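{- For every $\varepsilon>0$ there is a polynomial-time $(2+\varepsilon)$-approximation algorithm for budget-restrained makespan minimization in Server Cloud Scheduling on extended chain task graphs: given an instance and a budget $b$, it outputs a valid schedule with cost at most $b$ whose makespan is at most $(2+\varepsilon)$ times the minimum makespan of a valid schedule with cost at most $b$.
   Context: Server Cloud Scheduling: the input is a directed acyclic task graph $G=(\mathcal{J},E)$ with exactly one source $s$ and one sink $t$; each job $j\in\mathcal{J}$ has a server processing time $p_s(j)\in\mathbb{N}_0$ and a cloud processing time $p_c(j)\in\mathbb{N}_0$, where $p_s(s)=p_s(t)=0$ and $p_c(s)=p_c(t)=\infty$; each edge $(i,j)\in E$ has a communication delay $c(i,j)\in\mathbb{N}_0$. There is one server machine (processing at most one job at a time) and unboundedly many cloud machines. A schedule is a partition $\mathcal{J}=\mathcal{J}_s\cup\mathcal{J}_c$ together with completion times $C:\mathcal{J}\to\mathbb{N}_0$; let $p_\pi(j)=p_s(j)$ if $j\in\mathcal{J}_s$ and $p_\pi(j)=p_c(j)$ if $j\in\mathcal{J}_c$. It is valid if (a) for distinct $i,j\in\mathcal{J}_s$: $C(i)\le C(j)-p_\pi(j)$ or $C(i)-p_\pi(i)\ge C(j)$; (b) for every edge $(i,j)$ with $i,j$ on the same side: $C(i)\le C(j)-p_\pi(j)$, and for every edge with $i,j$ on different sides: $C(i)+c(i,j)\le C(j)-p_\pi(j)$. The makespan is $C(t)$ and the cost is $\sum_{j\in\mathcal{J}_c}p_c(j)$. Extended chain: start from a chain $s=0\to1\to\dots\to n\to n+1=t$; for any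 subset of the chain edges $(j-1,j)$, remove the edge, add a set $\mathcal{J}_j$ of new jobs (a parallel subgraph), and for each $j'\in\mathcal{J}_j$ add edges $(j-1,j')$ and $(j',j)$. The resulting graph is an extended chain. -}

module Defs where

open import Data.Bool.Base using (Bool; true; false; if_then_else_)
open import Data.Fin.Base using (Fin; zero; suc; fromℕ; inject₁; toℕ)
open import Data.Integer.Base using (+_)
open import Data.List.Base as List using (List; []; _∷_)
open import Data.Maybe using (Is-just)
open import Data.Maybe.Base using (Maybe; just; nothing; zipWith)
open import Data.Nat.Base using (ℕ; zero; suc; _+_; _*_; _∸_; _^_; _≤_; _≤ᵇ_)
import Data.Nat.DivMod as ℕ
open import Data.Nat.Logarithm using (⌊log₂_⌋)
open import Data.Product.Base using (_×_; Σ; ∃-syntax)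
open import Data.Rational.Base as ℚ using (ℚ)
open import Data.Sum.Base using (_⊎_)
open import Data.Vec.Base using (Vec; lookup; []; _∷_)
import Data.Vec.Functional as Vector
open import Function.Bundles using (_⇔_; _↔_; module Inverse)
open import Relation.Binary.Construct.Closure.Transitive using (TransClosure)
open import Relation.Binary.Construct.Add.Supremum.NonStrict _≤_ using (_≤⁺_)
open import Relation.Binary.PropositionalEquality.Core using (_≡_; _≢_)
open import Relation.Nullary.Construct.Add.Supremum using (_⁺; ⊤⁺; [_])
open import Relation.Nullary.Negation.Core using (¬_)

-- ℕ ∪ {∞}, with ⊤⁺ as ∞.
ℕ∞ : Set
ℕ∞ = ℕ ⁺

infixl 6 _+∞_
_+∞_ : ℕ∞ → ℕ∞ → ℕ∞
_+∞_ = zipWith _+_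

record Instance : Set where
  field
    #jobs : ℕ

  Job : Set
  Job = Fin #jobs

  field
    s t     : Job
    p-s     : Job → ℕ
    p-c     : Job → ℕ∞
    -- delay i j is just c(i,j) if (i,j) is an edge, and nothing otherwise.
    delay   : Job → Job → Maybe ℕ

  Edge : Job → Job → Set
  Edge i j = Is-just (delay i j)

  field
    acyclic  : ∀ j → ¬ TransClosure Edge j j
    source   : ∀ j → (∀ i → ¬ Edge i j) ⇔ j ≡ s
    sink     : ∀ j → (∀ k → ¬ Edge j k) ⇔ j ≡ t
    p-s-s    : p-s s ≡ 0
    p-s-t    : p-s t ≡ 0
    p-c-∞    : ∀ j → p-c j ≡ ⊤⁺ ⇔ (j ≡ s ⊎ j ≡ t)

data Side : Set where
  server cloud : Side

module _ (I : Instance) where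
  open Instance I

  record Schedule : Set where
    field
      side : Job → Side
      C    : Job → ℕ

module _ {I : Instance} (σ : Schedule I) where
  open Instance I
  open Schedule σ

  p-π : Job → ℕ∞
  p-π j with side j
  ... | server = [ p-s j ]
  ... | cloud  = p-c j

  -- m ≤ C(j) - p_π(j), without truncated subtraction; false if p_π(j) = ∞.
  _≤start_ : ℕ → Job → Set
  m ≤start j = [ m ] +∞ p-π j ≤⁺ [ C j ]

  record Valid : Set where
    field
      machine  : ∀ i j → i ≢ j → side i ≡ server → side j ≡ server →
                 (C i ≤start j) ⊎ (C j ≤start i)
      same     : ∀ i j → Edge i j → side i ≡ side j → C i ≤start j
      across   : ∀ i j d → delay i j ≡ just d → side i ≢ side j →
                 (C i + d) ≤start j

  makespan : ℕ
  makespan = C t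

  cloudTime : Job → ℕ∞
  cloudTime j with side j
  ... | server = [ 0 ]
  ... | cloud  = p-c j

  cost : ℕ∞
  cost = Vector.foldr _+∞_ [ 0 ] cloudTime

  WithinBudget : ℕ → Set
  WithinBudget b = Valid × cost ≤⁺ [ b ]

-- The chain 0 → 1 → ⋯ → n+1 has the n+1 edges (inject₁ j, suc j), j : Fin (suc n).
-- Such an edge is kept if width j ≡ 0; otherwise it is replaced by width j
-- parallel jobs.  (Replacing an edge by the empty set would disconnect the
-- graph, contradicting uniqueness of source and sink.)
module _ {n : ℕ} (width : Fin (suc n) → ℕ) where

  data Node : Set where
    chain    : Fin (suc (suc n)) → Node
    parallel : (j : Fin (suc n)) → Fin (width j) → Node

  data _⇝_ : Node → Node → Set where
    kept : ∀ j → width j ≡ 0 → chain (inject₁ j) ⇝ chain (suc j)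
    fork : ∀ j x → chain (inject₁ j) ⇝ parallel j x
    join : ∀ j x → parallel j x ⇝ chain (suc j)

record IsExtendedChain (I : Instance) : Set where
  open Instance I
  field
    n     : ℕ
    width : Fin (suc n) → ℕ
    label : Node width ↔ Job

  open Inverse label using (to)

  field
    edges   : ∀ u v → _⇝_ width u v ⇔ Edge (to u) (to v)
    first-s : to (chain zero) ≡ s
    last-t  : to (chain (fromℕ (suc n))) ≡ t

-- Programs are closed syntax for a while-language over binary trees with
-- natural numbers at the leaves.  Tree operations copy pointers and have
-- unit cost; arithmetic is charged the bit length of its operands, as in the
-- logarithmic-cost random access machine.  An evaluation of cost τ
-- allocates at most τ tree cells, and the numbers it creates have bit length
-- O(τ + input size), so polynomial time here is polynomial time on Turing
-- machines.

data Val : Set where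
  nat  : ℕ → Val
  pair : Val → Val → Val

data Op : Set where
  add sub mul div leq : Op

-- De Bruijn syntax with n free variables.
data Exp (n : ℕ) : Set where
  var    : Fin n → Exp n
  lit    : ℕ → Exp n
  cons   : Exp n → Exp n → Exp n
  fst    : Exp n → Exp n
  snd    : Exp n → Exp n
  isPair : Exp n → Exp n
  op     : Op → Exp n → Exp n → Exp n
  cond   : Exp n → Exp n → Exp n → Exp n
  bind   : Exp n → Exp (suc n) → Exp n
  -- Call of a closed unary procedure.
  call   : Exp 1 → Exp n → Exp n
  -- while x₀ c e: starting from x := x₀, as long as c holds of x, set x := e;
  -- return x.  In c and e, the variable x has index zero.
  while  : Exp n → Exp (suc n) → Exp (suc n) → Exp n

Program : Set
Program = Exp 1

bits : ℕ → ℕ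
bits m = suc ⌊log₂ m ⌋

number : Val → ℕ
number (nat m)    = m
number (pair _ _) = 0

left right : Val → Val
left  (nat _)    = nat 0
left  (pair v _) = v
right (nat _)    = nat 0
right (pair _ w) = w

fromBool : Bool → Val
fromBool b = nat (if b then 1 else 0)

truth : Val → Bool
truth (nat zero)    = false
truth (nat (suc _)) = true
truth (pair _ _)    = true

pair? : Val → Bool
pair? (nat _)    = false
pair? (pair _ _) = true

apply : Op → ℕ → ℕ → Val
apply add k m       = nat (k + m)
apply sub k m       = nat (k ∸ m)
apply mul k m       = nat (k * m)
apply div k zero    = nat 0
apply div k (suc m) = nat (k ℕ./ suc m)
apply leq k m       = fromBool (k ≤ᵇ m)

opCost : Val → Val → ℕ
opCost v w = suc (bits (number v) + bits (number w))

-- ρ ⊢ e ⇓ v [ τ ]: in environment ρ, e evaluates to v at cost τ.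
-- ρ ⊢loop c , e from v ⇓ w [ τ ]: the same for a while loop whose variable
-- currently has the value v.
infix 4 _⊢_⇓_[_] _⊢loop_,_from_⇓_[_]

mutual

  data _⊢_⇓_[_] {n} (ρ : Vec Val n) : Exp n → Val → ℕ → Set where
    var    : ∀ x → ρ ⊢ var x ⇓ lookup ρ x [ 1 ]
    lit    : ∀ m → ρ ⊢ lit m ⇓ nat m [ 1 ]
    cons   : ∀ {e f v w τ υ} → ρ ⊢ e ⇓ v [ τ ] → ρ ⊢ f ⇓ w [ υ ] →
             ρ ⊢ cons e f ⇓ pair v w [ suc (τ + υ) ]
    fst    : ∀ {e v τ} → ρ ⊢ e ⇓ v [ τ ] → ρ ⊢ fst e ⇓ left v [ suc τ ]
    snd    : ∀ {e v τ} → ρ ⊢ e ⇓ v [ τ ] → ρ ⊢ snd e ⇓ right v [ suc τ ]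
    isPair : ∀ {e v τ} → ρ ⊢ e ⇓ v [ τ ] →
             ρ ⊢ isPair e ⇓ fromBool (pair? v) [ suc τ ]
    op     : ∀ {o e f v w τ υ} → ρ ⊢ e ⇓ v [ τ ] → ρ ⊢ f ⇓ w [ υ ] →
             ρ ⊢ op o e f ⇓ apply o (number v) (number w)
               [ opCost v w + (τ + υ) ]
    condᵗ  : ∀ {c e f v w τ υ} → ρ ⊢ c ⇓ v [ τ ] → truth v ≡ true →
             ρ ⊢ e ⇓ w [ υ ] → ρ ⊢ cond c e f ⇓ w [ suc (τ + υ) ]
    condᶠ  : ∀ {c e f v w τ υ} → ρ ⊢ c ⇓ v [ τ ] → truth v ≡ false →
             ρ ⊢ f ⇓ w [ υ ] → ρ ⊢ cond c e f ⇓ w [ suc (τ + υ) ]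
    bind   : ∀ {e f v w τ υ} → ρ ⊢ e ⇓ v [ τ ] → v ∷ ρ ⊢ f ⇓ w [ υ ] →
             ρ ⊢ bind e f ⇓ w [ suc (τ + υ) ]
    call   : ∀ {f e v w τ υ} → ρ ⊢ e ⇓ v [ τ ] → v ∷ [] ⊢ f ⇓ w [ υ ] →
             ρ ⊢ call f e ⇓ w [ suc (τ + υ) ]
    while  : ∀ {x₀ c e v w τ υ} → ρ ⊢ x₀ ⇓ v [ τ ] →
             ρ ⊢loop c , e from v ⇓ w [ υ ] →
             ρ ⊢ while x₀ c e ⇓ w [ suc (τ + υ) ]

  data _⊢loop_,_from_⇓_[_] {n} (ρ : Vec Val n) (c e : Exp (suc n)) :
       Val → Val → ℕ → Set where
    stop : ∀ {v b τ} → v ∷ ρ ⊢ c ⇓ b [ τ ] → truth b ≡ false →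
           ρ ⊢loop c , e from v ⇓ v [ suc τ ]
    step : ∀ {v b v′ w τ υ φ} → v ∷ ρ ⊢ c ⇓ b [ τ ] → truth b ≡ true →
           v ∷ ρ ⊢ e ⇓ v′ [ υ ] → ρ ⊢loop c , e from v′ ⇓ w [ φ ] →
           ρ ⊢loop c , e from v ⇓ w [ suc (τ + υ + φ) ]

-- Encoding length, with numbers in binary.
size : Val → ℕ
size (nat m)    = bits m
size (pair v w) = suc (size v + size w)

_on_outputs_within_ : Program → Val → Val → ℕ → Set
P on v outputs w within T = ∃[ τ ] (v ∷ [] ⊢ P ⇓ w [ τ ] × τ ≤ T)

encodeList : List Val → Val
encodeList = List.foldr pair (nat 0)

encodeMaybe : Maybe ℕ → Val
encodeMaybe nothing  = nat 0
encodeMaybe (just m) = pair (nat m) (nat 0)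

encodeSide : Side → Val
encodeSide server = nat 0
encodeSide cloud  = nat 1

tabulated : ∀ {n} → (Fin n → Val) → Val
tabulated f = encodeList (List.tabulate f)

encodeInput : Instance → ℕ → Val
encodeInput I b = encodeList
  ( nat #jobs
  ∷ nat (toℕ s)
  ∷ nat (toℕ t)
  ∷ tabulated (λ j → nat (p-s j))
  ∷ tabulated (λ j → encodeMaybe (p-c j))
  ∷ tabulated (λ i → tabulated (λ j → encodeMaybe (delay i j)))
  ∷ nat b
  ∷ [] )
  where open Instance I

encodeSchedule : ∀ {I} → Schedule I → Val
encodeSchedule σ = tabulated (λ j → pair (encodeSide (side j)) (nat (C j)))
  where open Schedule σ

fromℕℚ : ℕ → ℚ
fromℕℚ m = + m ℚ./ 1

-- σ is a solution for budget b whose makespan is at most α times the minimum.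
-- The minimum is over a nonempty set (process all jobs on the server at cost
-- 0), so being at most α times it is being at most α times every member.
record Approximates {I : Instance} (α : ℚ) (b : ℕ) (σ : Schedule I) : Set where
  field
    withinBudget : WithinBudget σ b
    ratio        : ∀ (σ′ : Schedule I) → WithinBudget σ′ b →
                   fromℕℚ (makespan σ) ℚ.≤ α ℚ.* fromℕℚ (makespan σ′)

-- A polynomial-time α-approximation algorithm for budget-restrained makespan
-- minimization on the class 𝒢 of instances.
record PolyTimeApproximation (𝒢 : Instance → Set) (α : ℚ) : Set where
  field
    program  : Program
    c k      : ℕ
    correct  : ∀ (I : Instance) → 𝒢 I → ∀ (b : ℕ) →
               Σ (Schedule I) λ σ →
               (program on encodeInput I b outputs encodeSchedule σ
                 within (c * size (encodeInput I b) ^ k + c))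
               × Approximates α b σ

{-# OPTIONS --safe #-}
module Submission where

-- Fix the side of every job, let D be the length of a longest path when the
-- server may process any number of jobs in parallel, and let L be the server
-- load.  Both are lower bounds for the makespan, and list scheduling achieves
-- D + L: a job starts at its longest-path time plus the load of the server jobs
-- preceding it in the order of these times.  Hence it suffices to minimise
-- D + L over the assignments of sides up to a factor 1 + ε/2.  Along an extended
-- chain, D is computed by a finite-state pass: one has to remember the side and
-- the completion time of the last chain node, and for both sides of the next
-- one, how long the parallel jobs delay it.  So D + L can be minimised by
-- dynamic programming over these states once times are rounded to multiples of
-- P / (d n), where n is the number of jobs, d depends only on ε, and P is the
-- largest power of two up to the optimum, found by trying all powers.

open import Defs
open import Data.Bool.Base using (Bool; true; false; if_then_else_) renaming (T to IsTrue)
open import Data.Empty using (⊥-elim)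
open import Data.Fin.Base using (Fin; zero; suc; toℕ; fromℕ; inject₁)
open import Data.Fin.Induction using (<-weakInduction)
import Data.Fin.Properties as Fin
import Data.Integer.Base as ℤ
import Data.Integer.Properties as ℤ
open import Data.List.Base as List using (List; []; _∷_; foldr; foldl; reverse; length; _++_; concatMap; map; replicate; downFrom; tabulate; allFin)
open import Data.List.Membership.Propositional using (_∈_; find; lose)
open import Data.List.Membership.Propositional.Properties
  using (∈-concatMap⁺; ∈-concatMap⁻; ∈-downFrom⁺; ∈-++⁺ʳ; ∈-++⁻; ∈-map⁺; ∈-map⁻; ∈-allFin; ∈-lookup)
open import Data.List.Membership.Propositional.Properties.WithK using (unique∧set⇒bag)
open import Data.List.Properties
  using (reverse-foldl; ++-is-foldr; ++-identityʳ; length-++; length-map; length-replicate; length-tabulate;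
         concatMap-map; concatMap-cong; map-concatMap; map-tabulate; map-++; map-∘; map-cong-local; tabulate-cong; ∷-injective)
open import Data.List.Relation.Binary.BagAndSetEquality using (∼bag⇒↭)
open import Data.List.Relation.Binary.Permutation.Propositional using (_↭_)
open import Data.List.Relation.Binary.Permutation.Propositional.Properties using () renaming (map⁺ to ↭-map⁺)
open import Data.List.Relation.Binary.Sublist.Propositional using (_⊆_; []; _∷_; _∷ʳ_)
open import Data.List.Relation.Binary.Sublist.Propositional.Properties using (All-resp-⊆)
open import Data.List.Relation.Unary.All as All using (All; []; _∷_)
open import Data.List.Relation.Unary.All.Properties
  using () renaming (++⁺ to All-++⁺; map⁺ to All-map⁺; map⁻ to All-map⁻)
open import Data.List.Relation.Unary.AllPairs using (AllPairs; []; _∷_)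
open import Data.List.Relation.Unary.Any using (here; there)
open import Data.List.Relation.Unary.Unique.Propositional using (Unique)
open import Data.List.Relation.Unary.Unique.Propositional.Properties
  using (allFin⁺; ++⁺) renaming (map⁺ to Unique-map⁺)
open import Data.Maybe.Base using (Maybe; just; nothing)
open import Data.Maybe.Relation.Unary.Any using (just)
open import Data.Nat.Base
open import Data.Nat.Coprimality using (Coprime)
open import Data.Nat.DivMod using (m/n≤m; m/n*n≤m; m≡m%n+[m/n]*n; m%n<n)
open import Data.Nat.Induction using (<-rec)
open import Data.Nat.ListAction using (sum)
open import Data.Nat.ListAction.Properties using (sum-↭)
open import Data.Nat.Logarithm using (⌊log₂_⌋; ⌊log₂⌋-mono-≤; ⌊log₂⌊n/2⌋⌋≡⌊log₂n⌋∸1)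
open import Data.Nat.Properties
open import Data.Nat.Tactic.RingSolver using (solve-∀)
open import Data.Product.Base using (Σ; _×_; _,_; proj₁; proj₂; ∃-syntax)
open import Data.Rational.Base as ℚ using (ℚ; 0ℚ; mkℚ)
import Data.Rational.Properties as ℚ
open import Data.Rational.Unnormalised.Base as ℚᵘ using (mkℚᵘ; *≤*)
import Data.Rational.Unnormalised.Properties as ℚᵘ
open import Data.Sum.Base using (_⊎_; inj₁; inj₂)
open import Data.Unit.Base using (⊤; tt)
open import Data.Vec.Base using (Vec; lookup) renaming ([] to []ᵥ; _∷_ to _∷ᵥ_)
import Data.Vec.Functional as Vector
open import Function.Base using (_∘_; id; flip; case_of_)
open import Function.Bundles using (Inverse; Equivalence; mk⇔)
open import Relation.Binary.Construct.Add.Supremum.NonStrict _≤_ using (_≤⁺_; [_]; [≤]-injective)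
open import Relation.Binary.Construct.Closure.Transitive using (TransClosure; [_]) renaming (_∷ʳ_ to _▻_)
open import Relation.Binary.Definitions using (tri<; tri≈; tri>)
open import Relation.Binary.PropositionalEquality hiding ([_]; J)
open import Relation.Nullary using (yes; no; Dec; does)

-- Binary length

-- Rounding touches times only: costs are added exactly, so every plan in the table meets the
-- budget. Errors add up along the chain but not across a parallel subgraph, since a maximum is no
-- less exact than its arguments; this leaves at most 4 units for the clock and 1 for the load per
-- job. With units of P / (d n) and P at most the value V, the total error is at most 5 V / d, that
-- is 10 / d times the optimum after the factor 2 of the lower bounds. Times are capped at 2 d n
-- units, so that states stay few for a badly chosen P as well; for the right P, where V < 2 P, the
-- cap is not reached.
--
-- The other obstacle is the running time of a concrete program. Each function of the algorithm has
-- a twin in `Tm`, whose bounds are assembled along with its code. Composition keeps bounds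
-- polynomial, iteration need not: the work lies in bounding what folds accumulate.
--
-- List scheduling respects delays because the added server load never decreases with the rank, so a
-- later job is shifted at least as far as an earlier one.

module _ where
  private
    n<2+2⌊n/2⌋ : ∀ n → n < 2 * suc ⌊ n /2⌋
    n<2+2⌊n/2⌋ zero          = s≤s z≤n
    n<2+2⌊n/2⌋ (suc zero)    = s≤s (s≤s z≤n)
    n<2+2⌊n/2⌋ (suc (suc n)) = subst (suc (suc n) <_) (sym (*-suc 2 (suc ⌊ n /2⌋)))
                                 (s≤s (s≤s (n<2+2⌊n/2⌋ n)))

    2⌊n/2⌋≤n : ∀ n → 2 * ⌊ n /2⌋ ≤ n
    2⌊n/2⌋≤n zero          = z≤n
    2⌊n/2⌋≤n (suc zero)    = z≤n
    2⌊n/2⌋≤n (suc (suc n)) = subst (_≤ suc (suc n)) (sym (*-suc 2 ⌊ n /2⌋))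
                               (s≤s (s≤s (2⌊n/2⌋≤n n)))

    Bracket : ℕ → Set
    Bracket n = n < 2 ^ suc ⌊log₂ n ⌋ × (1 ≤ n → 2 ^ ⌊log₂ n ⌋ ≤ n)

    bracket : ∀ n → Bracket n
    bracket = <-rec Bracket go
      where
      go : ∀ n → (∀ {m} → m < n → Bracket m) → Bracket n
      go zero       ih = s≤s z≤n , λ ()
      go (suc zero) ih = s≤s (s≤s z≤n) , λ _ → s≤s z≤n
      go n@(suc (suc k)) ih with ih {suc ⌊ k /2⌋} (s≤s (s≤s (⌊n/2⌋≤n k)))
      ... | hi , lo = upper , λ _ → lower
        where
        l = ⌊log₂ n ⌋
        1≤l : 1 ≤ l
        1≤l = ⌊log₂⌋-mono-≤ {2} {n} (s≤s (s≤s z≤n))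
        eq : suc ⌊log₂ ⌊ n /2⌋ ⌋ ≡ l
        eq = trans (cong suc (⌊log₂⌊n/2⌋⌋≡⌊log₂n⌋∸1 n)) (m+[n∸m]≡n 1≤l)
        upper : n < 2 ^ suc l
        upper = ≤-trans (n<2+2⌊n/2⌋ n)
                  (*-monoʳ-≤ 2 (subst (λ x → suc ⌊ n /2⌋ ≤ 2 ^ x) eq hi))
        lower : 2 ^ l ≤ n
        lower = subst (λ x → 2 ^ x ≤ n) eq
                  (≤-trans (*-monoʳ-≤ 2 (lo (s≤s z≤n))) (2⌊n/2⌋≤n n))

  n<2^bits : ∀ n → n < 2 ^ bits n
  n<2^bits n = proj₁ (bracket n)

  2^⌊log₂n⌋≤n : ∀ n → 1 ≤ n → 2 ^ ⌊log₂ n ⌋ ≤ n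
  2^⌊log₂n⌋≤n n = proj₂ (bracket n)

2^-cancel-< : ∀ {i j} → 2 ^ i < 2 ^ j → i < j
2^-cancel-< {i} {j} lt with i <? j
... | yes i<j = i<j
... | no  i≮j = ⊥-elim (<⇒≱ lt (^-monoʳ-≤ 2 (≮⇒≥ i≮j)))

n<2^k⇒bits≤k : ∀ {n k} → 1 ≤ k → n < 2 ^ k → bits n ≤ k
n<2^k⇒bits≤k {zero}  1≤k _  = 1≤k
n<2^k⇒bits≤k {suc n} _   lt = 2^-cancel-< (≤-<-trans (2^⌊log₂n⌋≤n (suc n) (s≤s z≤n)) lt)

bits-mono : ∀ {m n} → m ≤ n → bits m ≤ bits n
bits-mono m≤n = s≤s (⌊log₂⌋-mono-≤ m≤n)

2≤2^bits : ∀ n → 2 ≤ 2 ^ bits n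
2≤2^bits n = *-monoʳ-≤ 2 (m^n>0 2 ⌊log₂ n ⌋)

a+b≤a*b : ∀ {a b} → 2 ≤ a → 2 ≤ b → a + b ≤ a * b
a+b≤a*b {suc zero} (s≤s ()) _
a+b≤a*b {suc (suc a)} {b} _ 2≤b = begin
  suc (suc a) + b        ≡⟨ +-comm (suc (suc a)) b ⟩
  b + suc (suc a)        ≤⟨ +-monoʳ-≤ b (+-mono-≤ 2≤b (m≤m*n a b {{>-nonZero (≤-trans (s≤s z≤n) 2≤b)}})) ⟩
  b + (b + a * b)        ∎
  where open ≤-Reasoning

bits-* : ∀ m n → bits (m * n) ≤ bits m + bits n
bits-* m n = n<2^k⇒bits≤k (s≤s z≤n) (begin-strict
  m * n                 ≤⟨ *-monoʳ-≤ m (<⇒≤ (n<2^bits n)) ⟩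
  m * 2 ^ bits n        <⟨ *-monoˡ-< (2 ^ bits n) {{m^n≢0 2 (bits n)}} (n<2^bits m) ⟩
  2 ^ bits m * 2 ^ bits n ≡⟨ ^-distribˡ-+-* 2 (bits m) (bits n) ⟨
  2 ^ (bits m + bits n) ∎)
  where open ≤-Reasoning

-- Both powers of two are at least 2, and then their sum is at most their product. Addition thus
-- obeys the same bound as multiplication, and `bits-apply` can treat all operations alike.
bits-+ : ∀ m n → bits (m + n) ≤ bits m + bits n
bits-+ m n = n<2^k⇒bits≤k (s≤s z≤n) (begin-strict
  m + n                     <⟨ +-mono-< (n<2^bits m) (n<2^bits n) ⟩
  2 ^ bits m + 2 ^ bits n   ≤⟨ a+b≤a*b (2≤2^bits m) (2≤2^bits n) ⟩
  2 ^ bits m * 2 ^ bits n   ≡⟨ ^-distribˡ-+-* 2 (bits m) (bits n) ⟨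
  2 ^ (bits m + bits n)     ∎)
  where open ≤-Reasoning

n<2^n : ∀ n → n < 2 ^ n
n<2^n zero    = s≤s z≤n
n<2^n (suc n) = begin-strict
  suc n           <⟨ s≤s (n<2^n n) ⟩
  suc (2 ^ n)     ≤⟨ +-monoˡ-≤ (2 ^ n) (m^n>0 2 n) ⟩
  2 ^ n + 2 ^ n   ≡⟨ cong (2 ^ n +_) (+-identityʳ (2 ^ n)) ⟨
  2 ^ suc n       ∎
  where open ≤-Reasoning

bits≤suc : ∀ n → bits n ≤ suc n
bits≤suc n = n<2^k⇒bits≤k (s≤s z≤n) (<-trans (n<2^n n) (^-monoʳ-< 2 (s≤s (s≤s z≤n)) (n<1+n n)))

bits-apply : ∀ o m n → size (apply o m n) ≤ bits m + bits n
bits-apply add m n       = bits-+ m n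
bits-apply sub m n       = ≤-trans (bits-mono (m∸n≤m m n)) (m≤m+n _ _)
bits-apply mul m n       = bits-* m n
bits-apply div m zero    = s≤s z≤n
bits-apply div m (suc n) = ≤-trans (bits-mono (m/n≤m m (suc n))) (m≤m+n _ _)
bits-apply leq m n with m ≤ᵇ n
... | true  = s≤s z≤n
... | false = s≤s z≤n

≤⇒≤ᵇ≡true : ∀ {m n} → m ≤ n → (m ≤ᵇ n) ≡ true
≤⇒≤ᵇ≡true {m} {n} m≤n with m ≤ᵇ n | ≤⇒≤ᵇ m≤n
... | true | _ = refl

≤ᵇ≡true⇒≤ : ∀ {m n} → (m ≤ᵇ n) ≡ true → m ≤ n
≤ᵇ≡true⇒≤ {m} {n} eq = ≤ᵇ⇒≤ m n (subst IsTrue (sym eq) tt)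

<⇒≰ᵇ : ∀ {m n} → n < m → (m ≤ᵇ n) ≡ false
<⇒≰ᵇ {m} {n} n<m with m ≤ᵇ n in eq
... | false = refl
... | true  = ⊥-elim (<⇒≱ n<m (≤ᵇ≡true⇒≤ eq))

≤ᵇ≡false⇒> : ∀ {m n} → (m ≤ᵇ n) ≡ false → n < m
≤ᵇ≡false⇒> {m} {n} eq = ≰⇒> λ m≤n → case trans (sym eq) (≤⇒≤ᵇ≡true m≤n) of λ ()

-- Polynomials

infixl 6 _⊕_
infixl 7 _⊛_
-- Bounds are kept as syntax: every such polynomial is monotone, and running one term after another
-- is substitution. The form c n^k demanded by the theorem is extracted only once, by
-- `monomial-bound`.
data Pol : Set where
  # : ℕ → Pol
  X : Pol
  _⊕_ _⊛_ : Pol → Pol → Pol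

eval : Pol → ℕ → ℕ
eval (# k)   n = k
eval X       n = n
eval (p ⊕ q) n = eval p n + eval q n
eval (p ⊛ q) n = eval p n * eval q n

eval-mono : ∀ p {m n} → m ≤ n → eval p m ≤ eval p n
eval-mono (# k)   m≤n = ≤-refl
eval-mono X       m≤n = m≤n
eval-mono (p ⊕ q) m≤n = +-mono-≤ (eval-mono p m≤n) (eval-mono q m≤n)
eval-mono (p ⊛ q) m≤n = *-mono-≤ (eval-mono p m≤n) (eval-mono q m≤n)

infixl 8 _[_]ₚ
_[_]ₚ : Pol → Pol → Pol
(# k)   [ r ]ₚ = # k
X       [ r ]ₚ = r
(p ⊕ q) [ r ]ₚ = p [ r ]ₚ ⊕ q [ r ]ₚ
(p ⊛ q) [ r ]ₚ = p [ r ]ₚ ⊛ q [ r ]ₚ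

eval-[] : ∀ p r n → eval (p [ r ]ₚ) n ≡ eval p (eval r n)
eval-[] (# k)   r n = refl
eval-[] X       r n = refl
eval-[] (p ⊕ q) r n = cong₂ _+_ (eval-[] p r n) (eval-[] q r n)
eval-[] (p ⊛ q) r n = cong₂ _*_ (eval-[] p r n) (eval-[] q r n)

eval-≤-[] : ∀ p r {m n} → m ≤ eval r n → eval p m ≤ eval (p [ r ]ₚ) n
eval-≤-[] p r {m} {n} le = ≤-trans (eval-mono p le) (≤-reflexive (sym (eval-[] p r n)))

-- For n ≥ 1 exponents may be raised, so the summands of a sum can share the exponent k + l.
monomial-bound : ∀ p → ∃[ c ] ∃[ k ] (∀ n → 1 ≤ n → eval p n ≤ c * n ^ k)
monomial-bound (# k) = k , 0 , λ n _ → ≤-reflexive (sym (*-identityʳ k))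
monomial-bound X     = 1 , 1 , λ n _ → ≤-reflexive (sym (trans (*-identityˡ _) (*-identityʳ n)))
monomial-bound (p ⊕ q) with monomial-bound p | monomial-bound q
... | c , k , hp | d , l , hq = c + d , k + l , λ n 1≤n → begin
  eval p n + eval q n                   ≤⟨ +-mono-≤ (hp n 1≤n) (hq n 1≤n) ⟩
  c * n ^ k + d * n ^ l                 ≤⟨ +-mono-≤ (*-monoʳ-≤ c (^-monoʳ-≤ n {{>-nonZero 1≤n}} (m≤m+n k l)))
                                                    (*-monoʳ-≤ d (^-monoʳ-≤ n {{>-nonZero 1≤n}} (m≤n+m l k))) ⟩
  c * n ^ (k + l) + d * n ^ (k + l)     ≡⟨ *-distribʳ-+ (n ^ (k + l)) c d ⟨
  (c + d) * n ^ (k + l)                 ∎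
  where open ≤-Reasoning
monomial-bound (p ⊛ q) with monomial-bound p | monomial-bound q
... | c , k , hp | d , l , hq = c * d , k + l , λ n 1≤n → begin
  eval p n * eval q n                   ≤⟨ *-mono-≤ (hp n 1≤n) (hq n 1≤n) ⟩
  (c * n ^ k) * (d * n ^ l)             ≡⟨ [m*n]*[o*p]≡[m*o]*[n*p] c (n ^ k) d (n ^ l) ⟩
  (c * d) * (n ^ k * n ^ l)             ≡⟨ cong ((c * d) *_) (^-distribˡ-+-* n k l) ⟨
  (c * d) * n ^ (k + l)                 ∎
  where open ≤-Reasoning

-- Terms

infixr 7 _⊗_
data Ty : Set where
  num bool : Ty
  _⊗_      : Ty → Ty → Ty
  list     : Ty → Ty

El : Ty → Set
El num      = ℕ
El bool     = Bool
El (a ⊗ b)  = El a × El b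
El (list a) = List (El a)

encL : {A : Set} → (A → Val) → List A → Val
encL f []       = nat 0
encL f (x ∷ xs) = pair (f x) (encL f xs)

enc : ∀ a → El a → Val
enc num      n       = nat n
enc bool     b       = fromBool b
enc (a ⊗ b)  (x , y) = pair (enc a x) (enc b y)
enc (list a) xs      = encL (enc a) xs

∥_∥ : ∀ {a} → El a → ℕ
∥_∥ {a} x = size (enc a x)

1≤size : ∀ v → 1 ≤ size v
1≤size (nat m)    = s≤s z≤n
1≤size (pair v w) = s≤s z≤n

truth-fromBool : ∀ b → truth (fromBool b) ≡ b
truth-fromBool true  = refl
truth-fromBool false = refl

Ctx : Set
Ctx = List Ty

infix 4 _∋_
data _∋_ : Ctx → Ty → Set where
  here : ∀ {a Γ} → a ∷ Γ ∋ a
  there : ∀ {a b Γ} → Γ ∋ a → b ∷ Γ ∋ a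

Env : Ctx → Set
Env []      = ⊤
Env (a ∷ Γ) = El a × Env Γ

infixl 9 _!_
_!_ : ∀ {Γ a} → Env Γ → Γ ∋ a → El a
(v , ρ) ! here   = v
(v , ρ) ! there x = ρ ! x

∣_∣ₑ : ∀ {Γ} → Env Γ → ℕ
∣_∣ₑ {[]}    _       = 0
∣_∣ₑ {a ∷ Γ} (v , ρ) = size (enc a v) + ∣ ρ ∣ₑ

size-! : ∀ {Γ a} (ρ : Env Γ) (x : Γ ∋ a) → size (enc a (ρ ! x)) ≤ ∣ ρ ∣ₑ
size-! (v , ρ) here     = m≤m+n _ _
size-! (v , ρ) (there x) = ≤-trans (size-! ρ x) (m≤n+m _ _)

Place : Ctx → ℕ → Set
Place Γ n = ∀ {a} → Γ ∋ a → Fin n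

infix 4 _at_represents_
_at_represents_ : ∀ {Γ n} → Vec Val n → Place Γ n → Env Γ → Set
η at m represents ρ = ∀ {a} (x : _ ∋ a) → lookup η (m x) ≡ enc a (ρ ! x)

infix 4 _⊢_⇓_within_
_⊢_⇓_within_ : ∀ {n} → Vec Val n → Exp n → Val → ℕ → Set
η ⊢ e ⇓ v within T = ∃[ τ ] (η ⊢ e ⇓ v [ τ ]) × τ ≤ T

-- An Agda function together with code computing it whose running time and
-- output size are bounded by a polynomial.  The variables of the context may
-- sit anywhere in the run-time environment, which makes weakening free.
record Tm (Γ : Ctx) (a : Ty) : Set where
  field
    ⟦_⟧   : Env Γ → El a
    code  : ∀ {n} → Place Γ n → Exp n
    pol   : Pol
    runs  : ∀ {n} (m : Place Γ n) (η : Vec Val n) ρ → η at m represents ρ →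
            η ⊢ code m ⇓ enc a (⟦_⟧ ρ) within eval pol ∣ ρ ∣ₑ
    small : ∀ ρ → size (enc a (⟦_⟧ ρ)) ≤ eval pol ∣ ρ ∣ₑ

open Tm public

weaken-≤ : ∀ {n} {η : Vec Val n} {e v T U} → T ≤ U → η ⊢ e ⇓ v within T → η ⊢ e ⇓ v within U
weaken-≤ T≤U (τ , d , le) = τ , d , ≤-trans le T≤U

infixl 4 _extended
_extended : ∀ {Γ n a} → Place Γ n → Place (a ∷ Γ) (suc n)
(m extended) here     = zero
(m extended) (there x) = suc (m x)

extend-represents : ∀ {Γ n a} {m : Place Γ n} {η : Vec Val n} {ρ : Env Γ} {v : El a} →
                    η at m represents ρ → (enc a v ∷ᵥ η) at (m extended) represents (v , ρ)
extend-represents r here     = refl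
extend-represents r (there x) = r x

-- Keeps the type checker from unfolding the bounds.
opaque
  sealed : Pol → Pol
  sealed p = p

  eval-sealed : ∀ p n → eval p n ≤ eval (sealed p) n
  eval-sealed p n = ≤-refl

-- Presents a term under a hand-written function equal to its denotation. Later proofs about the
-- algorithm see this function only, and the accumulated bound is hidden behind `sealed`.
as : ∀ {Γ a} (t : Tm Γ a) (f : Env Γ → El a) → (∀ ρ → ⟦ t ⟧ ρ ≡ f ρ) → Tm Γ a
as t f eq .⟦_⟧  = f
as t f eq .code = code t
as t f eq .pol  = sealed (pol t)
as {a = a} t f eq .runs m η ρ r =
  subst (λ y → η ⊢ code t m ⇓ enc a y within eval (sealed (pol t)) ∣ ρ ∣ₑ) (eq ρ)
    (weaken-≤ (eval-sealed (pol t) ∣ ρ ∣ₑ) (runs t m η ρ r))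
as {a = a} t f eq .small ρ = subst (λ y → size (enc a y) ≤ eval (sealed (pol t)) ∣ ρ ∣ₑ) (eq ρ)
  (≤-trans (small t ρ) (eval-sealed (pol t) ∣ ρ ∣ₑ))

` : ∀ {Γ a} → Γ ∋ a → Tm Γ a
` x .⟦_⟧ ρ  = ρ ! x
` x .code m = var (m x)
` x .pol    = # 1 ⊕ X
` x .runs m η ρ r = 1 , subst (λ v → η ⊢ var (m x) ⇓ v [ 1 ]) (r x) (var (m x)) , m≤m+n 1 _
` x .small ρ = ≤-trans (size-! ρ x) (n≤1+n _)

literal : ∀ {Γ} → ℕ → Tm Γ num
literal k .⟦_⟧ ρ       = k
literal k .code m      = lit k
literal k .pol         = # (bits k)
literal k .runs m η ρ r = 1 , lit k , s≤s z≤n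
literal k .small ρ     = ≤-refl

nil : ∀ {Γ a} → Tm Γ (list a)
nil .⟦_⟧ ρ        = []
nil .code m       = lit 0
nil .pol          = # 1
nil .runs m η ρ r = 1 , lit 0 , ≤-refl
nil .small ρ      = ≤-refl

boolean : ∀ {Γ} → Bool → Tm Γ bool
boolean b .⟦_⟧ ρ        = b
boolean b .code m       = lit (if b then 1 else 0)
boolean b .pol          = # 1
boolean b .runs m η ρ r = 1 , lit _ , ≤-refl
boolean true  .small ρ  = ≤-refl
boolean false .small ρ  = ≤-refl

module _ {Γ a b c} (f : El a → El b → El c) (eq : ∀ x y → pair (enc a x) (enc b y) ≡ enc c (f x y))
         (t : Tm Γ a) (u : Tm Γ b) where
  cell : Tm Γ c
  cell .⟦_⟧ ρ  = f (⟦ t ⟧ ρ) (⟦ u ⟧ ρ)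
  cell .code m = cons (code t m) (code u m)
  cell .pol    = # 1 ⊕ (pol t ⊕ pol u)
  cell .runs m η ρ r with runs t m η ρ r | runs u m η ρ r
  ... | τ , d , τ≤ | υ , e , υ≤ =
    suc (τ + υ) , subst (λ v → η ⊢ _ ⇓ v [ suc (τ + υ) ]) (eq _ _) (cons d e) , s≤s (+-mono-≤ τ≤ υ≤)
  cell .small ρ = subst (λ v → size v ≤ eval (# 1 ⊕ (pol t ⊕ pol u)) ∣ ρ ∣ₑ) (eq _ _) (s≤s (+-mono-≤ (small t ρ) (small u ρ)))

infixr 5 _,ₜ_ _∷ₜ_
_,ₜ_ : ∀ {Γ a b} → Tm Γ a → Tm Γ b → Tm Γ (a ⊗ b)
_,ₜ_ = cell _,_ λ _ _ → refl

_∷ₜ_ : ∀ {Γ a} → Tm Γ a → Tm Γ (list a) → Tm Γ (list a)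
_∷ₜ_ = cell _∷_ λ _ _ → refl

first : ∀ {Γ a b} → Tm Γ (a ⊗ b) → Tm Γ a
first t .⟦_⟧ ρ  = proj₁ (⟦ t ⟧ ρ)
first t .code m = fst (code t m)
first t .pol    = # 1 ⊕ pol t
first t .runs m η ρ r with runs t m η ρ r
... | τ , d , τ≤ = suc τ , fst d , s≤s τ≤
first t .small ρ = ≤-trans (≤-trans (m≤m+n _ _) (n≤1+n _)) (≤-trans (small t ρ) (n≤1+n _))

second : ∀ {Γ a b} → Tm Γ (a ⊗ b) → Tm Γ b
second t .⟦_⟧ ρ  = proj₂ (⟦ t ⟧ ρ)
second t .code m = snd (code t m)
second t .pol    = # 1 ⊕ pol t
second t .runs m η ρ r with runs t m η ρ r
... | τ , d , τ≤ = suc τ , snd d , s≤s τ≤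
second t .small ρ = ≤-trans (≤-trans (m≤n+m _ _) (n≤1+n _)) (≤-trans (small t ρ) (n≤1+n _))

module _ {Γ a} (o : Op) (f : ℕ → ℕ → El a) (eq : ∀ x y → apply o x y ≡ enc a (f x y))
         (t u : Tm Γ num) where
  arithmetic : Tm Γ a
  arithmetic .⟦_⟧ ρ  = f (⟦ t ⟧ ρ) (⟦ u ⟧ ρ)
  arithmetic .code m = op o (code t m) (code u m)
  -- One pair bounds the bit lengths charged by `opCost`, by way of `small`; the other bounds the
  -- evaluation of the operands.
  arithmetic .pol    = # 1 ⊕ (pol t ⊕ pol u) ⊕ (pol t ⊕ pol u)
  arithmetic .runs m η ρ r with runs t m η ρ r | runs u m η ρ r
  ... | τ , d , τ≤ | υ , e , υ≤ =
    _ , subst (λ v → η ⊢ _ ⇓ v [ _ ]) (eq _ _) (op d e) ,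
    +-mono-≤ (s≤s (+-mono-≤ (small t ρ) (small u ρ))) (+-mono-≤ τ≤ υ≤)
  arithmetic .small ρ = subst (λ v → size v ≤ _) (eq _ _)
    (≤-trans (bits-apply o _ _)
      (≤-trans (+-mono-≤ (small t ρ) (small u ρ)) (≤-trans (n≤1+n _) (m≤m+n _ _))))

infixl 6 _+ₜ_ _∸ₜ_
infixl 7 _*ₜ_
infix  5 _≤ₜ_
_+ₜ_ _∸ₜ_ _*ₜ_ _/ₜ_ : ∀ {Γ} → Tm Γ num → Tm Γ num → Tm Γ num
_+ₜ_ = arithmetic add _+_ λ _ _ → refl
_∸ₜ_ = arithmetic sub _∸_ λ _ _ → refl
_*ₜ_ = arithmetic mul _*_ λ _ _ → refl

quotient : ℕ → ℕ → ℕ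
quotient m zero    = 0
quotient m (suc n) = m / suc n

_/ₜ_ = arithmetic div quotient λ { _ zero → refl ; _ (suc _) → refl }

_≤ₜ_ : ∀ {Γ} → Tm Γ num → Tm Γ num → Tm Γ bool
_≤ₜ_ = arithmetic leq _≤ᵇ_ λ _ _ → refl

infix 4 if_then_else_fi
if_then_else_fi : ∀ {Γ a} → Tm Γ bool → Tm Γ a → Tm Γ a → Tm Γ a
if_then_else_fi c t u .⟦_⟧ ρ  = if ⟦ c ⟧ ρ then ⟦ t ⟧ ρ else ⟦ u ⟧ ρ
if_then_else_fi c t u .code m = cond (code c m) (code t m) (code u m)
if_then_else_fi c t u .pol    = # 1 ⊕ (pol c ⊕ (pol t ⊕ pol u))
if_then_else_fi c t u .runs m η ρ r with ⟦ c ⟧ ρ | runs c m η ρ r | runs t m η ρ r | runs u m η ρ r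
... | true  | τ , d , τ≤ | υ , e , υ≤ | _ =
  _ , condᵗ d refl e , s≤s (+-mono-≤ τ≤ (≤-trans υ≤ (m≤m+n _ _)))
... | false | τ , d , τ≤ | _ | υ , e , υ≤ =
  _ , condᶠ d refl e , s≤s (+-mono-≤ τ≤ (≤-trans υ≤ (m≤n+m _ _)))
if_then_else_fi c t u .small ρ with ⟦ c ⟧ ρ
... | true  = ≤-trans (small t ρ) (≤-trans (≤-trans (m≤m+n _ _) (m≤n+m _ (eval (pol c) ∣ ρ ∣ₑ))) (n≤1+n _))
... | false = ≤-trans (small u ρ) (≤-trans (≤-trans (m≤n+m _ (eval (pol t) ∣ ρ ∣ₑ)) (m≤n+m _ (eval (pol c) ∣ ρ ∣ₑ))) (n≤1+n _))

letₜ : ∀ {Γ a b} → Tm Γ a → Tm (a ∷ Γ) b → Tm Γ b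
letₜ t u .⟦_⟧ ρ  = ⟦ u ⟧ (⟦ t ⟧ ρ , ρ)
letₜ t u .code m = bind (code t m) (code u (m extended))
letₜ t u .pol    = # 1 ⊕ (pol t ⊕ pol u [ pol t ⊕ X ]ₚ)
letₜ t u .runs m η ρ r with runs t m η ρ r | runs u (m extended) _ (⟦ t ⟧ ρ , ρ) (extend-represents r)
... | τ , d , τ≤ | υ , e , υ≤ =
  _ , bind d e , s≤s (+-mono-≤ τ≤ (≤-trans υ≤ (eval-≤-[] (pol u) _ (+-monoˡ-≤ _ (small t ρ)))))
letₜ t u .small ρ =
  ≤-trans (small u (⟦ t ⟧ ρ , ρ))
    (≤-trans (eval-≤-[] (pol u) (pol t ⊕ X) (+-monoˡ-≤ _ (small t ρ)))
      (≤-trans (m≤n+m _ _) (n≤1+n _)))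

match : {A B : Set} → List A → B → (A → List A → B) → B
match []       n c = n
match (x ∷ xs) n c = c x xs

matchₜ : ∀ {Γ a b} → Tm Γ (list a) → Tm Γ b → Tm (a ∷ list a ∷ Γ) b → Tm Γ b
matchₜ {Γ} {a} {b} l t u = record
  { ⟦_⟧   = λ ρ → match (⟦ l ⟧ ρ) (⟦ t ⟧ ρ) (λ x xs → ⟦ u ⟧ (x , xs , ρ))
  ; code  = exp
  ; pol   = p
  ; runs  = λ m η ρ r → evaluate m η ρ r (⟦ l ⟧ ρ) (small l ρ) (runs l m η ρ r)
  ; small = λ ρ → bounded ρ (⟦ l ⟧ ρ) (small l ρ)
  }
  where
  place : ∀ {n} → Place Γ n → Place (a ∷ list a ∷ Γ) (suc (suc (suc n)))
  place m here         = zero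
  place m (there here)     = suc zero
  -- Index two holds the list itself, from which head and tail are projected, so the context starts
  -- at index three.
  place m (there (there x)) = suc (suc (suc (m x)))
  exp : ∀ {n} → Place Γ n → Exp n
  exp m = cond (isPair (code l m))
            (bind (code l m) (bind (snd (var zero)) (bind (fst (var (suc zero))) (code u (place m)))))
            (code t m)
  p = # 10 ⊕ (pol l ⊕ pol l) ⊕ (pol t ⊕ pol u [ pol l ⊕ X ]ₚ)
  fits : ∀ x xs S n → suc (size x + size xs) ≤ S → size x + (size xs + n) ≤ S + n
  fits x xs S n le = ≤-trans (≤-reflexive (sym (+-assoc (size x) _ n))) (+-monoˡ-≤ n (≤-trans (n≤1+n _) le))
  bounded : ∀ ρ (ys : List (El a)) → size (enc (list a) ys) ≤ eval (pol l) ∣ ρ ∣ₑ →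
            size (enc b (match ys (⟦ t ⟧ ρ) (λ x xs → ⟦ u ⟧ (x , xs , ρ)))) ≤ eval p ∣ ρ ∣ₑ
  bounded ρ [] le = ≤-trans (small t ρ) (≤-trans (m≤m+n _ _) (m≤n+m _ (eval (# 10 ⊕ (pol l ⊕ pol l)) ∣ ρ ∣ₑ)))
  bounded ρ (x ∷ xs) le = ≤-trans (small u (x , xs , ρ))
    (≤-trans (eval-≤-[] (pol u) (pol l ⊕ X) (fits (enc a x) (enc (list a) xs) _ _ le))
      (≤-trans (m≤n+m _ (eval (pol t) ∣ ρ ∣ₑ)) (m≤n+m _ (eval (# 10 ⊕ (pol l ⊕ pol l)) ∣ ρ ∣ₑ))))
  evaluate : ∀ {n} (m : Place Γ n) (η : Vec Val n) ρ → η at m represents ρ →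
             ∀ ys → size (enc (list a) ys) ≤ eval (pol l) ∣ ρ ∣ₑ →
             η ⊢ code l m ⇓ enc (list a) ys within eval (pol l) ∣ ρ ∣ₑ →
             η ⊢ exp m ⇓ enc b (match ys (⟦ t ⟧ ρ) (λ x xs → ⟦ u ⟧ (x , xs , ρ))) within eval p ∣ ρ ∣ₑ
  evaluate m η ρ r [] le (τ , d , τ≤) with runs t m η ρ r
  ... | υ , e , υ≤ = _ , condᶠ (isPair d) refl e ,
    s≤s (s≤s (+-mono-≤ {τ} (≤-trans τ≤ (≤-trans (m≤m+n _ (eval (pol l) ∣ ρ ∣ₑ)) (m≤n+m _ 8))) (≤-trans υ≤ (m≤m+n _ _))))
  evaluate m η ρ r (x ∷ xs) le (τ , d , τ≤)
    with runs u (place m) (enc a x ∷ᵥ enc (list a) xs ∷ᵥ enc (list a) (x ∷ xs) ∷ᵥ η) (x , xs , ρ)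
           (λ { here → refl ; (there here) → refl ; (there (there y)) → r y })
  ... | υ , e , υ≤ = _ , condᵗ (isPair d) refl (bind d (bind (snd (var zero)) (bind (fst (var (suc zero))) e))) , (begin
    suc (suc τ + suc (τ + suc (2 + suc (2 + υ))))  ≡⟨ lem τ υ ⟩
    9 + (τ + τ) + υ                                ≤⟨ +-mono-≤ (+-mono-≤ (n≤1+n 9) (+-mono-≤ τ≤ τ≤)) υ≤ ⟩
    10 + (L + L) + eval (pol u) _                  ≤⟨ +-monoʳ-≤ (10 + (L + L)) (eval-≤-[] (pol u) (pol l ⊕ X) (fits (enc a x) (enc (list a) xs) _ _ le)) ⟩
    10 + (L + L) + eval (pol u [ pol l ⊕ X ]ₚ) _   ≤⟨ +-monoʳ-≤ (10 + (L + L)) (m≤n+m _ (eval (pol t) ∣ ρ ∣ₑ)) ⟩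
    eval p ∣ ρ ∣ₑ                                  ∎)
    where
    open ≤-Reasoning
    L = eval (pol l) ∣ ρ ∣ₑ
    lem : ∀ τ υ → suc (suc τ + suc (τ + suc (2 + suc (2 + υ)))) ≡ 9 + (τ + τ) + υ
    lem = solve-∀

-- Recursion on lists

module _ {n} (η : Vec Val n) {A B : Set} (encA : A → Val) (encB : B → Val) (f : A → B → B)
         (body : Exp (suc n)) (Inv : List A → B → Set) (M : ℕ)
         (preserve : ∀ {x xs b} → Inv (x ∷ xs) b → Inv xs (f x b))
         (run-body : ∀ {x xs b} → Inv (x ∷ xs) b →
                     pair (encL encA (x ∷ xs)) (encB b) ∷ᵥ η ⊢ body ⇓ encB (f x b) within M) where

  -- The loop variable is the pair of the remaining list and the accumulator. The invariant is a
  -- parameter because the body runs within M only on accumulators that really occur. A round costs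
  -- 8 besides the body, and the final failing test costs 4.
  run-loop : ∀ xs b → Inv xs b →
             ∃[ τ ] (η ⊢loop isPair (fst (var zero)) , cons (snd (fst (var zero))) body
                       from pair (encL encA xs) (encB b)
                       ⇓ pair (nat 0) (encB (foldl (flip f) b xs)) [ τ ])
                  × τ ≤ 4 + length xs * (8 + M)
  run-loop []       b inv = 4 , stop (isPair (fst (var zero))) refl , ≤-refl
  run-loop (x ∷ xs) b inv with run-body inv | run-loop xs (f x b) (preserve inv)
  ... | τ , d , τ≤ | υ , e , υ≤ =
    _ , step (isPair (fst (var zero))) refl (cons (snd (fst (var zero))) d) e , (begin
      suc (3 + suc (3 + τ) + υ)              ≤⟨ s≤s (+-mono-≤ (+-monoʳ-≤ 7 τ≤) υ≤) ⟩
      suc (7 + M + (4 + length xs * (8 + M)))  ≡⟨ lem M (length xs * (8 + M)) ⟩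
      4 + (8 + M + length xs * (8 + M))      ∎)
    where
    open ≤-Reasoning
    lem : ∀ x y → suc (7 + x + (4 + y)) ≡ 4 + (8 + x + y)
    lem = solve-∀

size-reverse : ∀ a (acc xs : List (El a)) →
               suc (∥_∥ {list a} (foldl (flip _∷_) acc xs)) ≡ ∥_∥ {list a} acc + ∥_∥ {list a} xs
size-reverse a acc []       = +-comm 1 _
size-reverse a acc (x ∷ xs) = trans (size-reverse a (x ∷ acc) xs) (lem (∥_∥ {a} x) (∥_∥ {list a} acc) _)
  where
  lem : ∀ x y z → suc (x + y) + z ≡ y + suc (x + z)
  lem = solve-∀

length≤size : ∀ a (xs : List (El a)) → length xs ≤ ∥_∥ {list a} xs
length≤size a []       = z≤n
length≤size a (x ∷ xs) = s≤s (≤-trans (length≤size a xs) (m≤n+m _ (∥_∥ {a} x)))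

module _ {Γ a b} (t : Tm (a ∷ b ∷ Γ) b) (i : Tm Γ b) (l : Tm Γ (list a)) (g : Pol) where
  private
    f : Env Γ → El a → El b → El b
    f ρ x y = ⟦ t ⟧ (x , y , ρ)

    place : ∀ {n} → Place Γ n → Place (a ∷ b ∷ Γ) (suc (suc (suc n)))
    place m here         = zero
    place m (there here)     = suc zero
    place m (there (there x)) = suc (suc (suc (m x)))

    -- A while loop consumes a list from the front and so computes a left fold. Reversing the list
    -- first turns this into the right fold.
    reversed : ∀ {n} → Place Γ n → Exp n
    reversed m = snd (while (cons (code l m) (lit 0)) (isPair (fst (var zero)))
                   (cons (snd (fst (var zero))) (cons (fst (fst (var zero))) (snd (var zero)))))

    body : ∀ {n} → Place Γ n → Exp (suc n)
    body m = bind (snd (var zero)) (bind (fst (fst (var (suc zero)))) (code t (place m)))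

    exp : ∀ {n} → Place Γ n → Exp n
    exp m = snd (while (cons (reversed m) (code i m)) (isPair (fst (var zero)))
              (cons (snd (fst (var zero))) (body m)))

    span envs p : Pol
    span = X ⊕ pol l ⊕ # 1
    envs = span ⊕ (g [ span ]ₚ ⊕ X)
    p = # 15 ⊕ pol l ⊕ pol l ⊛ # 14 ⊕ pol i ⊕ pol l ⊛ (# 15 ⊕ pol t [ envs ]ₚ) ⊕ g [ X ⊕ pol l ]ₚ

    run-reversed : ∀ {n} (m : Place Γ n) η ρ → η at m represents ρ →
                   η ⊢ reversed m ⇓ enc (list a) (reverse (⟦ l ⟧ ρ))
                     within 8 + eval (pol l) ∣ ρ ∣ₑ + eval (pol l) ∣ ρ ∣ₑ * 14
    run-reversed m η ρ r with runs l m η ρ r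
    ... | τ , d , τ≤ with run-loop η (enc a) (enc (list a)) _∷_ _ (λ _ _ → ⊤) 6 _
                            (λ _ → _ , cons (fst (fst (var zero))) (snd (var zero)) , ≤-refl) (⟦ l ⟧ ρ) [] tt
    ... | υ , e , υ≤ = _ , snd (while (cons d (lit 0)) e) , (begin
      suc (suc (suc (τ + 1) + υ))                    ≤⟨ s≤s (s≤s (+-mono-≤ (s≤s (+-monoˡ-≤ 1 τ≤))
                                                          (≤-trans υ≤ (+-monoʳ-≤ 4 (*-monoˡ-≤ 14 (≤-trans (length≤size a (⟦ l ⟧ ρ)) (small l ρ))))))) ⟩
      suc (suc (suc (L + 1) + (4 + L * 14)))         ≡⟨ lem L (L * 14) ⟩
      8 + L + L * 14                                 ∎)
      where
      open ≤-Reasoning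
      L = eval (pol l) ∣ ρ ∣ₑ
      lem : ∀ x y → suc (suc (suc (x + 1) + (4 + y))) ≡ 8 + x + y
      lem = solve-∀

  module _ (h : ∀ ρ ys → size (enc b (foldr (f ρ) (⟦ i ⟧ ρ) ys)) ≤ eval g (∣ ρ ∣ₑ + ∥_∥ {list a} ys)) where
    private
      run : ∀ {n} (m : Place Γ n) η ρ → η at m represents ρ →
            η ⊢ exp m ⇓ enc b (foldr (f ρ) (⟦ i ⟧ ρ) (⟦ l ⟧ ρ)) within eval p ∣ ρ ∣ₑ
      run {n} m η ρ r = subst (λ v → η ⊢ exp m ⇓ enc b v within eval p ∣ ρ ∣ₑ) (sym value)
        (_ , snd (while (cons (proj₁ (proj₂ rev)) (proj₁ (proj₂ base))) (proj₁ (proj₂ loop))) , (begin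
          suc (suc (suc (proj₁ rev + proj₁ base) + proj₁ loop))
            ≤⟨ s≤s (s≤s (+-mono-≤ (s≤s (+-mono-≤ (proj₂ (proj₂ rev)) (proj₂ (proj₂ base)))) (proj₂ (proj₂ loop)))) ⟩
          suc (suc (suc (8 + L + L * 14 + I) + (4 + length ys * (8 + M))))
            ≤⟨ s≤s (s≤s (+-monoʳ-≤ (suc (8 + L + L * 14 + I)) (+-monoʳ-≤ 4 (*-monoˡ-≤ (8 + M) len≤)))) ⟩
          suc (suc (suc (8 + L + L * 14 + I) + (4 + L * (8 + M))))
            ≡⟨ lem L (L * 14) I (L * (8 + M)) ⟩
          15 + L + L * 14 + I + L * (8 + M)
            ≤⟨ m≤m+n _ _ ⟩
          eval p ∣ ρ ∣ₑ ∎))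
        where
        open ≤-Reasoning
        ys = reverse (⟦ l ⟧ ρ)
        value = sym (reverse-foldl (flip (f ρ)) (⟦ i ⟧ ρ) (⟦ l ⟧ ρ))
        L = eval (pol l) ∣ ρ ∣ₑ
        I = eval (pol i) ∣ ρ ∣ₑ
        S = suc (∥_∥ {list a} (⟦ l ⟧ ρ))
        M = 7 + eval (pol t [ envs ]ₚ) ∣ ρ ∣ₑ
        S≤ : ∣ ρ ∣ₑ + S ≤ eval span ∣ ρ ∣ₑ
        S≤ = ≤-trans (+-monoʳ-≤ ∣ ρ ∣ₑ (s≤s (small l ρ))) (≤-reflexive (lemS ∣ ρ ∣ₑ L))
          where
          lemS : ∀ x y → x + suc y ≡ x + y + 1
          lemS = solve-∀
        len≤ : length ys ≤ L
        len≤ = ≤-trans (length≤size a ys) (≤-trans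
          (≤-reflexive (suc-injective (size-reverse a [] (⟦ l ⟧ ρ)))) (small l ρ))
        lem : ∀ x y v w → suc (suc (suc (8 + x + y + v) + (4 + w))) ≡ 15 + x + y + v + w
        lem = solve-∀
        Inv : List (El a) → El b → Set
        -- `pre` is the part already consumed. The accumulator is the fold over it, and the sizes of
        -- both parts add up to a constant, so `h` applied to `pre` bounds the accumulator
        -- throughout the loop.
        Inv zs y = ∃[ pre ] y ≡ foldr (f ρ) (⟦ i ⟧ ρ) pre × ∥_∥ {list a} pre + ∥_∥ {list a} zs ≡ S
        shift : ∀ x y w → suc (x + y) + w ≡ y + suc (x + w)
        shift = solve-∀
        preserve : ∀ {x xs y} → Inv (x ∷ xs) y → Inv xs (f ρ x y)
        preserve {x} (pre , refl , eq) = x ∷ pre , refl , trans (shift (∥_∥ {a} x) _ _) eq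
        run-body : ∀ {x xs y} → Inv (x ∷ xs) y →
          pair (encL (enc a) (x ∷ xs)) (enc b y) ∷ᵥ η ⊢ body m ⇓ enc b (f ρ x y) within M
        run-body {x} {xs} {y} (pre , refl , eq)
          with runs t (place m) (enc a x ∷ᵥ enc b y ∷ᵥ pair (encL (enc a) (x ∷ xs)) (enc b y) ∷ᵥ η) (x , y , ρ)
                 (λ { here → refl ; (there here) → refl ; (there (there v)) → r v })
        ... | τ , d , τ≤ = _ , bind (snd (var zero)) (bind (fst (fst (var (suc zero)))) d) ,
          +-monoʳ-≤ 7 (≤-trans τ≤ (eval-≤-[] (pol t) envs
            (+-mono-≤ x≤ (+-monoˡ-≤ ∣ ρ ∣ₑ (≤-trans (h ρ pre) (eval-≤-[] g span (≤-trans (+-monoʳ-≤ ∣ ρ ∣ₑ pre≤) S≤)))))))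
          where
          pre≤ : ∥_∥ {list a} pre ≤ S
          pre≤ = ≤-trans (m≤m+n _ _) (≤-reflexive eq)
          x≤ : size (enc a x) ≤ eval span ∣ ρ ∣ₑ
          x≤ = ≤-trans (≤-trans (≤-trans (m≤m+n _ _) (n≤1+n _))
                 (≤-trans (m≤n+m _ (∥_∥ {list a} pre)) (≤-reflexive eq))) (≤-trans (m≤n+m S ∣ ρ ∣ₑ) S≤)
        rev = run-reversed m η ρ r
        base = runs i m η ρ r
        loop = run-loop η (enc a) (enc b) (f ρ) (body m) Inv M preserve run-body ys (⟦ i ⟧ ρ)
                 ([] , refl , size-reverse a [] (⟦ l ⟧ ρ))

    -- A polynomial bound on the step does not bound its iteration: repeated squaring would be a
    -- counterexample. Hence the hypothesis `h`, an a priori bound on the results. It is asked for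
    -- every list because the intermediate accumulators are results for suffixes.
    foldrₜ : Tm Γ b
    foldrₜ .⟦_⟧ ρ  = foldr (λ x y → ⟦ t ⟧ (x , y , ρ)) (⟦ i ⟧ ρ) (⟦ l ⟧ ρ)
    foldrₜ .code   = exp
    foldrₜ .pol    = p
    foldrₜ .runs   = run
    foldrₜ .small ρ = ≤-trans (h ρ (⟦ l ⟧ ρ))
      (≤-trans (eval-≤-[] g (X ⊕ pol l) (+-monoʳ-≤ ∣ ρ ∣ₑ (small l ρ))) (m≤n+m _ _))

-- The common case: a step enlarges the accumulator by an amount that does not depend on the
-- accumulator, so the total growth is at most the length of the list times this amount.
foldrₜ⁺ : ∀ {Γ a b} (t : Tm (a ∷ b ∷ Γ) b) (i : Tm Γ b) (l : Tm Γ (list a)) (q : Pol) →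
          (∀ x y ρ → size (enc b (⟦ t ⟧ (x , y , ρ))) ≤ size (enc b y) + eval q (size (enc a x) + ∣ ρ ∣ₑ)) →
          Tm Γ b
foldrₜ⁺ {Γ} {a} {b} t i l q h = foldrₜ t i l (pol i ⊕ X ⊛ q) λ ρ ys → begin
  size (enc b (foldr (λ x y → ⟦ t ⟧ (x , y , ρ)) (⟦ i ⟧ ρ) ys))
    ≤⟨ go ρ ys (∣ ρ ∣ₑ + ∥_∥ {list a} ys) (≤-reflexive (+-comm (∥_∥ {list a} ys) ∣ ρ ∣ₑ)) ⟩
  eval (pol i) ∣ ρ ∣ₑ + length ys * eval q (∣ ρ ∣ₑ + ∥_∥ {list a} ys)
    ≤⟨ +-mono-≤ (eval-mono (pol i) (m≤m+n _ _)) (*-monoˡ-≤ _ (≤-trans (length≤size a ys) (m≤n+m _ ∣ ρ ∣ₑ))) ⟩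
  eval (pol i ⊕ X ⊛ q) (∣ ρ ∣ₑ + ∥_∥ {list a} ys) ∎
  where
  open ≤-Reasoning
  go : ∀ ρ ys N → ∥_∥ {list a} ys + ∣ ρ ∣ₑ ≤ N →
       size (enc b (foldr (λ x y → ⟦ t ⟧ (x , y , ρ)) (⟦ i ⟧ ρ) ys)) ≤ eval (pol i) ∣ ρ ∣ₑ + length ys * eval q N
  go ρ []       N le = ≤-trans (small i ρ) (m≤m+n _ _)
  go ρ (y ∷ ys) N le = begin
    size (enc b (⟦ t ⟧ (y , _ , ρ)))  ≤⟨ h y _ ρ ⟩
    _ + eval q (size (enc a y) + ∣ ρ ∣ₑ)
      ≤⟨ +-mono-≤ (go ρ ys N (≤-trans (+-monoˡ-≤ ∣ ρ ∣ₑ (≤-trans (m≤n+m _ (size (enc a y))) (n≤1+n _))) le))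
                  (eval-mono q (≤-trans (+-monoˡ-≤ ∣ ρ ∣ₑ (≤-trans (m≤m+n _ _) (n≤1+n _))) le)) ⟩
    eval (pol i) ∣ ρ ∣ₑ + length ys * eval q N + eval q N
      ≡⟨ lem (eval (pol i) ∣ ρ ∣ₑ) (length ys * eval q N) (eval q N) ⟩
    eval (pol i) ∣ ρ ∣ₑ + (eval q N + length ys * eval q N) ∎
    where
    lem : ∀ x y z → x + y + z ≡ x + (z + y)
    lem = solve-∀

wk : ∀ {Γ a b} → Tm Γ b → Tm (a ∷ Γ) b
wk t .⟦_⟧ ρ        = ⟦ t ⟧ (proj₂ ρ)
wk t .code m       = code t (m ∘ there)
wk t .pol          = pol t
wk t .runs m η ρ r = weaken-≤ (eval-mono (pol t) (m≤n+m _ _)) (runs t (m ∘ there) η (proj₂ ρ) (r ∘ there))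
wk t .small ρ      = ≤-trans (small t (proj₂ ρ)) (eval-mono (pol t) (m≤n+m _ _))

wk₁ : ∀ {Γ a b c} → Tm (a ∷ Γ) c → Tm (a ∷ b ∷ Γ) c
wk₁ {Γ} {a} {b} t = record
  { ⟦_⟧   = λ ρ → ⟦ t ⟧ (proj₁ ρ , proj₂ (proj₂ ρ))
  ; code  = λ m → code t (place m)
  ; pol   = pol t
  ; runs  = λ m η ρ r → weaken-≤ (eval-mono (pol t) (le ρ))
      (runs t (place m) η _ λ { here → r here ; (there x) → r (there (there x)) })
  ; small = λ ρ → ≤-trans (small t _) (eval-mono (pol t) (le ρ))
  }
  where
  place : ∀ {n} → Place (a ∷ b ∷ Γ) n → Place (a ∷ Γ) n
  place m here     = m here
  place m (there x) = m (there (there x))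
  le : ∀ (ρ : Env (a ∷ b ∷ Γ)) → size (enc a (proj₁ ρ)) + ∣ proj₂ (proj₂ ρ) ∣ₑ ≤ ∣ ρ ∣ₑ
  le ρ = +-monoʳ-≤ (size (enc a (proj₁ ρ))) (m≤n+m _ _)

data Args (Γ : Ctx) : Ctx → Set where
  []  : Args Γ []
  _∷_ : ∀ {a Δ} → Tm Γ a → Args Γ Δ → Args Γ (a ∷ Δ)

⟦_⟧* : ∀ {Γ Δ} → Args Γ Δ → Env Γ → Env Δ
⟦ [] ⟧*     ρ = tt
⟦ t ∷ ts ⟧* ρ = ⟦ t ⟧ ρ , ⟦ ts ⟧* ρ

module _ {Γ Δ : Ctx} {b : Ty} (t : Tm Δ b) where
  private
    -- What to run once the arguments are bound: the first function tells where the old entries of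
    -- the environment have moved, and the `Place` tells where the bound values sit.
    Continuation : ℕ → Ctx → Set
    Continuation n Θ = ∀ {k} → (Fin n → Fin k) → Place Θ k → Exp k

    binds : ∀ {n Θ} → Args Γ Θ → Place Γ n → Continuation n Θ → Exp n
    binds []       m k = k (λ x → x) λ ()
    binds (u ∷ us) m k = bind (code u m) (binds us (suc ∘ m)
      λ e d → k (e ∘ suc) λ { here → e zero ; (there x) → d x })

    pols : ∀ {Θ} → Args Γ Θ → Pol
    pols []       = # 0
    pols (u ∷ us) = # 1 ⊕ (pol u ⊕ pols us)

    small* : ∀ {Θ} (us : Args Γ Θ) ρ → ∣ ⟦ us ⟧* ρ ∣ₑ ≤ eval (pols us) ∣ ρ ∣ₑ
    small* []       ρ = z≤n
    small* (u ∷ us) ρ = ≤-trans (+-mono-≤ (small u ρ) (small* us ρ)) (n≤1+n _)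

    run-binds : ∀ {n Θ} (us : Args Γ Θ) (m : Place Γ n) (k : Continuation n Θ) (η : Vec Val n) ρ v T →
                η at m represents ρ →
                (∀ {l} (e : Fin n → Fin l) (d : Place Θ l) (θ : Vec Val l) →
                  (∀ i → lookup θ (e i) ≡ lookup η i) → θ at d represents ⟦ us ⟧* ρ →
                  θ ⊢ k e d ⇓ v within T) →
                η ⊢ binds us m k ⇓ v within eval (pols us) ∣ ρ ∣ₑ + T
    run-binds []       m k η ρ v T r K = K (λ x → x) (λ ()) η (λ i → refl) λ ()
    run-binds (u ∷ us) m k η ρ v T r K with runs u m η ρ r
    ... | τ , d , τ≤ with run-binds us (suc ∘ m) _ (enc _ (⟦ u ⟧ ρ) ∷ᵥ η) ρ v T r
            (λ e d θ e≡ d≡ → K (e ∘ suc) _ θ (λ i → e≡ (suc i)) λ { here → e≡ zero ; (there x) → d≡ x })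
    ... | υ , e , υ≤ = _ , bind d e , s≤s (≤-trans (+-mono-≤ τ≤ υ≤) (≤-reflexive (sym (+-assoc (eval (pol u) _) _ T))))

  -- The arguments are bound one by one on top of the environment. As a term runs in any environment
  -- that represents its context, the body finds them there and ignores the rest; each argument is
  -- evaluated once, however often the body uses it.
  call-with : Args Γ Δ → Tm Γ b
  call-with us .⟦_⟧ ρ  = ⟦ t ⟧ (⟦ us ⟧* ρ)
  call-with us .code m = binds us m λ e d → code t d
  call-with us .pol    = pols us ⊕ pol t [ pols us ]ₚ
  call-with us .runs m η ρ r = run-binds us m _ η ρ _ _ r
    λ e d θ _ d≡ → weaken-≤ (eval-≤-[] (pol t) (pols us) (small* us ρ)) (runs t d θ (⟦ us ⟧* ρ) d≡)
  call-with us .small ρ = ≤-trans (small t (⟦ us ⟧* ρ))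
    (≤-trans (eval-≤-[] (pol t) (pols us) (small* us ρ)) (m≤n+m _ _))

appendₜ : ∀ {Γ a} → Tm Γ (list a) → Tm Γ (list a) → Tm Γ (list a)
appendₜ {a = a} t u = as (foldrₜ⁺ (` here ∷ₜ ` (there here)) u t (X ⊕ # 1) bound)
  (λ ρ → ⟦ t ⟧ ρ ++ ⟦ u ⟧ ρ) (λ ρ → sym (++-is-foldr (⟦ t ⟧ ρ) (⟦ u ⟧ ρ)))
  where
  bound : ∀ (x : El a) (y : List (El a)) ρ → suc (size (enc a x) + size (enc (list a) y)) ≤
          size (enc (list a) y) + (size (enc a x) + ∣ ρ ∣ₑ + 1)
  bound x y ρ = ≤-trans (m≤m+n _ _) (≤-reflexive (lem (size (enc a x)) (size (enc (list a) y)) ∣ ρ ∣ₑ))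
    where
    lem : ∀ x y r → suc (x + y) + r ≡ y + (x + r + 1)
    lem = solve-∀

size-++ : ∀ a (xs ys : List (El a)) →
          suc (∥_∥ {list a} (xs ++ ys)) ≡ ∥_∥ {list a} xs + ∥_∥ {list a} ys
size-++ a []       ys = refl
size-++ a (x ∷ xs) ys = cong suc (trans (sym (+-suc _ _)) (trans (cong (∥_∥ {a} x +_) (size-++ a xs ys)) (sym (+-assoc (∥_∥ {a} x) _ _))))

forₜ : ∀ {Γ a b} → Tm Γ (list a) → Tm (a ∷ Γ) (list b) → Tm Γ (list b)
forₜ {Γ} {a} {b} l t = as (foldrₜ⁺ (appendₜ (wk₁ t) (` (there here))) nil l (pol t) bound)
  (λ ρ → concatMap (λ x → ⟦ t ⟧ (x , ρ)) (⟦ l ⟧ ρ)) (λ ρ → eq ρ (⟦ l ⟧ ρ))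
  where
  bound : ∀ x (y : List (El b)) ρ → size (enc (list b) (⟦ t ⟧ (x , ρ) ++ y)) ≤
          size (enc (list b) y) + eval (pol t) (size (enc a x) + ∣ ρ ∣ₑ)
  bound x y ρ = ≤-trans (n≤1+n _) (≤-trans (≤-reflexive (trans (size-++ b (⟦ t ⟧ (x , ρ)) y) (+-comm _ (∥_∥ {list b} y))))
    (+-monoʳ-≤ (∥_∥ {list b} y) (small t (x , ρ))))
  eq : ∀ ρ xs → foldr (λ x y → ⟦ t ⟧ (x , ρ) ++ y) [] xs ≡ concatMap (λ x → ⟦ t ⟧ (x , ρ)) xs
  eq ρ []       = refl
  eq ρ (x ∷ xs) = cong (⟦ t ⟧ (x , ρ) ++_) (eq ρ xs)

infix 4 for_yield_
for_yield_ : ∀ {Γ a b} → Tm Γ (list a) → Tm (a ∷ Γ) (list b) → Tm Γ (list b)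
for_yield_ = forₜ

sumₜ : ∀ {Γ} → Tm Γ (list num) → Tm Γ num
sumₜ l = foldrₜ⁺ (` here +ₜ ` (there here)) (literal 0) l X λ x y ρ →
  ≤-trans (bits-+ x y) (≤-trans (≤-reflexive (+-comm (bits x) (bits y))) (+-monoʳ-≤ (bits y) (m≤m+n _ _)))

lengthₜ : ∀ {Γ a} → Tm Γ (list a) → Tm Γ num
lengthₜ l = as (foldrₜ⁺ (literal 1 +ₜ ` (there here)) (literal 0) l (X ⊕ # 1)
    (λ x y ρ → ≤-trans (bits-+ 1 y) (≤-trans (≤-reflexive (+-comm 1 (bits y))) (+-monoʳ-≤ (bits y) (m≤n+m 1 _)))))
  (λ ρ → length (⟦ l ⟧ ρ)) (λ ρ → eq (⟦ l ⟧ ρ))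
  where
  eq : ∀ {A : Set} (xs : List A) → foldr (λ _ n → 1 + n) 0 xs ≡ length xs
  eq []       = refl
  eq (x ∷ xs) = cong suc (eq xs)

lighter : {A : Set} → ℕ × A → List (ℕ × A) → List (ℕ × A)
lighter x ys = match ys (x ∷ []) (λ y _ → if proj₁ x ≤ᵇ proj₁ y then x ∷ [] else y ∷ [])

lightest : {A : Set} → List (ℕ × A) → List (ℕ × A)
lightest = foldr lighter []

lightestₜ : ∀ {Γ a} → Tm Γ (list (num ⊗ a)) → Tm Γ (list (num ⊗ a))
lightestₜ {a = a} l = foldrₜ⁺
  (matchₜ (` (there here)) (` here ∷ₜ nil)
    (if first (` (there (there here))) ≤ₜ first (` here) then ` (there (there here)) ∷ₜ nil else ` here ∷ₜ nil fi))
  nil l (# 2 ⊕ X) bound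
  where
  elem : ∀ (x : El (num ⊗ a)) y r → suc (size (enc (num ⊗ a) x) + 1) ≤ y + (2 + (size (enc (num ⊗ a) x) + r))
  elem x y r = ≤-trans (≤-trans (m≤m+n _ r) (≤-reflexive (lem (size (enc (num ⊗ a) x)) r))) (m≤n+m _ y)
    where
    lem : ∀ x r → suc (x + 1) + r ≡ 2 + (x + r)
    lem = solve-∀
  bound : ∀ x (ys : List (ℕ × El a)) ρ → size (enc (list (num ⊗ a)) (lighter x ys)) ≤
          size (enc (list (num ⊗ a)) ys) + (2 + (size (enc (num ⊗ a) x) + ∣ ρ ∣ₑ))
  bound x []       ρ = elem x 1 ∣ ρ ∣ₑ
  bound x (y ∷ ys) ρ with proj₁ x ≤ᵇ proj₁ y
  ... | true  = elem x (size (enc (list (num ⊗ a)) (y ∷ ys))) ∣ ρ ∣ₑ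
  ... | false = ≤-trans (s≤s (+-monoʳ-≤ (size (enc (num ⊗ a) y)) (1≤size (enc (list (num ⊗ a)) ys)))) (m≤m+n _ _)

indices : {A : Set} → List A → List ℕ
indices xs = downFrom (length xs)

size-downFrom : ∀ n → size (enc (list num) (downFrom n)) ≤ 1 + n * (1 + n)
size-downFrom n = ≤-trans (go n n ≤-refl) (≤-reflexive refl)
  where
  go : ∀ m n → m ≤ n → size (enc (list num) (downFrom m)) ≤ 1 + m * (1 + n)
  go zero    n le = ≤-refl
  go (suc m) n le = s≤s (begin
    bits m + size (enc (list num) (downFrom m))
      ≤⟨ +-mono-≤ (≤-trans (bits≤suc m) le) (go m n (≤-trans (n≤1+n m) le)) ⟩
    n + suc (m * (1 + n)) ≡⟨ +-suc n _ ⟩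
    suc m * (1 + n)       ∎)
    where open ≤-Reasoning

indicesₜ : ∀ {Γ a} → Tm Γ (list a) → Tm Γ (list num)
indicesₜ {a = a} l = as (foldrₜ
    (matchₜ (` (there here)) (literal 0 ∷ₜ nil) (literal 1 +ₜ ` here ∷ₜ ` (there (there (there here)))))
    nil l (# 1 ⊕ X ⊛ (# 1 ⊕ X))
    (λ ρ ys → subst (λ v → size (enc (list num) v) ≤ eval (# 1 ⊕ X ⊛ (# 1 ⊕ X)) (∣ ρ ∣ₑ + ∥_∥ {list a} ys)) (sym (eq ys))
      (≤-trans (size-downFrom (length ys)) (s≤s (*-mono-≤ (n≤ ρ ys) (s≤s (n≤ ρ ys)))))))
  (λ ρ → indices (⟦ l ⟧ ρ)) (λ ρ → eq (⟦ l ⟧ ρ))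
  where
  n≤ : ∀ {Γ} (ρ : Env Γ) (ys : List (El a)) → length ys ≤ ∣ ρ ∣ₑ + ∥_∥ {list a} ys
  n≤ ρ ys = ≤-trans (length≤size a ys) (m≤n+m _ _)
  next : List ℕ → List ℕ
  next is = match is (0 ∷ []) (λ i _ → 1 + i ∷ is)
  next-downFrom : ∀ n → next (downFrom n) ≡ downFrom (suc n)
  next-downFrom zero    = refl
  next-downFrom (suc n) = refl
  eq : ∀ {A : Set} (ys : List A) → foldr (λ _ → next) [] ys ≡ indices ys
  eq []       = refl
  eq (y ∷ ys) = trans (cong next (eq ys)) (next-downFrom (length ys))

-- Numbers the entries from 0, provided that n is the length of the list.
enumerate : {A : Set} → ℕ → List A → List (ℕ × A)
enumerate n = foldr (λ x ys → (n ∸ suc (length ys) , x) ∷ ys) []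

enumerateₜ : ∀ {Γ a} → Tm Γ num → Tm Γ (list a) → Tm Γ (list (num ⊗ a))
enumerateₜ {a = a} n l = letₜ n (foldrₜ⁺
  ((` (there (there here)) ∸ₜ (literal 1 +ₜ lengthₜ (` (there here))) ,ₜ ` here) ∷ₜ ` (there here)) nil (wk l) (X ⊕ # 2)
  λ x y ρ → ≤-trans
    (s≤s (s≤s (+-monoˡ-≤ (size (enc (list (num ⊗ a)) y))
      (+-monoˡ-≤ (size (enc a x)) (≤-trans (bits-mono (m∸n≤m (proj₁ ρ) (suc (length y)))) (m≤m+n _ ∣ proj₂ ρ ∣ₑ))))))
    (≤-reflexive (lem ∣ ρ ∣ₑ (size (enc a x)) (size (enc (list (num ⊗ a)) y)))))
  where
  lem : ∀ r x y → suc (suc (r + x + y)) ≡ y + (x + r + 2)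
  lem = solve-∀

powers : ℕ → List ℕ
powers zero    = 1 ∷ []
powers (suc i) = 2 ^ suc i ∷ powers i

head-power : ∀ i → number (left (enc (list num) (powers i))) ≡ 2 ^ i
head-power zero    = refl
head-power (suc i) = refl

size-powers : ∀ i → size (enc (list num) (powers i)) ≤ 1 + suc i * (2 + i)
size-powers i = go i i ≤-refl
  where
  go : ∀ m n → m ≤ n → size (enc (list num) (powers m)) ≤ 1 + suc m * (2 + n)
  go zero    n le = s≤s (s≤s (s≤s z≤n))
  go (suc m) n le = s≤s (≤-trans (+-mono-≤ (b≤ (suc m)) (go m n (≤-trans (n≤1+n m) le)))
                                 (≤-trans (≤-reflexive (lem m (suc m * (2 + n)))) (+-monoˡ-≤ _ (s≤s (s≤s le)))))
    where
    b≤ : ∀ i → bits (2 ^ i) ≤ suc i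
    b≤ i = n<2^k⇒bits≤k (s≤s z≤n) (^-monoʳ-< 2 (s≤s (s≤s z≤n)) (n<1+n i))
    lem : ∀ m x → suc (suc m) + (1 + x) ≡ 3 + m + x
    lem = solve-∀

-- No list is at hand to fold over, so this term has a loop of its own, which prepends the double of
-- the head while that does not exceed the number. The number of rounds is at most the bit length,
-- hence linear in the size of the input.
powersUpToₜ : ∀ {Γ} → Tm Γ num → Tm Γ (list num)
powersUpToₜ {Γ} t = record
  { ⟦_⟧   = λ ρ → powers ⌊log₂ ⟦ t ⟧ ρ ⌋
  ; code  = exp
  ; pol   = p
  ; runs  = run
  ; small = λ ρ → ≤-trans (size-powers ⌊log₂ ⟦ t ⟧ ρ ⌋) (begin
      1 + suc ⌊log₂ ⟦ t ⟧ ρ ⌋ * (1 + suc ⌊log₂ ⟦ t ⟧ ρ ⌋) ≤⟨ s≤s (*-mono-≤ (small t ρ) (s≤s (small t ρ))) ⟩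
      1 + T ρ * (1 + T ρ)                                 ≤⟨ m≤n+m _ (eval (# 5 ⊕ pol t ⊕ pol t ⊛ (# 26 ⊕ # 4 ⊛ pol t)) ∣ ρ ∣ₑ) ⟩
      eval p ∣ ρ ∣ₑ                                       ∎)
  }
  where
  open ≤-Reasoning hiding (stop)
  test body : ∀ {n} → Exp (suc (suc n))
  test = op leq (op mul (lit 2) (fst (var zero))) (var (suc zero))
  body = cons (op mul (lit 2) (fst (var zero))) (var zero)
  exp : ∀ {n} → Place Γ n → Exp n
  exp m = bind (code t m) (while (cons (lit 1) (lit 0)) test body)
  p = # 5 ⊕ pol t ⊕ pol t ⊛ (# 26 ⊕ # 4 ⊛ pol t) ⊕ (# 1 ⊕ pol t ⊛ (# 1 ⊕ pol t))
  T : Env Γ → ℕ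
  T ρ = eval (pol t) ∣ ρ ∣ₑ

  bits-2^ : ∀ i → bits (2 ^ i) ≤ suc i
  bits-2^ i = n<2^k⇒bits≤k (s≤s z≤n) (^-monoʳ-< 2 (s≤s (s≤s z≤n)) (n<1+n i))

  bits-head : ∀ i → bits (number (left (enc (list num) (powers i)))) ≤ suc i
  bits-head i = subst (λ x → bits x ≤ suc i) (sym (head-power i)) (bits-2^ i)

  bits-2*head : ∀ i → bits (2 * number (left (enc (list num) (powers i)))) ≤ suc (suc i)
  bits-2*head i = subst (λ x → bits (2 * x) ≤ suc (suc i)) (sym (head-power i)) (bits-2^ (suc i))

  run-test : ∀ {n} (η : Vec Val n) k i →
             enc (list num) (powers i) ∷ᵥ nat k ∷ᵥ η ⊢ test ⇓ fromBool (2 ^ suc i ≤ᵇ k) within 13 + 2 * i + bits k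
  run-test η k i = _ , subst (λ x → enc (list num) (powers i) ∷ᵥ nat k ∷ᵥ η ⊢ test ⇓ fromBool (2 * x ≤ᵇ k) [ τ ]) (head-power i)
      (op (op (lit 2) (fst (var zero))) (var (suc zero))) , (begin
    τ                                                            ≤⟨ +-mono-≤ (s≤s (+-monoˡ-≤ (bits k) (bits-2*head i)))
                                                                         (+-monoˡ-≤ 1 (+-monoˡ-≤ 3 (s≤s (+-monoʳ-≤ 2 (bits-head i))))) ⟩
    suc (suc (suc i) + bits k) + (suc (2 + suc i) + 3 + 1)          ≡⟨ lem i (bits k) ⟩
    11 + 2 * i + bits k                                             ≤⟨ +-monoˡ-≤ (bits k) (+-monoˡ-≤ (2 * i) (m≤n+m 11 2)) ⟩
    13 + 2 * i + bits k                                             ∎)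
    where
    τ = suc (bits (2 * number (left (enc (list num) (powers i)))) + bits k)
           + (suc (2 + bits (number (left (enc (list num) (powers i))))) + 3 + 1)
    lem : ∀ i b → suc (suc (suc i) + b) + (suc (2 + suc i) + 3 + 1) ≡ 11 + 2 * i + b
    lem = solve-∀

  run-body : ∀ {n} (η : Vec Val n) k i →
             enc (list num) (powers i) ∷ᵥ nat k ∷ᵥ η ⊢ body ⇓ enc (list num) (powers (suc i)) within 9 + i
  run-body η k i = _ , subst (λ x → enc (list num) (powers i) ∷ᵥ nat k ∷ᵥ η ⊢ body ⇓ pair (nat (2 * x)) (enc (list num) (powers i)) [ τ ]) (head-power i)
      (cons (op (lit 2) (fst (var zero))) (var zero)) , (begin
    τ                             ≤⟨ s≤s (+-monoˡ-≤ 1 (+-monoˡ-≤ 3 (s≤s (+-monoʳ-≤ 2 (bits-head i))))) ⟩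
    suc (suc (2 + suc i) + 3 + 1)    ≡⟨ lem i ⟩
    9 + i                            ∎)
    where
    τ = suc (suc (2 + bits (number (left (enc (list num) (powers i))))) + 3 + 1)
    lem : ∀ i → suc (suc (2 + suc i) + 3 + 1) ≡ 9 + i
    lem = solve-∀

  run-loop-powers : ∀ {n} (η : Vec Val n) k d i → i + d ≡ ⌊log₂ k ⌋ →
    ∃[ τ ] (nat k ∷ᵥ η ⊢loop test , body from enc (list num) (powers i) ⇓ enc (list num) (powers ⌊log₂ k ⌋) [ τ ])
           × τ ≤ suc d * (26 + 4 * bits k)
  run-loop-powers η k zero i eq with trans (sym (+-identityʳ i)) eq
  ... | refl with run-test η k i
  ... | τ , e , τ≤ = suc τ , stop e (trans (truth-fromBool _) (<⇒≰ᵇ (n<2^bits k))) , (begin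
      suc τ                      ≤⟨ s≤s τ≤ ⟩
      14 + 2 * i + bits k        ≤⟨ +-monoˡ-≤ (bits k) (+-mono-≤ (m≤n+m 14 12) (*-monoʳ-≤ 2 (n≤1+n i))) ⟩
      26 + 2 * bits k + bits k   ≤⟨ m≤m+n _ (bits k) ⟩
      26 + 2 * bits k + bits k + bits k ≡⟨ lem (bits k) ⟩
      26 + 4 * bits k + 0        ∎)
    where
    lem : ∀ b → 26 + 2 * b + b + b ≡ 26 + 4 * b + 0
    lem = solve-∀
  run-loop-powers η k (suc d) i eq with run-test η k i | run-body η k i | run-loop-powers η k d (suc i) (trans (sym (+-suc i d)) eq)
  ... | τ , e , τ≤ | υ , e′ , υ≤ | φ , es , φ≤ =
    _ , step e (trans (truth-fromBool _) (≤⇒≤ᵇ≡true fits)) e′ es , (begin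
      suc (τ + υ + φ)                                    ≤⟨ s≤s (+-mono-≤ (+-mono-≤ τ≤ υ≤) φ≤) ⟩
      suc (13 + 2 * i + bits k + (9 + i) + suc d * (26 + 4 * bits k))
                                                         ≤⟨ s≤s (+-monoˡ-≤ _ (+-mono-≤ (+-monoˡ-≤ (bits k) (+-monoʳ-≤ 13 (*-monoʳ-≤ 2 i≤))) (+-monoʳ-≤ 9 i≤))) ⟩
      suc (13 + 2 * bits k + bits k + (9 + bits k) + suc d * (26 + 4 * bits k))
                                                         ≤⟨ +-monoˡ-≤ (suc d * (26 + 4 * bits k)) (≤-trans (m≤n+m _ 3) (≤-reflexive (lem (bits k)))) ⟩
      suc (suc d) * (26 + 4 * bits k)                    ∎)
    where
    i≤ : i ≤ bits k
    i≤ = ≤-trans (m≤m+n i (suc d)) (≤-trans (≤-reflexive eq) (n≤1+n _))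
    fits : 2 ^ suc i ≤ k
    fits = below k eq
      where
      below : ∀ k → i + suc d ≡ ⌊log₂ k ⌋ → 2 ^ suc i ≤ k
      below zero    eq = case trans (sym (+-suc i d)) eq of λ ()
      below (suc k) eq = ≤-trans (^-monoʳ-≤ 2 (≤-trans (≤-reflexive (+-comm 1 i)) (≤-trans (+-monoʳ-≤ i (s≤s z≤n)) (≤-reflexive eq))))
                                 (2^⌊log₂n⌋≤n (suc k) (s≤s z≤n))
    lem : ∀ b → 3 + suc (13 + 2 * b + b + (9 + b)) ≡ 26 + 4 * b
    lem = solve-∀

  run : ∀ {n} (m : Place Γ n) η ρ → η at m represents ρ →
        η ⊢ exp m ⇓ enc (list num) (powers ⌊log₂ ⟦ t ⟧ ρ ⌋) within eval p ∣ ρ ∣ₑ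
  run m η ρ r with runs t m η ρ r | run-loop-powers η (⟦ t ⟧ ρ) ⌊log₂ ⟦ t ⟧ ρ ⌋ 0 refl
  ... | τ , d , τ≤ | υ , e , υ≤ = _ , bind d (while (cons (lit 1) (lit 0)) e) , (begin
    suc (τ + suc (3 + υ))                       ≤⟨ s≤s (+-mono-≤ τ≤ (+-monoʳ-≤ 4 (≤-trans υ≤ (*-mono-≤ (small t ρ) (+-monoʳ-≤ 26 (*-monoʳ-≤ 4 (small t ρ))))))) ⟩
    suc (T ρ + (4 + T ρ * (26 + 4 * T ρ)))      ≡⟨ lem (T ρ) (T ρ * (26 + 4 * T ρ)) ⟩
    5 + T ρ + T ρ * (26 + 4 * T ρ)              ≤⟨ m≤m+n _ _ ⟩
    eval p ∣ ρ ∣ₑ                                ∎)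
    where
    lem : ∀ x y → suc (x + (4 + y)) ≡ 5 + x + y
    lem = solve-∀

-- The algorithm

rowTy recTy itemTy stateTy planTy entryTy slotTy : Ty
rowTy   = list (num ⊗ num)
recTy   = num ⊗ num ⊗ list num ⊗ rowTy
itemTy  = num ⊗ bool ⊗ num ⊗ list num ⊗ num ⊗ num
stateTy = bool ⊗ num ⊗ num ⊗ num ⊗ num
planTy  = list (itemTy ⊗ bool)
entryTy = stateTy ⊗ num ⊗ planTy
slotTy  = num ⊗ bool ⊗ num ⊗ num ⊗ num ⊗ num

-- Job number, processing times and outgoing edges with their delays.  Here and
-- below a number that may be ∞ is a list with at most one element.
Rec : Set
Rec = El recTy

-- Job number, chain node or not, processing times, and two delays.  For a job
-- of a parallel subgraph these are the delays from and to the adjacent chain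
-- nodes; for a chain node, the first is the delay from the previous chain node
-- if they are adjacent (and 0 otherwise), and the second is unused.
Item : Set
Item = El itemTy

-- (a , mₛ , m꜀ , D , L): the last chain node is on side a and is completed at
-- time D, the next one can start D + mₛ resp. D + m꜀ if it is on the server
-- resp. the cloud, and the server load is L.  These times ignore that the
-- server processes only one job at a time.
State : Set
State = El stateTy

-- The last item comes first.  The sides are server = false, cloud = true.
Plan : Set
Plan = El planTy

Entry : Set
Entry = El entryTy

-- Job number, side, server load, cloud time, start time, rank.
Slot : Set
Slot = El slotTy

same : ℕ → ℕ → Bool
same m n = if m ≤ᵇ n then n ≤ᵇ m else false

differ : Bool → Bool → Bool
differ a b = if a then (if b then false else true) else b

agree : Bool → Bool → Bool
agree a b = if differ a b then false else true

max min : ℕ → ℕ → ℕ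
max m n = m + (n ∸ m)
min m n = if m ≤ᵇ n then m else n

choose : {A : Set} → Bool → A → List A
choose b x = if b then x ∷ [] else []

successors : List Rec → Rec → List (Rec × ℕ)
successors J r = concatMap
  (λ e → concatMap (λ r′ → choose (same (proj₁ e) (proj₁ r′)) (r′ , proj₂ e)) J)
  (proj₂ (proj₂ (proj₂ r)))

delaysTo : Rec → Rec → List ℕ
delaysTo r v = concatMap (λ e → choose (same (proj₁ e) (proj₁ v)) (proj₂ e)) (proj₂ (proj₂ (proj₂ r)))

item : Bool → Rec → ℕ → ℕ → Item
item b r d q = proj₁ r , b , proj₁ (proj₂ r) , proj₁ (proj₂ (proj₂ r)) , d , q

parallelItems : List (Rec × ℕ) → Rec → List Item
parallelItems S v =
  concatMap (λ x → concatMap (λ q → item false (proj₁ x) (proj₂ x) q ∷ []) (delaysTo (proj₁ x) v)) S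

-- A unique successor is taken as the next chain node even if it is the only job of a parallel
-- subgraph: the graph does not tell the two apart, and the chain merely becomes longer. In a true
-- fork, the join goes in front of the parallel jobs, since `extend` expects the last chain node at
-- the head.
nextItems : List Rec → Rec → List Item
nextItems J r = match (successors J r) [] λ x xs →
  match xs (item true (proj₁ x) (proj₂ x) 0 ∷ []) λ _ _ →
  match (successors J (proj₁ x)) [] λ v _ →
  item true (proj₁ v) 0 0 ∷ parallelItems (successors J r) (proj₁ v)

extend : List Rec → List Item → List Item
extend J items = match items [] λ i _ →
  concatMap (λ r → if same (proj₁ r) (proj₁ i) then nextItems J r else []) J ++ items

-- The second `J` merely counts rounds. Rounds after the sink has been reached change nothing,
-- because it has no successors.
allItems : List Rec → ℕ → List Item
allItems J s = foldr (λ _ → extend J) (concatMap (λ r → choose (same (proj₁ r) s) (item true r 0 0)) J) J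

duration : Item → Bool → ℕ
duration (_ , _ , ps , pc , _) σ = if σ then sum pc else ps

load : Item → Bool → ℕ
load (_ , _ , ps , _) σ = if σ then 0 else ps

inDelay : Item → Bool → Bool → ℕ
inDelay (_ , _ , _ , _ , r , _) σ a = if differ a σ then r else 0

outDelay : Item → Bool → Bool → ℕ
outDelay (_ , _ , _ , _ , _ , q) σ b = if differ σ b then q else 0

detour : Item → Bool → Bool → Bool → ℕ
detour i σ a b = inDelay i σ a + duration i σ + outDelay i σ b

-- For a chain node at most one argument of the maximum is nonzero: after a direct link the front is
-- 0, after a fork the in-delay of the item is 0. A parallel job depends on the last chain node
-- alone and ignores the fronts.
begins : Item → Bool → State → ℕ
begins i σ (a , ms , mc , D , _) =
  D + (if proj₁ (proj₂ i) then max (if σ then mc else ms) (inDelay i σ a) else inDelay i σ a)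

advance : Item → Bool → State → State
advance i σ S@(a , ms , mc , D , L) = if proj₁ (proj₂ i)
  then σ , 0 , 0 , begins i σ S + duration i σ , L + load i σ
  else (a , max ms (detour i σ a false) , max mc (detour i σ a true) , D , L + load i σ)

initial : State
initial = false , 0 , 0 , 0 , 0

run : (Item → Item) → Plan → State
run f = foldr (λ i → advance (f (proj₁ i)) (proj₂ i)) initial

value : State → ℕ
value (_ , _ , _ , D , L) = D + L

-- Bounds what an item adds to `potential`. The server time appears twice because it counts for the
-- clock and for the load.
weight : Item → ℕ
weight (_ , _ , ps , pc , r , q) = ps + ps + (sum pc + (r + q))

total : List Item → ℕ
total is = sum (concatMap (λ i → weight i ∷ []) is)

-- The cap K keeps the number of states polynomial.
scale : (P Q K : ℕ) → ℕ → ℕ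
scale P Q K x = min (quotient (x * Q) P) K

-- An infinite cloud time becomes finite here. This is harmless: `grow` applies the scaling only to
-- advance the state, and takes the permission to use the cloud, the cost and the recorded plan from
-- the original item.
scaleItem : (P Q K : ℕ) → Item → Item
scaleItem P Q K (j , b , ps , pc , r , q) =
  j , b , scale P Q K ps , scale P Q K (sum pc) ∷ [] , scale P Q K r , scale P Q K q

sameState : State → State → Bool
sameState (a , m , n , D , L) (a′ , m′ , n′ , D′ , L′) =
  if agree a a′ then
    (if same m m′ then
      (if same n n′ then
        (if same D D′ then same L L′ else false)
        else false)
      else false)
    else false

grow : (Item → Item) → ℕ → Item → Entry → List Entry
grow f b i (S , c , α) =
  (advance (f i) false S , c , (i , false) ∷ α) ∷
  match (proj₁ (proj₂ (proj₂ (proj₂ i)))) [] λ _ _ →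
    choose (c + sum (proj₁ (proj₂ (proj₂ (proj₂ i)))) ≤ᵇ b)
      (advance (f i) true S , c + sum (proj₁ (proj₂ (proj₂ (proj₂ i)))) , (i , true) ∷ α)

matching : List Entry → State → List (ℕ × Entry)
matching es k = concatMap (λ e → choose (sameState (proj₁ e) k) (proj₁ (proj₂ e) , e)) es

-- Entries in the same state have the same continuations, so a cheapest one
-- suffices.
keep : List Entry → State → List Entry
keep es k = concatMap (λ w → proj₂ w ∷ []) (lightest (matching es k))

layer : (Item → Item) → ℕ → List State → Item → List Entry → List Entry
layer f b ks i es = concatMap (keep (concatMap (grow f b i) es)) ks

table : (Item → Item) → ℕ → List State → List Item → List Entry
table f b ks = foldr (layer f b ks) ((initial , 0 , []) ∷ [])

allStates : List ℕ → List State
allStates R = concatMap (λ a → concatMap (λ m → concatMap (λ n → concatMap (λ D → concatMap (λ L →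
  (a , m , n , D , L) ∷ []) R) R) R) R) (false ∷ true ∷ [])

-- Rounded states only steer the search. The plans found are evaluated with exact times, which makes
-- those found for different P comparable.
candidates : (d b : ℕ) → List Item → List State → ℕ → List (ℕ × Plan)
candidates d b is ks P = concatMap
  (λ e → (value (run (λ i → i) (proj₂ (proj₂ e))) , proj₂ (proj₂ e)) ∷ [])
  (table (scaleItem P (d * length is) (2 * (d * length is))) b ks is)

bestPlan : (d b : ℕ) → List Item → List State → List (ℕ × Plan)
bestPlan d b is ks = lightest (concatMap (candidates d b is ks) (powers ⌊log₂ (total is) ⌋))

-- Contains all components of states: there are n items, each of weight at most
-- 5 K = 10 d n after scaling.
range : ℕ → List Item → List ℕ
range d is = indices (0 ∷ concatMap (λ _ → concatMap (λ _ → replicate (10 * d) 0) is) is)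

plans : (d b : ℕ) → List Item → List (ℕ × Plan)
plans d b is = bestPlan d b is (allStates (range d is))

-- Slots are ranked by start time and, for equal start times, by position in the
-- plan; M must exceed all positions.
timeline : ℕ → Plan → List Slot
timeline M []            = []
timeline M ((i , σ) ∷ α) =
  (proj₁ i , σ , load i σ , (if σ then duration i σ else 0) , begins i σ (run (λ i → i) α)
    , begins i σ (run (λ i → i) α) * M + length (timeline M α)) ∷ timeline M α

rank : Slot → ℕ
rank (_ , _ , _ , _ , _ , κ) = κ

slotLoad : Slot → ℕ
slotLoad (_ , _ , l , _) = l

-- List scheduling: a job is delayed by the server load of all jobs of at most
-- its rank.
completion : List Slot → Slot → ℕ
completion ss (_ , _ , _ , c , ℓ , κ) =
  ℓ + c + sum (concatMap (λ e → choose (rank e ≤ᵇ κ) (slotLoad e)) ss)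

output : List Rec → List Slot → List (Bool × ℕ)
output J ss = concatMap (λ r → concatMap (λ e → choose (same (proj₁ e) (proj₁ r)) (proj₁ (proj₂ e) , completion ss e)) ss) J

present : List (ℕ × List ℕ) → List (ℕ × ℕ)
present = concatMap λ e → concatMap (λ d → (proj₁ e , d) ∷ []) (proj₂ e)

records : ℕ → List ℕ → List (List ℕ) → List (List (List ℕ)) → List Rec
records n ps pc ds =
  concatMap (λ x → concatMap (λ y → concatMap (λ w →
    choose (if same (proj₁ x) (proj₁ y) then same (proj₁ x) (proj₁ w) else false)
      (proj₁ x , proj₂ x , proj₂ y , present (enumerate n (proj₂ w))))
    (enumerate n ds)) (enumerate n pc)) (enumerate n ps)

solve : ℕ → List Rec → ℕ → ℕ → List (Bool × ℕ)
solve d J s b = concatMap (λ x → output J (timeline (suc (length (proj₂ x))) (proj₂ x))) (plans d b (allItems J s))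

-- The algorithm as terms with polynomial bounds

v0 : ∀ {Γ a} → Tm (a ∷ Γ) a
v0 = ` here
v1 : ∀ {Γ a b} → Tm (b ∷ a ∷ Γ) a
v1 = ` (there here)
v2 : ∀ {Γ a b c} → Tm (c ∷ b ∷ a ∷ Γ) a
v2 = ` (there (there here))
v3 : ∀ {Γ a b c d} → Tm (d ∷ c ∷ b ∷ a ∷ Γ) a
v3 = ` (there (there (there here)))
v4 : ∀ {Γ a b c d e} → Tm (e ∷ d ∷ c ∷ b ∷ a ∷ Γ) a
v4 = ` (there (there (there (there here))))
v5 : ∀ {Γ a b c d e f} → Tm (f ∷ e ∷ d ∷ c ∷ b ∷ a ∷ Γ) a
v5 = ` (there (there (there (there (there here)))))
v6 : ∀ {Γ a b c d e f g} → Tm (g ∷ f ∷ e ∷ d ∷ c ∷ b ∷ a ∷ Γ) a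
v6 = ` (there (there (there (there (there (there here))))))

singleₜ : ∀ {Γ a} → Tm Γ a → Tm Γ (list a)
singleₜ t = t ∷ₜ nil

chooseₜ : ∀ {Γ a} → Tm Γ bool → Tm Γ a → Tm Γ (list a)
chooseₜ c t = if c then singleₜ t else nil fi

sameₜ : ∀ {Γ} → Tm Γ num → Tm Γ num → Tm Γ bool
sameₜ t u = if t ≤ₜ u then u ≤ₜ t else boolean false fi

differₜ agreeₜ : ∀ {Γ} → Tm Γ bool → Tm Γ bool → Tm Γ bool
differₜ t u = if t then if u then boolean false else boolean true fi else u fi
agreeₜ t u = if differₜ t u then boolean false else boolean true fi

maxₜ minₜ : ∀ {Γ} → Tm Γ num → Tm Γ num → Tm Γ num
maxₜ t u = t +ₜ (u ∸ₜ t)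
minₜ t u = if t ≤ₜ u then t else u fi

successorsₜ : Tm (list recTy ∷ recTy ∷ []) (list (recTy ⊗ num))
successorsₜ = as
  (for second (second (second v1)) yield for v1 yield
    chooseₜ (sameₜ (first v1) (first v0)) (v0 ,ₜ second v1))
  (λ (J , r , _) → successors J r) (λ _ → refl)

delaysToₜ : Tm (recTy ∷ recTy ∷ []) (list num)
delaysToₜ = as
  (for second (second (second v0)) yield chooseₜ (sameₜ (first v0) (first v2)) (second v0))
  (λ (r , v , _) → delaysTo r v) (λ _ → refl)

itemₜ : ∀ {Γ} → Bool → Tm Γ recTy → Tm Γ num → Tm Γ num → Tm Γ itemTy
itemₜ b r d q = first r ,ₜ boolean b ,ₜ first (second r) ,ₜ first (second (second r)) ,ₜ d ,ₜ q

parallelItemsₜ : Tm (list (recTy ⊗ num) ∷ recTy ∷ []) (list itemTy)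
parallelItemsₜ = as
  (for v0 yield for call-with delaysToₜ (first v0 ∷ v2 ∷ []) yield
    singleₜ (itemₜ false (first v1) (second v1) v0))
  (λ (S , v , _) → parallelItems S v) (λ _ → refl)

nextItemsₜ : Tm (list recTy ∷ recTy ∷ []) (list itemTy)
nextItemsₜ = as
  (matchₜ (call-with successorsₜ (v0 ∷ v1 ∷ [])) nil
    (matchₜ v1 (singleₜ (itemₜ true (first v0) (second v0) (literal 0)))
      (matchₜ (call-with successorsₜ (v4 ∷ first v2 ∷ [])) nil
        (itemₜ true (first v0) (literal 0) (literal 0) ∷ₜ
          call-with parallelItemsₜ (call-with successorsₜ (v6 ∷ ` (there (there (there (there (there (there (there here))))))) ∷ []) ∷ first v0 ∷ [])))))
  (λ (J , r , _) → nextItems J r) (λ _ → refl)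

size-∈ : ∀ a {x : El a} {xs : List (El a)} → x ∈ xs → ∥_∥ {a} x ≤ ∥_∥ {list a} xs
size-∈ a (here refl) = ≤-trans (m≤m+n _ _) (n≤1+n _)
size-∈ a (there {x = y} x∈) = ≤-trans (size-∈ a x∈) (≤-trans (m≤n+m _ (∥_∥ {a} y)) (n≤1+n _))

size-concatMap : ∀ {A : Set} b (f : A → List (El b)) xs M →
                 (∀ {x} → x ∈ xs → ∥_∥ {list b} (f x) ≤ M) → ∥_∥ {list b} (concatMap f xs) ≤ 1 + length xs * M
size-concatMap b f []       M h = ≤-refl
size-concatMap b f (x ∷ xs) M h = ≤-trans (n≤1+n _) (≤-trans (≤-reflexive (size-++ b (f x) _))
  (≤-trans (+-mono-≤ (h (here refl)) (size-concatMap b f xs M (λ x∈ → h (there x∈)))) (≤-reflexive (+-suc M _))))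

size-list : ∀ a (xs : List (El a)) M → (∀ {x} → x ∈ xs → ∥_∥ {a} x ≤ M) → ∥_∥ {list a} xs ≤ 1 + length xs * (1 + M)
size-list a []       M h = ≤-refl
size-list a (x ∷ xs) M h = s≤s (≤-trans (+-mono-≤ (h (here refl)) (size-list a xs M (λ x∈ → h (there x∈))))
  (≤-reflexive (+-suc M _)))

extendₜ : Tm (list itemTy ∷ list recTy ∷ []) (list itemTy)
extendₜ = as
  (matchₜ v0 nil
    (appendₜ (for v3 yield if sameₜ (first v0) (first v1) then call-with nextItemsₜ (v4 ∷ v0 ∷ []) else nil fi) v2))
  (λ (is , J , _) → extend J is) (λ _ → refl)

size-prepend : ∀ a b (f : El a → List (El b)) xs ys M → (∀ {x} → x ∈ xs → ∥_∥ {list b} (f x) ≤ M) →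
               ∥_∥ {list b} (concatMap f xs ++ ys) ≤ ∥_∥ {list b} ys + (1 + ∥_∥ {list a} xs * M)
size-prepend a b f xs ys M h = begin
  ∥_∥ {list b} (concatMap f xs ++ ys)                   ≤⟨ n≤1+n _ ⟩
  suc (∥_∥ {list b} (concatMap f xs ++ ys))             ≡⟨ size-++ b (concatMap f xs) ys ⟩
  ∥_∥ {list b} (concatMap f xs) + ∥_∥ {list b} ys       ≡⟨ +-comm _ (∥_∥ {list b} ys) ⟩
  ∥_∥ {list b} ys + ∥_∥ {list b} (concatMap f xs)       ≤⟨ +-monoʳ-≤ (∥_∥ {list b} ys) (size-concatMap b f xs M h) ⟩
  ∥_∥ {list b} ys + (1 + length xs * M)                 ≤⟨ +-monoʳ-≤ (∥_∥ {list b} ys) (s≤s (*-monoˡ-≤ M (length≤size a xs))) ⟩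
  ∥_∥ {list b} ys + (1 + ∥_∥ {list a} xs * M)           ∎
  where open ≤-Reasoning

size-if : ∀ a (c : Bool) (x : List (El a)) M → ∥_∥ {list a} x ≤ M → ∥_∥ {list a} (if c then x else []) ≤ M
size-if a true  x M le = le
size-if a false x M le = ≤-trans (1≤size (enc (list a) x)) le

module _ {a b c} (t : Tm (list a ∷ a ∷ []) (list b)) (p : El a → El c → Bool) where
  prepend-bound : Pol
  prepend-bound = # 1 ⊕ X ⊛ pol t [ X ⊕ (X ⊕ # 0) ]ₚ

  size-extension : ∀ xs y ys →
    ∥_∥ {list b} (concatMap (λ x → if p x y then ⟦ t ⟧ (xs , x , _) else []) xs ++ ys) ≤
    ∥_∥ {list b} ys + eval prepend-bound (∥_∥ {list a} xs)
  size-extension xs y ys = size-prepend a b _ xs ys (eval (pol t [ X ⊕ (X ⊕ # 0) ]ₚ) (∥_∥ {list a} xs)) λ {x} x∈ →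
    size-if b (p x y) (⟦ t ⟧ (xs , x , _)) _ (≤-trans (small t (xs , x , _))
      (eval-≤-[] (pol t) (X ⊕ (X ⊕ # 0)) (+-monoʳ-≤ (∥_∥ {list a} xs) (+-monoˡ-≤ 0 (size-∈ a x∈)))))

-- The items collected so far influence a round only through the number of their first entry. What
-- is added is therefore bounded in terms of `J` alone, as `foldrₜ⁺` requires.
size-extend : ∀ J is → ∥_∥ {list itemTy} (extend J is) ≤
              ∥_∥ {list itemTy} is + eval (prepend-bound {c = itemTy} nextItemsₜ (λ r i → same (proj₁ r) (proj₁ i))) (∥_∥ {list recTy} J)
size-extend J []         = s≤s z≤n
size-extend J is@(i ∷ _) = size-extension {c = itemTy} nextItemsₜ (λ r i → same (proj₁ r) (proj₁ i)) J i is

allItemsₜ : Tm (list recTy ∷ num ∷ []) (list itemTy)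
allItemsₜ = as
  (foldrₜ⁺ (call-with extendₜ (v1 ∷ v2 ∷ []))
    (for v0 yield chooseₜ (sameₜ (first v0) v2) (itemₜ true v0 (literal 0) (literal 0)))
    v0 p
    λ x y ρ → ≤-trans (size-extend (proj₁ ρ) y) (+-monoʳ-≤ (∥_∥ {list itemTy} y)
      (eval-mono p {∥_∥ {list recTy} (proj₁ ρ)} {size (enc recTy x) + ∣ ρ ∣ₑ}
        (≤-trans (m≤m+n (∥_∥ {list recTy} (proj₁ ρ)) _) (m≤n+m _ (size (enc recTy x)))))))
  (λ (J , s , _) → allItems J s) (λ _ → refl)
  where p = prepend-bound {c = itemTy} nextItemsₜ (λ r i → same (proj₁ r) (proj₁ i))

durationₜ loadₜ : ∀ {Γ} → Tm Γ itemTy → Tm Γ bool → Tm Γ num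
durationₜ i σ = if σ then sumₜ (first (second (second (second i)))) else first (second (second i)) fi
loadₜ i σ = if σ then literal 0 else first (second (second i)) fi

inDelayₜ outDelayₜ : ∀ {Γ} → Tm Γ itemTy → Tm Γ bool → Tm Γ bool → Tm Γ num
inDelayₜ i σ a = if differₜ a σ then first (second (second (second (second i)))) else literal 0 fi
outDelayₜ i σ b = if differₜ σ b then second (second (second (second (second i)))) else literal 0 fi

detourₜ : ∀ {Γ} → Tm Γ itemTy → Tm Γ bool → Tm Γ bool → Bool → Tm Γ num
detourₜ i σ a b = inDelayₜ i σ a +ₜ durationₜ i σ +ₜ outDelayₜ i σ (boolean b)

startₜ : Tm (itemTy ∷ bool ∷ stateTy ∷ []) num
startₜ = as
  (first (second (second (second v2))) +ₜ
    (if first (second v0)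
      then maxₜ (if v1 then first (second (second v2)) else first (second v2) fi) (inDelayₜ v0 v1 (first v2))
      else inDelayₜ v0 v1 (first v2) fi))
  (λ (i , σ , S , _) → begins i σ S) (λ _ → refl)

advanceₜ : Tm (itemTy ∷ bool ∷ stateTy ∷ []) stateTy
advanceₜ = as
  (if first (second v0)
    then v1 ,ₜ literal 0 ,ₜ literal 0 ,ₜ call-with startₜ (v0 ∷ v1 ∷ v2 ∷ []) +ₜ durationₜ v0 v1 ,ₜ l
    else first v2 ,ₜ maxₜ (first (second v2)) (detourₜ v0 v1 (first v2) false)
      ,ₜ maxₜ (first (second (second v2))) (detourₜ v0 v1 (first v2) true)
      ,ₜ first (second (second (second v2))) ,ₜ l fi)
  (λ (i , σ , S , _) → advance i σ S) (λ _ → refl)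
  where l = second (second (second (second v2))) +ₜ loadₜ v0 v1

initialₜ : ∀ {Γ} → Tm Γ stateTy
initialₜ = boolean false ,ₜ literal 0 ,ₜ literal 0 ,ₜ literal 0 ,ₜ literal 0

weightₜ : ∀ {Γ} → Tm Γ itemTy → Tm Γ num
weightₜ i = first (second (second i)) +ₜ first (second (second i)) +ₜ
  (sumₜ (first (second (second (second i)))) +ₜ
    (first (second (second (second (second i)))) +ₜ second (second (second (second (second i))))))

totalₜ : Tm (list itemTy ∷ []) num
totalₜ = as (sumₜ (for v0 yield singleₜ (weightₜ v0))) (λ (is , _) → total is) (λ _ → refl)

scaleₜ : ∀ {Γ} → (P Q K x : Tm Γ num) → Tm Γ num
scaleₜ P Q K x = minₜ ((x *ₜ Q) /ₜ P) K

scaleItemₜ : Tm (num ∷ num ∷ num ∷ itemTy ∷ []) itemTy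
scaleItemₜ = as
  (first v3 ,ₜ first (second v3) ,ₜ scaleₜ v0 v1 v2 (first (second (second v3)))
    ,ₜ singleₜ (scaleₜ v0 v1 v2 (sumₜ (first (second (second (second v3))))))
    ,ₜ scaleₜ v0 v1 v2 (first (second (second (second (second v3)))))
    ,ₜ scaleₜ v0 v1 v2 (second (second (second (second (second v3))))))
  (λ (P , Q , K , i , _) → scaleItem P Q K i) (λ _ → refl)

sameStateₜ : Tm (stateTy ∷ stateTy ∷ []) bool
sameStateₜ = as
  (if agreeₜ (first v0) (first v1) then
    (if sameₜ (first (second v0)) (first (second v1)) then
      (if sameₜ (first (second (second v0))) (first (second (second v1))) then
        (if sameₜ (first (second (second (second v0)))) (first (second (second (second v1))))
          then sameₜ (second (second (second (second v0)))) (second (second (second (second v1))))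
          else boolean false fi)
        else boolean false fi)
      else boolean false fi)
    else boolean false fi)
  (λ (S , T , _) → sameState S T) (λ _ → refl)

scalingTy : Ty
scalingTy = num ⊗ num ⊗ num

scaling : El scalingTy → Item → Item
scaling (P , Q , K) = scaleItem P Q K

growₜ : Tm (scalingTy ∷ num ∷ itemTy ∷ entryTy ∷ []) (list entryTy)
growₜ = as
  ((call-with advanceₜ (scaled ∷ boolean false ∷ first v3 ∷ []) ,ₜ first (second v3) ,ₜ ((v2 ,ₜ boolean false) ∷ₜ second (second v3))) ∷ₜ
    matchₜ (first (second (second (second v2)))) nil (wk (wk
      (chooseₜ (cost′ ≤ₜ v1)
        (call-with advanceₜ (scaled ∷ boolean true ∷ first v3 ∷ []) ,ₜ cost′ ,ₜ ((v2 ,ₜ boolean true) ∷ₜ second (second v3)))))))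
  (λ (f , b , i , e , _) → grow (scaling f) b i e) (λ _ → refl)
  where
  scaled : Tm (scalingTy ∷ num ∷ itemTy ∷ entryTy ∷ []) itemTy
  scaled = call-with scaleItemₜ (first v0 ∷ first (second v0) ∷ second (second v0) ∷ v2 ∷ [])
  cost′ : Tm (scalingTy ∷ num ∷ itemTy ∷ entryTy ∷ []) num
  cost′ = first (second v3) +ₜ sumₜ (first (second (second (second v2))))

keepₜ : Tm (list entryTy ∷ stateTy ∷ []) (list entryTy)
keepₜ = as
  (for lightestₜ (for v0 yield chooseₜ (call-with sameStateₜ (first v0 ∷ v2 ∷ [])) (first (second v0) ,ₜ v0))
    yield singleₜ (second v0))
  (λ (es , k , _) → keep es k) (λ _ → refl)

layerₜ : Tm (scalingTy ∷ num ∷ list stateTy ∷ itemTy ∷ list entryTy ∷ []) (list entryTy)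
layerₜ = as
  (letₜ (for v4 yield call-with growₜ (v1 ∷ v2 ∷ v4 ∷ v0 ∷ []))
    (for v3 yield call-with keepₜ (v1 ∷ v0 ∷ [])))
  (λ (f , b , ks , i , es , _) → layer (scaling f) b ks i es) (λ _ → refl)

allStatesₜ : Tm (list num ∷ []) (list stateTy)
allStatesₜ = as
  (for boolean false ∷ₜ boolean true ∷ₜ nil yield for v1 yield for v2 yield for v3 yield for v4 yield
    singleₜ (v4 ,ₜ v3 ,ₜ v2 ,ₜ v1 ,ₜ v0))
  (λ (R , _) → allStates R) (λ _ → refl)

replicateₜ : ∀ {Γ} → ℕ → Tm Γ (list num)
replicateₜ zero    = nil
replicateₜ (suc k) = literal 0 ∷ₜ replicateₜ k

⟦replicateₜ⟧ : ∀ {Γ} k (ρ : Env Γ) → ⟦ replicateₜ k ⟧ ρ ≡ replicate k 0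
⟦replicateₜ⟧ zero    ρ = refl
⟦replicateₜ⟧ (suc k) ρ = cong (0 ∷_) (⟦replicateₜ⟧ k ρ)

rangeₜ : ℕ → Tm (list itemTy ∷ []) (list num)
rangeₜ d = as
  (indicesₜ (literal 0 ∷ₜ (for v0 yield for v1 yield as (replicateₜ (10 * d)) (λ _ → replicate (10 * d) 0) (⟦replicateₜ⟧ (10 * d)))))
  (λ (is , _) → range d is) (λ _ → refl)

presentₜ : Tm (list (num ⊗ list num) ∷ []) (list (num ⊗ num))
presentₜ = as (for v0 yield for second v0 yield singleₜ (first v1 ,ₜ v0)) (λ (es , _) → present es) (λ _ → refl)

recordsₜ : Tm (num ∷ list num ∷ list (list num) ∷ list (list (list num)) ∷ []) (list recTy)
recordsₜ = as
  (for enumerateₜ v0 v1 yield for enumerateₜ v1 v3 yield for enumerateₜ v2 v5 yield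
    chooseₜ (if sameₜ (first v2) (first v1) then sameₜ (first v2) (first v0) else boolean false fi)
      (first v2 ,ₜ second v2 ,ₜ second v1 ,ₜ call-with presentₜ (enumerateₜ v3 (second v0) ∷ [])))
  (λ (n , ps , pc , ds , _) → records n ps pc ds) (λ _ → refl)

completionₜ : Tm (list slotTy ∷ slotTy ∷ []) num
completionₜ = as
  (first (second (second (second (second v1)))) +ₜ first (second (second (second v1))) +ₜ
    sumₜ (for v0 yield chooseₜ (second (second (second (second (second v0)))) ≤ₜ second (second (second (second (second v2)))))
      (first (second (second v0)))))
  (λ (ss , e , _) → completion ss e) (λ _ → refl)

outputₜ : Tm (list recTy ∷ list slotTy ∷ []) (list (bool ⊗ num))
outputₜ = as
  (for v0 yield for v2 yield chooseₜ (sameₜ (first v0) (first v1)) (first (second v0) ,ₜ call-with completionₜ (v3 ∷ v0 ∷ [])))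
  (λ (J , ss , _) → output J ss) (λ _ → refl)

-- Dynamic programming

same-refl : ∀ n → same n n ≡ true
same-refl n rewrite ≤⇒≤ᵇ≡true (≤-refl {n}) = refl

same⇒≡ : ∀ {m n} → same m n ≡ true → m ≡ n
same⇒≡ {m} {n} eq with m ≤ᵇ n in le
... | true = ≤-antisym (≤ᵇ≡true⇒≤ le) (≤ᵇ≡true⇒≤ eq)

≢⇒same : ∀ {m n} → m ≢ n → same m n ≡ false
≢⇒same {m} {n} m≢n with same m n in eq
... | true  = ⊥-elim (m≢n (same⇒≡ eq))
... | false = refl

agree-refl : ∀ a → agree a a ≡ true
agree-refl true  = refl
agree-refl false = refl

agree⇒≡ : ∀ {a b} → agree a b ≡ true → a ≡ b
agree⇒≡ {true}  {true}  _ = refl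
agree⇒≡ {false} {false} _ = refl

sameState-refl : ∀ S → sameState S S ≡ true
sameState-refl (a , m , n , D , L)
  rewrite agree-refl a | same-refl m | same-refl n | same-refl D | same-refl L = refl

sameState⇒≡ : ∀ {S T} → sameState S T ≡ true → S ≡ T
sameState⇒≡ {a , m , n , D , L} {a′ , m′ , n′ , D′ , L′} eq
  with agree a a′ in p | same m m′ in q | same n n′ in r | same D D′ in u
... | true | true | true | true
  rewrite agree⇒≡ {a} p | same⇒≡ {m} q | same⇒≡ {n} r | same⇒≡ {D} u | same⇒≡ {L} eq = refl

module _ {A B : Set} {f : A → List B} where
  ∈-for⁺ : ∀ {x xs y} → x ∈ xs → y ∈ f x → y ∈ concatMap f xs
  ∈-for⁺ x∈ y∈ = ∈-concatMap⁺ f (lose x∈ y∈)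

  ∈-for⁻ : ∀ xs {y} → y ∈ concatMap f xs → ∃[ x ] x ∈ xs × y ∈ f x
  ∈-for⁻ xs y∈ = find (∈-concatMap⁻ f {xs = xs} y∈)

∈-choose⁺ : ∀ {A : Set} {b} {x : A} → b ≡ true → x ∈ choose b x
∈-choose⁺ refl = here refl

∈-choose⁻ : ∀ {A : Set} {b} {x y : A} → y ∈ choose b x → b ≡ true × y ≡ x
∈-choose⁻ {b = true} (here eq) = refl , eq

∈-single : ∀ {A : Set} {x y : A} → y ∈ x ∷ [] → y ≡ x
∈-single (here eq) = eq

Lightest : {A : Set} → List (ℕ × A) → List (ℕ × A) → Set
Lightest xs ys = (xs ≡ [] × ys ≡ []) ⊎
  (∃[ x ] ys ≡ x ∷ [] × x ∈ xs × (∀ {y} → y ∈ xs → proj₁ x ≤ proj₁ y))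

lightest-spec : ∀ {A : Set} (xs : List (ℕ × A)) → Lightest xs (lightest xs)
lightest-spec [] = inj₁ (refl , refl)
lightest-spec (x ∷ xs) with lightest xs | lightest-spec xs
... | _ | inj₁ (refl , refl) = inj₂ (x , refl , here refl , λ { (here refl) → ≤-refl })
... | _ | inj₂ (y , refl , y∈ , y≤) with proj₁ x ≤ᵇ proj₁ y in eq
...   | true  = inj₂ (x , refl , here refl , λ { (here refl) → ≤-refl ; (there w∈) → ≤-trans (≤ᵇ≡true⇒≤ eq) (y≤ w∈) })
...   | false = inj₂ (y , refl , there y∈ , λ { (here refl) → <⇒≤ (≤ᵇ≡false⇒> eq) ; (there w∈) → y≤ w∈ })

∈-lightest : ∀ {A : Set} {xs : List (ℕ × A)} {x} → x ∈ lightest xs → x ∈ xs × (∀ {y} → y ∈ xs → proj₁ x ≤ proj₁ y)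
∈-lightest {xs = xs} x∈ with lightest xs | lightest-spec xs | x∈
... | _ | inj₂ (y , refl , y∈ , y≤) | here refl = y∈ , y≤
... | _ | inj₂ (_ , refl , _)       | there ()

lightest-exists : ∀ {A : Set} {xs : List (ℕ × A)} {y} → y ∈ xs → ∃[ x ] lightest xs ≡ x ∷ []
lightest-exists {xs = xs} y∈ with lightest xs | lightest-spec xs | y∈
... | _ | inj₁ (refl , _)     | ()
... | _ | inj₂ (x , refl , _) | _ = x , refl

length-lightest : ∀ {A : Set} (xs : List (ℕ × A)) → length (lightest xs) ≤ 1
length-lightest xs with lightest xs | lightest-spec xs
... | _ | inj₁ (_ , refl)     = z≤n
... | _ | inj₂ (x , refl , _) = s≤s z≤n

cloudTimes : Item → List ℕ
cloudTimes i = proj₁ (proj₂ (proj₂ (proj₂ i)))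

itemCost : Item → Bool → ℕ
itemCost i σ = if σ then sum (cloudTimes i) else 0

planCost : Plan → ℕ
planCost []            = 0
planCost ((i , σ) ∷ α) = planCost α + itemCost i σ

Allowed : Item × Bool → Set
Allowed (i , σ) = σ ≡ true → cloudTimes i ≢ []

Weighted : Entry → ℕ × Entry
Weighted e = proj₁ (proj₂ e) , e

∈-keep⁻ : ∀ {es k e} → e ∈ keep es k → e ∈ es × proj₁ e ≡ k
∈-keep⁻ {es} {k} e∈ with ∈-for⁻ {f = λ w → proj₂ w ∷ []} (lightest (matching es k)) e∈
... | w , w∈ , here refl
  with ∈-for⁻ {f = λ e → choose (sameState (proj₁ e) k) (Weighted e)} es (proj₁ (∈-lightest {xs = matching es k} w∈))
... | e′ , e′∈ , w∈′ with ∈-choose⁻ {b = sameState (proj₁ e′) k} {x = Weighted e′} w∈′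
... | eq , refl = e′∈ , sameState⇒≡ eq

∈-keep⁺ : ∀ {es e} → e ∈ es →
          ∃[ e′ ] e′ ∈ keep es (proj₁ e) × proj₁ (proj₂ e′) ≤ proj₁ (proj₂ e)
∈-keep⁺ {es} {e} e∈ with ∈-for⁺ {f = λ e′ → choose (sameState (proj₁ e′) (proj₁ e)) (Weighted e′)} e∈
                           (∈-choose⁺ (sameState-refl (proj₁ e)))
... | w∈ with lightest-exists {xs = matching es (proj₁ e)} w∈
... | w , eq with subst (w ∈_) (sym eq) (here refl)
... | w∈′ with ∈-lightest {xs = matching es (proj₁ e)} w∈′
... | w∈″ , least with ∈-for⁻ {f = λ e′ → choose (sameState (proj₁ e′) (proj₁ e)) (Weighted e′)} es w∈″
... | e′ , _ , c with ∈-choose⁻ {b = sameState (proj₁ e′) (proj₁ e)} {x = Weighted e′} c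
... | _ , refl = e′ , ∈-for⁺ {f = λ w → proj₂ w ∷ []} {xs = lightest (matching es (proj₁ e))} w∈′ (here refl) , least w∈

length-concatMap : ∀ {A B : Set} (f : A → List B) xs M → (∀ x → length (f x) ≤ M) → length (concatMap f xs) ≤ length xs * M
length-concatMap f []       M h = z≤n
length-concatMap f (x ∷ xs) M h = ≤-trans (≤-reflexive (length-++ (f x))) (+-mono-≤ (h x) (length-concatMap f xs M h))

length-keep : ∀ es k → length (keep es k) ≤ 1
length-keep es k = ≤-trans (length-concatMap (λ w → proj₂ w ∷ []) (lightest (matching es k)) 1 (λ _ → ≤-refl))
  (*-monoˡ-≤ 1 (length-lightest (matching es k)))

module _ (f : Item → Item) (b : ℕ) where

  data Grown (i : Item) (e : Entry) : Entry → Set where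
    on-server : Grown i e (advance (f i) false (proj₁ e) , proj₁ (proj₂ e) , (i , false) ∷ proj₂ (proj₂ e))
    on-cloud  : cloudTimes i ≢ [] → proj₁ (proj₂ e) + sum (cloudTimes i) ≤ b →
                Grown i e (advance (f i) true (proj₁ e) , proj₁ (proj₂ e) + sum (cloudTimes i) , (i , true) ∷ proj₂ (proj₂ e))

  ∈-grow⁻ : ∀ i e {e′} → e′ ∈ grow f b i e → Grown i e e′
  ∈-grow⁻ i e (here refl) = on-server
  ∈-grow⁻ i@(_ , _ , _ , _ ∷ _ , _) e (there e′∈)
    with ∈-choose⁻ {b = proj₁ (proj₂ e) + sum (cloudTimes i) ≤ᵇ b} e′∈
  ... | le , refl = on-cloud (λ ()) (≤ᵇ≡true⇒≤ le)

  ∈-grow⁺ : ∀ {i e e′} → Grown i e e′ → e′ ∈ grow f b i e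
  ∈-grow⁺ on-server = here refl
  ∈-grow⁺ {_ , _ , _ , []    , _} (on-cloud ne le) = ⊥-elim (ne refl)
  ∈-grow⁺ {_ , _ , _ , _ ∷ _ , _} (on-cloud ne le) = there (∈-choose⁺ (≤⇒≤ᵇ≡true le))

  grown-exists : ∀ i e σ → Allowed (i , σ) → proj₁ (proj₂ e) + itemCost i σ ≤ b →
                 ∃[ e′ ] Grown i e e′ × proj₁ e′ ≡ advance (f i) σ (proj₁ e)
                         × proj₁ (proj₂ e′) ≡ proj₁ (proj₂ e) + itemCost i σ
  grown-exists i e false _  _  = _ , on-server , refl , sym (+-identityʳ _)
  grown-exists i e true  ok le = _ , on-cloud (ok refl) le , refl , refl

  module _ (ks : List State) where

    ∈-layer⁻ : ∀ {i es e} → e ∈ layer f b ks i es → ∃[ e₀ ] e₀ ∈ es × Grown i e₀ e × proj₁ e ∈ ks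
    ∈-layer⁻ {i} {es} e∈ =
      let k , k∈ , e∈k = ∈-for⁻ ks e∈
          e∈′ , eq = ∈-keep⁻ {concatMap (grow f b i) es} {k} e∈k
          e₀ , e₀∈ , new = ∈-for⁻ {f = grow f b i} es e∈′
      in e₀ , e₀∈ , ∈-grow⁻ i e₀ new , subst (_∈ ks) (sym eq) k∈

    ∈-layer⁺ : ∀ {i es e₀ e} → e₀ ∈ es → Grown i e₀ e → proj₁ e ∈ ks →
               ∃[ e′ ] e′ ∈ layer f b ks i es × proj₁ e′ ≡ proj₁ e × proj₁ (proj₂ e′) ≤ proj₁ (proj₂ e)
    ∈-layer⁺ {i} {es} {e₀} {e} e₀∈ grown k∈ =
      let e′ , e′∈ , le = ∈-keep⁺ {concatMap (grow f b i) es} {e} (∈-for⁺ e₀∈ (∈-grow⁺ grown))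
      in e′ , ∈-for⁺ k∈ e′∈ , proj₂ (∈-keep⁻ {concatMap (grow f b i) es} {proj₁ e} e′∈) , le

    -- Besides correctness, this serves the running time: `items`, `cheap` and `known` bound the
    -- sizes of plan, cost and state in every intermediate table.
    record Sound (is : List Item) (e : Entry) : Set where
      field
        state   : proj₁ e ≡ run f (proj₂ (proj₂ e))
        items   : map proj₁ (proj₂ (proj₂ e)) ≡ is
        costs   : proj₁ (proj₂ e) ≡ planCost (proj₂ (proj₂ e))
        cheap   : proj₁ (proj₂ e) ≤ b
        allowed : All Allowed (proj₂ (proj₂ e))
        known   : proj₁ e ≡ initial ⊎ proj₁ e ∈ ks

    open Sound

    grown-sound : ∀ {i is e₀ e} → Grown i e₀ e → proj₁ e ∈ ks → Sound is e₀ → Sound (i ∷ is) e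
    grown-sound {i} on-server k∈ s = record
      { state   = cong (advance (f i) false) (state s)
      ; items   = cong (i ∷_) (items s)
      ; costs   = trans (costs s) (sym (+-identityʳ _))
      ; cheap   = cheap s
      ; allowed = (λ ()) ∷ allowed s
      ; known   = inj₂ k∈
      }
    grown-sound {i} (on-cloud ne le) k∈ s = record
      { state   = cong (advance (f i) true) (state s)
      ; items   = cong (i ∷_) (items s)
      ; costs   = cong (_+ sum (cloudTimes i)) (costs s)
      ; cheap   = le
      ; allowed = (λ _ → ne) ∷ allowed s
      ; known   = inj₂ k∈
      }

    table-sound : ∀ is {e} → e ∈ table f b ks is → Sound is e
    table-sound [] (here refl) = record
      { state = refl ; items = refl ; costs = refl ; cheap = z≤n ; allowed = [] ; known = inj₁ refl }
    table-sound (i ∷ is) {e} e∈ =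
      let e₀ , e₀∈ , grown , k∈ = ∈-layer⁻ {i} {table f b ks is} e∈
      in grown-sound grown k∈ (table-sound is e₀∈)

    Inside : Plan → Set
    Inside []      = ⊤
    Inside (x ∷ α) = run f (x ∷ α) ∈ ks × Inside α

    -- The plan itself may have been discarded. The induction only maintains an entry with the same
    -- state and no greater cost; it can take the place of the plan because the next state depends
    -- on the state alone and a smaller cost still fits the budget. `Inside` ensures that no
    -- intermediate state is missing from the list of states.
    table-complete : ∀ α → All Allowed α → planCost α ≤ b → Inside α →
                     ∃[ e ] e ∈ table f b ks (map proj₁ α) × proj₁ e ≡ run f α × proj₁ (proj₂ e) ≤ planCost α
    table-complete [] _ _ _ = _ , here refl , refl , z≤n
    table-complete ((i , σ) ∷ α) (ok ∷ oks) cheap (k∈ , inside) =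
      let e , e∈ , S≡ , c≤ = table-complete α oks (≤-trans (m≤m+n _ _) cheap) inside
          c′≤ = +-monoˡ-≤ (itemCost i σ) c≤
          e′ , grown , S′≡ , c≡ = grown-exists i e σ ok (≤-trans c′≤ cheap)
          S″≡ = trans S′≡ (cong (advance (f i) σ) S≡)
          e″ , e″∈ , S‴≡ , c″≤ = ∈-layer⁺ {i} {table f b ks (map proj₁ α)} {e} {e′} e∈ grown (subst (_∈ ks) (sym S″≡) k∈)
      in e″ , e″∈ , trans S‴≡ S″≡ , ≤-trans c″≤ (≤-trans (≤-reflexive c≡) c′≤)

    -- Since `keep` leaves at most one entry per state, the bound does not grow with the number of
    -- items. The successor accounts for the initial table.
    length-table : ∀ is → length (table f b ks is) ≤ suc (length ks)
    length-table []       = s≤s z≤n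
    length-table (i ∷ is) = ≤-trans (length-concatMap (keep (concatMap (grow f b i) (table f b ks is))) ks 1 (length-keep (concatMap (grow f b i) (table f b ks is)))) (≤-trans (≤-reflexive (*-identityʳ _)) (n≤1+n _))

-- Sizes of states and plans

clock serverLoad : State → ℕ
clock (_ , _ , _ , D , _) = D
serverLoad (_ , _ , _ , _ , L) = L

front : State → Bool → ℕ
front (_ , ms , mc , _ , _) b = if b then mc else ms

-- Includes the front because a chain node turns front into clock. In this form every item raises
-- the potential by at most its weight, whichever kind it is, and each component of a state is
-- bounded by it.
potential : State → Bool → ℕ
potential S b = clock S + front S b + serverLoad S

inTime outTime : Item → ℕ
inTime  (_ , _ , _ , _ , r , _) = r
outTime (_ , _ , _ , _ , _ , q) = q

inDelay≤ : ∀ i σ a → inDelay i σ a ≤ inTime i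
inDelay≤ i σ a with differ a σ
... | true  = ≤-refl
... | false = z≤n

outDelay≤ : ∀ i σ b → outDelay i σ b ≤ outTime i
outDelay≤ i σ b with differ σ b
... | true  = ≤-refl
... | false = z≤n

duration+load≤ : ∀ i σ → duration i σ + load i σ ≤ proj₁ (proj₂ (proj₂ i)) + proj₁ (proj₂ (proj₂ i)) + sum (cloudTimes i)
duration+load≤ i false = m≤m+n _ _
duration+load≤ i true  = ≤-trans (≤-reflexive (+-identityʳ _)) (m≤n+m _ _)

max≤+ : ∀ m n → max m n ≤ m + n
max≤+ m n = +-monoʳ-≤ m (m∸n≤m n m)

m≤max : ∀ m n → m ≤ max m n
m≤max m n = m≤m+n m _

n≤max : ∀ m n → n ≤ max m n
n≤max m n = m≤n+m∸n n m

max-lub : ∀ {m n k} → m ≤ k → n ≤ k → max m n ≤ k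
max-lub {m} {n} m≤k n≤k with ≤-total m n
... | inj₁ m≤n = ≤-trans (≤-reflexive (m+[n∸m]≡n m≤n)) n≤k
... | inj₂ n≤m = ≤-trans (≤-reflexive (trans (cong (m +_) (m≤n⇒m∸n≡0 n≤m)) (+-identityʳ m))) m≤k

visit≤ : ∀ i σ r → r ≤ inTime i → r + duration i σ + load i σ + outTime i ≤ weight i
visit≤ i σ r r≤ = begin
  r + duration i σ + load i σ + outTime i   ≡⟨ lem r (duration i σ) (load i σ) (outTime i) ⟩
  r + (duration i σ + load i σ) + outTime i ≤⟨ +-monoˡ-≤ (outTime i) (+-mono-≤ r≤ (duration+load≤ i σ)) ⟩
  inTime i + (ps + ps + pc) + outTime i     ≡⟨ lem′ (inTime i) (ps + ps) pc (outTime i) ⟩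
  ps + ps + (pc + (inTime i + outTime i))   ∎
  where
  open ≤-Reasoning
  ps = proj₁ (proj₂ (proj₂ i))
  pc = sum (cloudTimes i)
  lem : ∀ r d l q → r + d + l + q ≡ r + (d + l) + q
  lem = solve-∀
  lem′ : ∀ r s c q → r + (s + c) + q ≡ s + (c + (r + q))
  lem′ = solve-∀

start≤ : ∀ i σ S → begins i σ S ≤ clock S + front S σ + inTime i
start≤ i@(_ , true , _) σ S@(a , ms , mc , D , L) =
  ≤-trans (+-monoʳ-≤ D (≤-trans (max≤+ (front S σ) _) (+-monoʳ-≤ (front S σ) (inDelay≤ i σ a)))) (≤-reflexive (sym (+-assoc D _ _)))
start≤ i@(_ , false , _) σ S@(a , ms , mc , D , L) = +-mono-≤ (m≤m+n D (front S σ)) (inDelay≤ i σ a)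

potential-advance : ∀ i σ S T → (∀ b → potential S b ≤ T) → ∀ b → potential (advance i σ S) b ≤ weight i + T
potential-advance i@(_ , true , _) σ S@(a , ms , mc , D , L) T h b = begin
  begins i σ S + duration i σ + (if b then 0 else 0) + (L + load i σ)
    ≡⟨ cong (λ x → begins i σ S + duration i σ + x + (L + load i σ)) (zero-front b) ⟩
  begins i σ S + duration i σ + 0 + (L + load i σ)
    ≤⟨ +-monoˡ-≤ (L + load i σ) (+-monoˡ-≤ 0 (+-monoˡ-≤ (duration i σ) (start≤ i σ S))) ⟩
  D + front S σ + inTime i + duration i σ + 0 + (L + load i σ)
    ≡⟨ lem D (front S σ) (inTime i) (duration i σ) L (load i σ) ⟩
  (inTime i + duration i σ + load i σ) + (D + front S σ + L)
    ≤⟨ +-mono-≤ (≤-trans (m≤m+n _ (outTime i)) (visit≤ i σ (inTime i) ≤-refl)) (h σ) ⟩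
  weight i + T ∎
  where
  open ≤-Reasoning
  zero-front : ∀ b → (if b then 0 else 0) ≡ 0
  zero-front true  = refl
  zero-front false = refl
  lem : ∀ D f r d L l → D + f + r + d + 0 + (L + l) ≡ (r + d + l) + (D + f + L)
  lem = solve-∀
potential-advance i@(_ , false , _) σ S@(a , ms , mc , D , L) T h b = begin
  D + (if b then max mc (detour i σ a true) else max ms (detour i σ a false)) + (L + load i σ)
    ≤⟨ +-monoˡ-≤ (L + load i σ) (+-monoʳ-≤ D (front′ b)) ⟩
  D + (front S b + (inTime i + duration i σ + outTime i)) + (L + load i σ)
    ≡⟨ lem D (front S b) (inTime i) (duration i σ) (outTime i) L (load i σ) ⟩
  (inTime i + duration i σ + load i σ + outTime i) + (D + front S b + L)
    ≤⟨ +-mono-≤ (visit≤ i σ (inTime i) ≤-refl) (h b) ⟩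
  weight i + T ∎
  where
  open ≤-Reasoning
  detour≤ : ∀ b → detour i σ a b ≤ inTime i + duration i σ + outTime i
  detour≤ b = +-mono-≤ (+-monoˡ-≤ (duration i σ) (inDelay≤ i σ a)) (outDelay≤ i σ b)
  front′ : ∀ b → (if b then max mc (detour i σ a true) else max ms (detour i σ a false)) ≤
                 front S b + (inTime i + duration i σ + outTime i)
  front′ true  = ≤-trans (max≤+ mc _) (+-monoʳ-≤ mc (detour≤ true))
  front′ false = ≤-trans (max≤+ ms _) (+-monoʳ-≤ ms (detour≤ false))
  lem : ∀ D f r d q L l → D + (f + (r + d + q)) + (L + l) ≡ (r + d + l + q) + (D + f + L)
  lem = solve-∀

itemsOf : Plan → List Item
itemsOf = map proj₁

potential-run : ∀ f α b → potential (run f α) b ≤ total (map (λ x → f (proj₁ x)) α)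
potential-run f []            true  = z≤n
potential-run f []            false = z≤n
potential-run f ((i , σ) ∷ α) b     = potential-advance (f i) σ (run f α) _ (potential-run f α) b

clock≤ : ∀ S → clock S ≤ potential S false
clock≤ S = ≤-trans (m≤m+n _ _) (m≤m+n _ _)

serverLoad≤ : ∀ S → serverLoad S ≤ potential S false
serverLoad≤ S = m≤n+m _ _

front≤ : ∀ S b → front S b ≤ potential S b
front≤ S b = ≤-trans (m≤n+m _ (clock S)) (m≤m+n _ _)

bits-sum : ∀ xs → bits (sum xs) ≤ ∥_∥ {list num} xs
bits-sum []       = ≤-refl
bits-sum (x ∷ xs) = ≤-trans (bits-+ x (sum xs)) (≤-trans (+-monoʳ-≤ (bits x) (bits-sum xs)) (n≤1+n _))

size-item≥ : ∀ (i : Item) → bits (proj₁ i) + bits (proj₁ (proj₂ (proj₂ i))) + ∥_∥ {list num} (cloudTimes i) + bits (inTime i) + bits (outTime i) ≤ ∥_∥ {itemTy} i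
size-item≥ (j , b , ps , pc , r , q) = ≤-trans (m≤m+n _ (5 + size (fromBool b)))
  (≤-reflexive (lem (bits j) (size (fromBool b)) (bits ps) (∥_∥ {list num} pc) (bits r) (bits q)))
  where
  lem : ∀ j b s c r q → j + s + c + r + q + (5 + b) ≡ suc (j + suc (b + suc (s + suc (c + suc (r + q)))))
  lem = solve-∀

bits-job≤ : ∀ i → bits (proj₁ i) ≤ ∥_∥ {itemTy} i
bits-job≤ i = ≤-trans (≤-trans (m≤m+n _ _) (≤-trans (m≤m+n _ _) (≤-trans (m≤m+n _ _) (m≤m+n _ (bits (outTime i)))))) (size-item≥ i)

bits-load≤ : ∀ i σ → bits (load i σ) ≤ ∥_∥ {itemTy} i
bits-load≤ i true  = ≤-trans (s≤s z≤n) (bits-job≤ i)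
bits-load≤ i false = ≤-trans (≤-trans (m≤n+m _ (bits (proj₁ i))) (≤-trans (m≤m+n _ _) (≤-trans (m≤m+n _ _) (m≤m+n _ (bits (outTime i)))))) (size-item≥ i)

bits-cloud≤ : ∀ i σ → bits (if σ then duration i σ else 0) ≤ ∥_∥ {itemTy} i
bits-cloud≤ i false = ≤-trans (s≤s z≤n) (bits-job≤ i)
bits-cloud≤ i true  = ≤-trans (bits-sum (cloudTimes i)) (≤-trans (≤-trans (m≤n+m _ (bits (proj₁ i) + bits (proj₁ (proj₂ (proj₂ i)))))
  (≤-trans (m≤m+n _ _) (m≤m+n _ (bits (outTime i))))) (size-item≥ i))

bits-weight : ∀ i → bits (weight i) ≤ 2 * ∥_∥ {itemTy} i
bits-weight i = begin
  bits (ps + ps + (sum pc + (inTime i + outTime i)))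
    ≤⟨ ≤-trans (bits-+ (ps + ps) _) (+-mono-≤ (bits-+ ps ps) (≤-trans (bits-+ (sum pc) _) (+-mono-≤ (bits-sum pc) (bits-+ (inTime i) (outTime i))))) ⟩
  bits ps + bits ps + (C + (R + Q))
    ≤⟨ m≤m+n _ (bits (proj₁ i) + bits (proj₁ i) + C + R + Q) ⟩
  bits ps + bits ps + (C + (R + Q)) + (bits (proj₁ i) + bits (proj₁ i) + C + R + Q)
    ≡⟨ lem (bits (proj₁ i)) (bits ps) C R Q ⟩
  2 * (bits (proj₁ i) + bits ps + C + R + Q)
    ≤⟨ *-monoʳ-≤ 2 (size-item≥ i) ⟩
  2 * ∥_∥ {itemTy} i ∎
  where
  open ≤-Reasoning
  ps = proj₁ (proj₂ (proj₂ i))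
  pc = cloudTimes i
  C = ∥_∥ {list num} pc
  R = bits (inTime i)
  Q = bits (outTime i)
  lem : ∀ j s c r q → s + s + (c + (r + q)) + (j + j + c + r + q) ≡ 2 * (j + s + c + r + q)
  lem = solve-∀

bits-total : ∀ is → bits (total is) ≤ 2 * ∥_∥ {list itemTy} is
bits-total []       = s≤s z≤n
bits-total (i ∷ is) = begin
  bits (weight i + total is)                              ≤⟨ bits-+ (weight i) (total is) ⟩
  bits (weight i) + bits (total is)                       ≤⟨ +-mono-≤ (bits-weight i) (bits-total is) ⟩
  2 * ∥_∥ {itemTy} i + 2 * ∥_∥ {list itemTy} is           ≡⟨ *-distribˡ-+ 2 (∥_∥ {itemTy} i) _ ⟨
  2 * (∥_∥ {itemTy} i + ∥_∥ {list itemTy} is)             ≤⟨ *-monoʳ-≤ 2 (n≤1+n (∥_∥ {itemTy} i + ∥_∥ {list itemTy} is)) ⟩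
  2 * ∥_∥ {list itemTy} (i ∷ is)                          ∎
  where open ≤-Reasoning

size-fromBool : ∀ b → size (fromBool b) ≡ 1
size-fromBool true  = refl
size-fromBool false = refl

size-itemsOf : ∀ α → ∥_∥ {list itemTy} (itemsOf α) ≤ ∥_∥ {planTy} α
size-itemsOf []            = ≤-refl
size-itemsOf ((i , σ) ∷ α) = s≤s (+-mono-≤ (≤-trans (m≤m+n _ _) (n≤1+n _)) (size-itemsOf α))

size-plan : ∀ α → ∥_∥ {planTy} α ≤ 3 * ∥_∥ {list itemTy} (itemsOf α)
size-plan []            = s≤s z≤n
size-plan ((i , σ) ∷ α) = begin
  suc (suc (∥_∥ {itemTy} i + size (fromBool σ)) + ∥_∥ {planTy} α)
    ≤⟨ s≤s (s≤s (+-mono-≤ (≤-reflexive (cong (∥_∥ {itemTy} i +_) (size-fromBool σ))) (size-plan α))) ⟩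
  suc (suc (∥_∥ {itemTy} i + 1 + 3 * ∥_∥ {list itemTy} (itemsOf α)))
    ≤⟨ m≤m+n _ (2 * ∥_∥ {itemTy} i) ⟩
  suc (suc (∥_∥ {itemTy} i + 1 + 3 * ∥_∥ {list itemTy} (itemsOf α))) + 2 * ∥_∥ {itemTy} i
    ≡⟨ lem (∥_∥ {itemTy} i) (∥_∥ {list itemTy} (itemsOf α)) ⟩
  3 * suc (∥_∥ {itemTy} i + ∥_∥ {list itemTy} (itemsOf α)) ∎
  where
  open ≤-Reasoning
  lem : ∀ x y → suc (suc (x + 1 + 3 * y)) + 2 * x ≡ 3 * suc (x + y)
  lem = solve-∀

size-state : ∀ S T → (∀ b → potential S b ≤ T) → ∥_∥ {stateTy} S ≤ 5 + 4 * bits T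
size-state S@(a , ms , mc , D , L) T h = begin
  suc (size (fromBool a) + suc (bits ms + suc (bits mc + suc (bits D + bits L))))
    ≡⟨ cong (λ x → suc (x + suc (bits ms + suc (bits mc + suc (bits D + bits L))))) (size-fromBool a) ⟩
  suc (1 + suc (bits ms + suc (bits mc + suc (bits D + bits L))))
    ≤⟨ s≤s (s≤s (s≤s (+-mono-≤ (b≤ (≤-trans (front≤ S false) (h false)))
         (s≤s (+-mono-≤ (b≤ (≤-trans (front≤ S true) (h true)))
         (s≤s (+-mono-≤ (b≤ (≤-trans (clock≤ S) (h false))) (b≤ (≤-trans (serverLoad≤ S) (h false)))))))))) ⟩
  suc (1 + suc (bits T + suc (bits T + suc (bits T + bits T))))
    ≡⟨ lem (bits T) ⟩
  5 + 4 * bits T ∎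
  where
  open ≤-Reasoning
  b≤ : ∀ {m} → m ≤ T → bits m ≤ bits T
  b≤ = bits-mono
  lem : ∀ t → suc (1 + suc (t + suc (t + suc (t + t)))) ≡ 5 + 4 * t
  lem = solve-∀

unscaled : Plan → State
unscaled = run (λ i → i)

potential-unscaled : ∀ α b → potential (unscaled α) b ≤ total (itemsOf α)
potential-unscaled = potential-run (λ i → i)

bits-total-itemsOf : ∀ α → bits (total (itemsOf α)) ≤ 2 * ∥_∥ {planTy} α
bits-total-itemsOf α = ≤-trans (bits-total (itemsOf α)) (*-monoʳ-≤ 2 (size-itemsOf α))

size-unscaled : ∀ α → ∥_∥ {stateTy} (unscaled α) ≤ 5 + 8 * ∥_∥ {planTy} α
size-unscaled α = ≤-trans (size-state (unscaled α) _ (potential-unscaled α))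
  (+-monoʳ-≤ 5 (≤-trans (*-monoʳ-≤ 4 (bits-total-itemsOf α)) (≤-reflexive (sym (*-assoc 4 2 (∥_∥ {planTy} α))))))

start≤total : ∀ i σ α → begins i σ (unscaled α) ≤ total (i ∷ itemsOf α)
start≤total i σ α = begin
  begins i σ S                              ≤⟨ start≤ i σ S ⟩
  clock S + front S σ + inTime i           ≤⟨ +-monoˡ-≤ (inTime i) (≤-trans (m≤m+n _ _) (potential-unscaled α σ)) ⟩
  total (itemsOf α) + inTime i             ≤⟨ +-monoʳ-≤ (total (itemsOf α)) r≤ ⟩
  total (itemsOf α) + weight i             ≡⟨ +-comm (total (itemsOf α)) (weight i) ⟩
  weight i + total (itemsOf α)             ∎
  where
  open ≤-Reasoning
  S = unscaled α
  r≤ : inTime i ≤ weight i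
  r≤ = ≤-trans (≤-trans (m≤m+n _ _) (m≤m+n _ _)) (≤-trans (m≤m+n _ (outTime i)) (visit≤ i σ (inTime i) ≤-refl))

length-timeline : ∀ M α → length (timeline M α) ≡ length α
length-timeline M []      = refl
length-timeline M (_ ∷ α) = cong suc (length-timeline M α)

size-slot : ∀ M α N → ∥_∥ {planTy} α ≤ N → bits M ≤ N → ∀ {e} → e ∈ timeline M α → ∥_∥ {slotTy} e ≤ 7 + 9 * N
size-slot M (x ∷ α) N α≤ M≤ (there e∈) = size-slot M α N (≤-trans (≤-trans (m≤n+m _ _) (n≤1+n _)) α≤) M≤ e∈
size-slot M ((i , σ) ∷ α) N α≤ M≤ (here refl) = begin
  suc (bits (proj₁ i) + suc (size (fromBool σ) + suc (bits (load i σ) + suc (bits c + suc (bits ℓ + bits κ)))))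
    ≡⟨ cong (λ x → suc (bits (proj₁ i) + suc (x + suc (bits (load i σ) + suc (bits c + suc (bits ℓ + bits κ)))))) (size-fromBool σ) ⟩
  suc (bits (proj₁ i) + suc (1 + suc (bits (load i σ) + suc (bits c + suc (bits ℓ + bits κ)))))
    ≤⟨ s≤s (+-mono-≤ (≤-trans (bits-job≤ i) i≤) (s≤s (s≤s (s≤s (+-mono-≤ (≤-trans (bits-load≤ i σ) i≤)
         (s≤s (+-mono-≤ (≤-trans (bits-cloud≤ i σ) i≤) (s≤s (+-mono-≤ ℓ≤ κ≤))))))))) ⟩
  suc (N + suc (1 + suc (N + suc (N + suc (2 * N + (2 * N + N + suc N))))))
    ≡⟨ lem N ⟩
  7 + 9 * N ∎
  where
  open ≤-Reasoning
  c = if σ then duration i σ else 0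
  ℓ = begins i σ (unscaled α)
  κ = ℓ * M + length (timeline M α)
  i≤ : ∥_∥ {itemTy} i ≤ N
  i≤ = ≤-trans (≤-trans (≤-trans (m≤m+n _ _) (n≤1+n _)) (≤-trans (m≤m+n _ _) (n≤1+n _))) α≤
  ℓ≤ : bits ℓ ≤ 2 * N
  ℓ≤ = ≤-trans (bits-mono (start≤total i σ α)) (≤-trans (bits-total (i ∷ itemsOf α))
         (*-monoʳ-≤ 2 (≤-trans (size-itemsOf ((i , σ) ∷ α)) α≤)))
  κ≤ : bits κ ≤ 2 * N + N + suc N
  κ≤ = ≤-trans (bits-+ (ℓ * M) _) (+-mono-≤ (≤-trans (bits-* ℓ M) (+-mono-≤ ℓ≤ M≤))
         (≤-trans (bits≤suc _) (s≤s (≤-trans (≤-reflexive (length-timeline M α))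
           (≤-trans (length≤size (itemTy ⊗ bool) α) (≤-trans (≤-trans (m≤n+m _ _) (n≤1+n _)) α≤))))))
  lem : ∀ n → suc (n + suc (1 + suc (n + suc (n + suc (2 * n + (2 * n + n + suc n)))))) ≡ 7 + 9 * n
  lem = solve-∀

size-timeline : ∀ M α N → ∥_∥ {planTy} α ≤ N → bits M ≤ N → ∥_∥ {list slotTy} (timeline M α) ≤ 1 + N * (8 + 9 * N)
size-timeline M α N α≤ M≤ = ≤-trans (size-list slotTy (timeline M α) (7 + 9 * N) (size-slot M α N α≤ M≤))
  (s≤s (*-monoˡ-≤ (8 + 9 * N) (≤-trans (≤-reflexive (length-timeline M α)) (≤-trans (length≤size (itemTy ⊗ bool) α) α≤))))

size-entry : ∀ f b ks is N {e} → ∥_∥ {list stateTy} ks + bits b ≤ N → ∥_∥ {list itemTy} is ≤ N →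
             e ∈ table f b ks is → ∥_∥ {entryTy} e ≤ 11 + 5 * N
size-entry f b ks is N {S , c , α} ks≤ is≤ e∈ = begin
  suc (∥_∥ {stateTy} S + suc (bits c + ∥_∥ {planTy} α))
    ≤⟨ s≤s (+-mono-≤ (S≤ (known sound)) (s≤s (+-mono-≤ (≤-trans (bits-mono (cheap sound)) (≤-trans (m≤n+m _ _) ks≤))
         (≤-trans (size-plan α) (*-monoʳ-≤ 3 (subst (λ x → ∥_∥ {list itemTy} x ≤ N) (sym (items sound)) is≤)))))) ⟩
  suc (9 + N + suc (N + 3 * N))  ≡⟨ lem N ⟩
  11 + 5 * N                     ∎
  where
  open ≤-Reasoning
  open Sound
  sound : Sound f b ks is (S , c , α)
  sound = table-sound f b ks is e∈
  S≤ : S ≡ initial ⊎ S ∈ ks → ∥_∥ {stateTy} S ≤ 9 + N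
  S≤ (inj₁ refl) = m≤m+n 9 N
  S≤ (inj₂ S∈)   = ≤-trans (size-∈ stateTy S∈) (≤-trans (≤-trans (m≤m+n _ _) ks≤) (m≤n+m _ 9))
  lem : ∀ n → suc (9 + n + suc (n + 3 * n)) ≡ 11 + 5 * n
  lem = solve-∀

size-table : ∀ f b ks is N → ∥_∥ {list stateTy} ks + bits b ≤ N → ∥_∥ {list itemTy} is ≤ N →
             ∥_∥ {list entryTy} (table f b ks is) ≤ 1 + (1 + N) * (12 + 5 * N)
size-table f b ks is N ks≤ is≤ = ≤-trans
  (size-list entryTy (table f b ks is) (11 + 5 * N) (size-entry f b ks is N ks≤ is≤))
  (s≤s (*-monoˡ-≤ (12 + 5 * N) (≤-trans (length-table f b ks is) (s≤s (≤-trans (length≤size stateTy ks) (≤-trans (m≤m+n _ _) ks≤))))))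

-- A layer may double the number of entries before `keep` thins them out, so no additive bound on a
-- step is available. `size-table` bounds all intermediate tables directly.
tableₜ : Tm (scalingTy ∷ num ∷ list stateTy ∷ list itemTy ∷ []) (list entryTy)
tableₜ = as
  (foldrₜ (call-with layerₜ (v2 ∷ v3 ∷ v4 ∷ v0 ∷ v1 ∷ [])) ((initialₜ ,ₜ literal 0 ,ₜ nil) ∷ₜ nil) v3
    (# 1 ⊕ (# 1 ⊕ X) ⊛ (# 12 ⊕ # 5 ⊛ X))
    λ (f , b , ks , is , _) ys → size-table (scaling f) b ks ys _
      (≤-trans (≤-trans (≤-trans (≤-reflexive (+-comm (∥_∥ {list stateTy} ks) (bits b)))
        (+-monoʳ-≤ (bits b) (m≤m+n _ _))) (m≤n+m _ (∥_∥ {scalingTy} f))) (m≤m+n _ (∥_∥ {list itemTy} ys)))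
      (m≤n+m _ (∣_∣ₑ {scalingTy ∷ num ∷ list stateTy ∷ list itemTy ∷ []} (f , b , ks , is , _))))
  (λ (f , b , ks , is , _) → table (scaling f) b ks is) (λ _ → refl)

unscaledₜ : Tm (planTy ∷ []) stateTy
unscaledₜ = as
  (foldrₜ (call-with advanceₜ (first v0 ∷ second v0 ∷ v1 ∷ [])) initialₜ v0 (# 5 ⊕ # 8 ⊛ X)
    λ ρ ys → ≤-trans (size-unscaled ys) (+-monoʳ-≤ 5 (*-monoʳ-≤ 8 (m≤n+m _ ∣ ρ ∣ₑ))))
  (λ (α , _) → unscaled α) (λ _ → refl)

valueₜ : ∀ {Γ} → Tm Γ stateTy → Tm Γ num
valueₜ S = first (second (second (second S))) +ₜ second (second (second (second S)))

candidatesₜ : ℕ → Tm (num ∷ list itemTy ∷ list stateTy ∷ num ∷ []) (list (num ⊗ planTy))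
candidatesₜ d = as
  (for call-with tableₜ ((v3 ,ₜ q ,ₜ literal 2 *ₜ q) ∷ v0 ∷ v2 ∷ v1 ∷ []) yield
    singleₜ (valueₜ (call-with unscaledₜ (second (second v0) ∷ [])) ,ₜ second (second v0)))
  (λ (b , is , ks , P , _) → candidates d b is ks P) (λ _ → refl)
  where q = literal d *ₜ lengthₜ v1

plansₜ : ℕ → Tm (num ∷ list itemTy ∷ []) (list (num ⊗ planTy))
plansₜ d = as
  (letₜ (call-with allStatesₜ (call-with (rangeₜ d) (v1 ∷ []) ∷ []))
    (lightestₜ (for powersUpToₜ (call-with totalₜ (v2 ∷ [])) yield call-with (candidatesₜ d) (v2 ∷ v3 ∷ v1 ∷ v0 ∷ []))))
  (λ (b , is , _) → plans d b is) (λ _ → refl)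

-- Each slot needs the state reached by the items below it, so the fold carries this state along
-- instead of recomputing it.
timelineₜ : Tm (num ∷ planTy ∷ []) (list slotTy)
timelineₜ = as (second (as
    (foldrₜ (call-with advanceₜ (first v0 ∷ second v0 ∷ first v1 ∷ []) ,ₜ
             ((first (first v0) ,ₜ second v0 ,ₜ loadₜ (first v0) (second v0)
               ,ₜ if second v0 then durationₜ (first v0) (second v0) else literal 0 fi
               ,ₜ ℓ ,ₜ ℓ *ₜ v2 +ₜ lengthₜ (second v1)) ∷ₜ second v1))
      (initialₜ ,ₜ nil) v1 (# 7 ⊕ # 8 ⊛ X ⊕ X ⊛ (# 8 ⊕ # 9 ⊛ X)) bound)
    (λ (M , α , _) → unscaled α , timeline M α) (λ (M , α , _) → eq M α)))
  (λ (M , α , _) → timeline M α) (λ _ → refl)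
  where
  ℓ : Tm ((itemTy ⊗ bool) ∷ (stateTy ⊗ list slotTy) ∷ num ∷ planTy ∷ []) num
  ℓ = call-with startₜ (first v0 ∷ second v0 ∷ first v1 ∷ [])
  both : ℕ → Item × Bool → State × List Slot → State × List Slot
  both M (i , σ) (S , ss) = advance i σ S ,
    (proj₁ i , σ , load i σ , (if σ then duration i σ else 0) , begins i σ S , begins i σ S * M + length ss) ∷ ss
  eq : ∀ M α → foldr (both M) (initial , []) α ≡ (unscaled α , timeline M α)
  eq M []      = refl
  eq M (x ∷ α) = cong (both M x) (eq M α)
  bound : ∀ (ρ : Env (num ∷ planTy ∷ [])) ys → size (enc (stateTy ⊗ list slotTy) (foldr (both (proj₁ ρ)) (initial , []) ys)) ≤
          eval (# 7 ⊕ # 8 ⊛ X ⊕ X ⊛ (# 8 ⊕ # 9 ⊛ X)) (∣ ρ ∣ₑ + ∥_∥ {planTy} ys)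
  bound ρ@(M , α , _) ys = subst (λ x → size (enc (stateTy ⊗ list slotTy) x) ≤ 7 + 8 * N + N * (8 + 9 * N)) (sym (eq M ys)) (begin
    suc (∥_∥ {stateTy} (unscaled ys) + ∥_∥ {list slotTy} (timeline M ys))
      ≤⟨ s≤s (+-mono-≤ (≤-trans (size-unscaled ys) (+-monoʳ-≤ 5 (*-monoʳ-≤ 8 ys≤)))
                       (size-timeline M ys N ys≤ (≤-trans (m≤m+n _ _) (m≤m+n _ (∥_∥ {planTy} ys))))) ⟩
    suc (5 + 8 * N + (1 + N * (8 + 9 * N)))
      ≡⟨ cong suc (+-suc (5 + 8 * N) _) ⟩
    7 + 8 * N + N * (8 + 9 * N) ∎)
    where
    open ≤-Reasoning
    N = ∣ ρ ∣ₑ + ∥_∥ {planTy} ys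
    ys≤ : ∥_∥ {planTy} ys ≤ N
    ys≤ = m≤n+m _ ∣ ρ ∣ₑ

solveₜ : ℕ → Tm (list recTy ∷ num ∷ num ∷ []) (list (bool ⊗ num))
solveₜ d = as
  (for call-with (plansₜ d) (v2 ∷ call-with allItemsₜ (v0 ∷ v1 ∷ []) ∷ []) yield
    call-with outputₜ (v1 ∷ call-with timelineₜ ((literal 1 +ₜ lengthₜ (second v0)) ∷ second v0 ∷ []) ∷ []))
  (λ (J , s , b , _) → solve d J s b) (λ _ → refl)

inputTy : Ty
inputTy = num ⊗ num ⊗ num ⊗ list num ⊗ list (list num) ⊗ list (list (list num)) ⊗ num ⊗ num

algorithm : ℕ → El inputTy → List (Bool × ℕ)
algorithm d (n , s , _ , ps , pc , ds , b , _) = solve d (records n ps pc ds) s b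

algorithmₜ : ℕ → Tm (inputTy ∷ []) (list (bool ⊗ num))
algorithmₜ d = as
  (call-with (solveₜ d)
    (call-with recordsₜ
      (first v0 ∷ first (second (second (second v0))) ∷ first (second (second (second (second v0))))
        ∷ first (second (second (second (second (second v0))))) ∷ [])
    ∷ first (second v0) ∷ first (second (second (second (second (second (second v0)))))) ∷ []))
  (λ (x , _) → algorithm d x) (λ _ → refl)

-- Rounding

m<[1+m/n]*n : ∀ m n → m < suc (m / suc n) * suc n
m<[1+m/n]*n m n = ≤-<-trans (≤-reflexive (m≡m%n+[m/n]*n m (suc n))) (+-monoˡ-< (m / suc n * suc n) (m%n<n m (suc n)))

min-sel : ∀ m n → (min m n ≡ m × m ≤ n) ⊎ (min m n ≡ n × n ≤ m)
min-sel m n with m ≤ᵇ n in eq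
... | true  = inj₁ (refl , ≤ᵇ≡true⇒≤ eq)
... | false = inj₂ (refl , <⇒≤ (≤ᵇ≡false⇒> eq))

max-sel : ∀ m n → max m n ≡ m ⊎ max m n ≡ n
max-sel m n with ≤-total m n
... | inj₁ m≤n = inj₂ (m+[n∸m]≡n m≤n)
... | inj₂ n≤m = inj₁ (trans (cong (m +_) (m≤n⇒m∸n≡0 n≤m)) (+-identityʳ m))

module Rounding (p Q K : ℕ) where

  P : ℕ
  P = suc p

  -- y is x scaled by Q / P up to an additive error e, unless it exceeds K.
  record Close (e x y : ℕ) : Set where
    constructor close
    field
      below : P * y ≤ Q * x
      above : y < K → Q * x ≤ P * (y + e)
  open Close

  close-scale : ∀ x → Close 1 x (scale P Q K x)
  close-scale x with min-sel (quotient (x * Q) P) K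
  ... | inj₁ (eq , _) = subst (Close 1 x) (sym eq) (close
    (≤-trans (≤-reflexive (*-comm P _)) (≤-trans (m/n*n≤m (x * Q) P) (≤-reflexive (*-comm x Q))))
    λ _ → ≤-trans (≤-reflexive (*-comm Q x)) (≤-trans (<⇒≤ (m<[1+m/n]*n (x * Q) p)) (≤-reflexive
      (trans (cong (_* P) (+-comm 1 (x * Q / P))) (*-comm (x * Q / P + 1) P)))))
  ... | inj₂ (eq , K≤) = subst (Close 1 x) (sym eq) (close
    (≤-trans (*-monoʳ-≤ P K≤) (≤-trans (≤-reflexive (*-comm P _)) (≤-trans (m/n*n≤m (x * Q) P) (≤-reflexive (*-comm x Q)))))
    -- A capped value equals K, so the upper estimate claims nothing for it.
    λ K<K → ⊥-elim (<-irrefl refl K<K))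

  scale≤ : ∀ x → scale P Q K x ≤ K
  scale≤ x with min-sel (quotient (x * Q) P) K
  ... | inj₁ (eq , le) = ≤-trans (≤-reflexive eq) le
  ... | inj₂ (eq , _)  = ≤-reflexive eq

  close-0 : ∀ e → Close e 0 0
  close-0 e = close (≤-reflexive (trans (*-zeroʳ P) (sym (*-zeroʳ Q)))) λ _ → ≤-trans (≤-reflexive (*-zeroʳ Q)) z≤n

  close-mono : ∀ {e e′ x y} → e ≤ e′ → Close e x y → Close e′ x y
  close-mono {y = y} e≤ c = close (below c) λ lt → ≤-trans (above c lt) (*-monoʳ-≤ P (+-monoʳ-≤ y e≤))

  close-≡ : ∀ {e e′ x y} → e ≡ e′ → Close e x y → Close e′ x y
  close-≡ eq = close-mono (≤-reflexive eq)

  close-+ : ∀ {e e′ x y x′ y′} → Close e x y → Close e′ x′ y′ → Close (e + e′) (x + x′) (y + y′)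
  close-+ {e} {e′} {x} {y} {x′} {y′} c c′ = close
    (begin
      P * (y + y′)      ≡⟨ *-distribˡ-+ P y y′ ⟩
      P * y + P * y′    ≤⟨ +-mono-≤ (below c) (below c′) ⟩
      Q * x + Q * x′    ≡⟨ *-distribˡ-+ Q x x′ ⟨
      Q * (x + x′)      ∎)
    λ lt → begin
      Q * (x + x′)                   ≡⟨ *-distribˡ-+ Q x x′ ⟩
      Q * x + Q * x′                 ≤⟨ +-mono-≤ (above c (≤-<-trans (m≤m+n y y′) lt)) (above c′ (≤-<-trans (m≤n+m y′ y) lt)) ⟩
      P * (y + e) + P * (y′ + e′)    ≡⟨ lem P y e y′ e′ ⟩
      P * (y + y′ + (e + e′))        ∎
    where
    open ≤-Reasoning
    lem : ∀ P y e y′ e′ → P * (y + e) + P * (y′ + e′) ≡ P * (y + y′ + (e + e′))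
    lem = solve-∀

  close-max : ∀ {e x y x′ y′} → Close e x y → Close e x′ y′ → Close e (max x x′) (max y y′)
  close-max {e} {x} {y} {x′} {y′} c c′ = close
    (case max-sel y y′ of λ
      { (inj₁ eq) → subst (λ w → P * w ≤ Q * max x x′) (sym eq) (≤-trans (below c) (*-monoʳ-≤ Q (m≤max x x′)))
      ; (inj₂ eq) → subst (λ w → P * w ≤ Q * max x x′) (sym eq) (≤-trans (below c′) (*-monoʳ-≤ Q (n≤max x x′))) })
    λ lt → case max-sel x x′ of λ
      { (inj₁ eq) → subst (λ w → Q * w ≤ P * (max y y′ + e)) (sym eq)
          (≤-trans (above c (≤-<-trans (m≤max y y′) lt)) (*-monoʳ-≤ P (+-monoˡ-≤ e (m≤max y y′))))
      ; (inj₂ eq) → subst (λ w → Q * w ≤ P * (max y y′ + e)) (sym eq)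
          (≤-trans (above c′ (≤-<-trans (n≤max y y′) lt)) (*-monoʳ-≤ P (+-monoˡ-≤ e (n≤max y y′)))) }

  close-if : ∀ {e x y x′ y′} b → Close e x y → Close e x′ y′ → Close e (if b then x else x′) (if b then y else y′)
  close-if true  c c′ = c
  close-if false c c′ = c′

  rounded : Item → Item
  rounded = scaleItem P Q K

  close-duration : ∀ i σ → Close 1 (duration i σ) (duration (rounded i) σ)
  close-duration i true  = subst (Close 1 _) (sym (+-identityʳ _)) (close-scale (sum (cloudTimes i)))
  close-duration i false = close-scale _

  close-load : ∀ i σ → Close 1 (load i σ) (load (rounded i) σ)
  close-load i σ = close-if σ (close-0 1) (close-scale _)

  close-inDelay : ∀ i σ a → Close 1 (inDelay i σ a) (inDelay (rounded i) σ a)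
  close-inDelay i σ a = close-if (differ a σ) (close-scale _) (close-0 1)

  close-detour : ∀ i σ a b → Close 3 (detour i σ a b) (detour (rounded i) σ a b)
  close-detour i σ a b = close-+ (close-+ (close-inDelay i σ a) (close-duration i σ)) (close-if (differ σ b) (close-scale _) (close-0 1))

  -- A detour consists of an in-delay, a duration and an out-delay, each with error 1, and maxima
  -- over parallel jobs keep the error at 3. A chain node moves this into the clock together with
  -- the error 1 of its own duration, hence 4 per item.
  record CloseState (n : ℕ) (S T : State) : Set where
    constructor closeState
    field
      sides  : proj₁ S ≡ proj₁ T
      fronts : ∀ b → Close 3 (front S b) (front T b)
      clocks : Close (n * 4) (clock S) (clock T)
      loads  : Close n (serverLoad S) (serverLoad T)
  open CloseState

  close-advance : ∀ {n S T} i σ → CloseState n S T → CloseState (suc n) (advance i σ S) (advance (rounded i) σ T)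
  close-advance {n} {a , ms , mc , D , L} {.a , ms′ , mc′ , D′ , L′} i@(_ , true , _) σ (closeState refl fs c l) = closeState refl
    (λ b → close-if b (close-0 3) (close-0 3))
    (close-≡ (lem n) (close-+
      (close-+ c (close-max (close-if σ (fs true) (fs false)) (close-mono (s≤s z≤n) (close-inDelay i σ a))))
      (close-duration i σ)))
    (close-≡ (+-comm n 1) (close-+ l (close-load i σ)))
    where
    lem : ∀ n → n * 4 + 3 + 1 ≡ suc n * 4
    lem = solve-∀
  close-advance {n} {a , ms , mc , D , L} {.a , ms′ , mc′ , D′ , L′} i@(_ , false , _) σ (closeState refl fs c l) = closeState refl
    (λ b → close-if b (close-max (fs true) (close-detour i σ a true)) (close-max (fs false) (close-detour i σ a false)))
    (close-mono (m≤n+m _ 4) c)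
    (close-≡ (+-comm n 1) (close-+ l (close-load i σ)))

  close-run : ∀ α → CloseState (length α) (unscaled α) (run rounded α)
  close-run []            = closeState refl (λ b → close-if b (close-0 3) (close-0 3)) (close-0 0) (close-0 0)
  close-run ((i , σ) ∷ α) = close-advance i σ (close-run α)

  close-value : ∀ α → Close (length α * 5) (value (unscaled α)) (value (run rounded α))
  close-value α = close-≡ (lem (length α)) (close-+ (clocks (close-run α)) (loads (close-run α)))
    where
    lem : ∀ n → n * 4 + n ≡ n * 5
    lem = solve-∀

  total-rounded : ∀ is → total (map rounded is) ≤ length is * (5 * K)
  total-rounded []                             = z≤n
  total-rounded ((j , b , ps , pc , r , q) ∷ is) = +-mono-≤
    (≤-trans (+-mono-≤ (+-mono-≤ (scale≤ ps) (scale≤ ps)) (+-mono-≤ (+-mono-≤ (scale≤ (sum pc)) (≤-refl {0})) (+-mono-≤ (scale≤ r) (scale≤ q))))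
      (≤-reflexive (lem K)))
    (total-rounded is)
    where
    lem : ∀ k → k + k + (k + 0 + (k + k)) ≡ 5 * k
    lem = solve-∀

  potential-rounded : ∀ α b → potential (run rounded α) b ≤ length α * (5 * K)
  potential-rounded α b = ≤-trans (potential-run rounded α b) (≤-trans (≤-reflexive (cong total (map-∘ α)))
    (≤-trans (total-rounded (itemsOf α)) (≤-reflexive (cong (_* (5 * K)) (length-map proj₁ α)))))
    where open import Data.List.Properties using (map-∘)

∈-powers : ∀ {i k} → i ≤ k → 2 ^ i ∈ powers k
∈-powers {i} {zero}  z≤n = here refl
∈-powers {i} {suc k} i≤ with m≤n⇒m<n∨m≡n i≤
... | inj₁ (s≤s i≤k) = there (∈-powers i≤k)
... | inj₂ refl      = here refl

∈-allStates : ∀ {R a m n D L} → m ∈ R → n ∈ R → D ∈ R → L ∈ R → (a , m , n , D , L) ∈ allStates R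
∈-allStates {R} {a} {m} {n} {D} {L} m∈ n∈ D∈ L∈ =
  ∈-for⁺ {f = f₁} (∈-bools a) (∈-for⁺ {f = f₂ a} m∈ (∈-for⁺ {f = f₃ a m} n∈ (∈-for⁺ {f = f₄ a m n} D∈
    (∈-for⁺ {f = f₅ a m n D} L∈ (here refl)))))
  where
  f₅ : Bool → ℕ → ℕ → ℕ → ℕ → List State
  f₅ a m n D L = (a , m , n , D , L) ∷ []
  f₄ : Bool → ℕ → ℕ → ℕ → List State
  f₄ a m n D = concatMap (f₅ a m n D) R
  f₃ : Bool → ℕ → ℕ → List State
  f₃ a m n = concatMap (f₄ a m n) R
  f₂ : Bool → ℕ → List State
  f₂ a m = concatMap (f₃ a m) R
  f₁ : Bool → List State
  f₁ a = concatMap (f₂ a) R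
  ∈-bools : ∀ a → a ∈ false ∷ true ∷ []
  ∈-bools false = here refl
  ∈-bools true  = there (here refl)

known-state : ∀ {N S} → (∀ b → potential S b < N) → S ∈ allStates (downFrom N)
known-state {N} {S} h = ∈-allStates
  (∈-downFrom⁺ (≤-<-trans (front≤ S false) (h false))) (∈-downFrom⁺ (≤-<-trans (front≤ S true) (h true)))
  (∈-downFrom⁺ (≤-<-trans (clock≤ S) (h false))) (∈-downFrom⁺ (≤-<-trans (serverLoad≤ S) (h false)))

length-for-constant : ∀ {A B : Set} (ys : List B) (xs : List A) → length (concatMap (λ _ → ys) xs) ≡ length xs * length ys
length-for-constant ys []       = refl
length-for-constant ys (x ∷ xs) = trans (length-++ ys) (cong (length ys +_) (length-for-constant ys xs))

length-range : ∀ d (is : List Item) → suc (length is * (length is * (10 * d))) ≡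
               length (0 ∷ concatMap (λ (_ : Item) → concatMap (λ (_ : Item) → replicate (10 * d) 0) is) is)
length-range d is = cong suc (sym (trans (length-for-constant (concatMap (λ _ → replicate (10 * d) 0) is) is)
  (cong (length is *_) (trans (length-for-constant (replicate (10 * d) 0) is) (cong (length is *_) (length-replicate (10 * d)))))))

range≡ : ∀ d is → range d is ≡ downFrom (suc (length is * (length is * (10 * d))))
range≡ d is = sym (cong downFrom (length-range d is))

-- The value of the best plan

record Feasible (b : ℕ) (is : List Item) (α : Plan) : Set where
  constructor feasible
  field
    items   : itemsOf α ≡ is
    allowed : All Allowed α
    cheap   : planCost α ≤ b

-- 2 ^ ⌊log₂ v⌋, which is 1 if v = 0.
scale-for : ∀ v → ∃[ p ] ∃[ i ] suc p ≡ 2 ^ i × i ≤ ⌊log₂ v ⌋ × v < 2 * suc p × (suc p ≤ v ⊎ v ≡ 0)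
scale-for v with 2 ^ ⌊log₂ v ⌋ in eq
... | zero  = ⊥-elim (<⇒≢ (m^n>0 2 ⌊log₂ v ⌋) (sym eq))
... | suc p = p , ⌊log₂ v ⌋ , sym eq , ≤-refl , subst (λ x → v < 2 * x) eq (n<2^bits v) , lower v eq
  where
  lower : ∀ v → 2 ^ ⌊log₂ v ⌋ ≡ suc p → suc p ≤ v ⊎ v ≡ 0
  lower zero    _  = inj₂ refl
  lower (suc v) eq = inj₁ (subst (_≤ suc v) eq (2^⌊log₂n⌋≤n (suc v) (s≤s z≤n)))

module _ (d b : ℕ) (5<d : 5 < d) (is : List Item) (1≤n : 1 ≤ length is) where
  private
    n = length is
    ks = allStates (range d is)

  module _ {α : Plan} (feas : Feasible b is α) where
    open Feasible feas

    private
      V = value (unscaled α)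

      choice = scale-for V
      p = proj₁ choice
      V<2P : V < 2 * suc p
      V<2P = proj₁ (proj₂ (proj₂ (proj₂ (proj₂ choice))))

      -- A unit is P / Q, so n items with error 5 each are off by 5 P / d in total. As V < 2 P, the
      -- scaled value of `α` is below 2 Q, which is why K suffices as a cap.
      Q K : ℕ
      Q = d * n
      K = 2 * Q
      open Rounding p Q K

      1≤Q : 1 ≤ Q
      1≤Q = *-mono-≤ (≤-trans (s≤s z≤n) 5<d) 1≤n

      length-α : length α ≡ n
      length-α = trans (sym (length-map proj₁ α)) (cong length items)

      inside : ∀ β → length β ≤ n → Inside rounded b ks β
      inside []      _  = tt
      inside (x ∷ β) le = subst (λ R → run rounded (x ∷ β) ∈ allStates R) (sym (range≡ d is))
        (known-state λ c → s≤s (≤-trans (potential-rounded (x ∷ β) c) (≤-trans (*-monoˡ-≤ (5 * K) le) (≤-reflexive (lem n d))))) ,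
        inside β (≤-trans (n≤1+n _) le)
        where
        lem : ∀ n d → n * (5 * (2 * (d * n))) ≡ n * (n * (10 * d))
        lem = solve-∀

      V≤total : V ≤ total is
      V≤total = ≤-trans (+-monoˡ-≤ (serverLoad (unscaled α)) (m≤m+n (clock (unscaled α)) (front (unscaled α) false)))
        (≤-trans (potential-unscaled α false) (≤-reflexive (cong total items)))

      P∈ : P ∈ powers ⌊log₂ total is ⌋
      P∈ = let _ , i , eq , i≤ , _ = choice in
        subst (_∈ powers ⌊log₂ total is ⌋) (sym eq) (∈-powers (≤-trans i≤ (⌊log₂⌋-mono-≤ V≤total)))

      found : ∃[ e ] e ∈ table rounded b ks is × proj₁ e ≡ run rounded α × proj₁ (proj₂ e) ≤ planCost α
      found = subst (λ js → ∃[ e ] e ∈ table rounded b ks js × proj₁ e ≡ run rounded α × proj₁ (proj₂ e) ≤ planCost α) items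
        (table-complete rounded b ks α allowed cheap (inside α (≤-reflexive length-α)))

      β : Plan
      β = proj₂ (proj₂ (proj₁ found))

      sound = table-sound rounded b ks is (proj₁ (proj₂ found))

      W = value (unscaled β)

      length-β : length β ≡ n
      length-β = trans (sym (length-map proj₁ β)) (cong length (Sound.items sound))

      rounded-value : value (run rounded β) ≡ value (run rounded α)
      rounded-value = cong value (trans (sym (Sound.state sound)) (proj₁ (proj₂ (proj₂ found))))

      small-value : value (run rounded α) < K
      small-value = *-cancelˡ-< P _ _ (begin-strict
        P * value (run rounded α)  ≤⟨ Close.below (close-value α) ⟩
        Q * V                      <⟨ *-monoʳ-< Q {{>-nonZero 1≤Q}} V<2P ⟩
        Q * (2 * P)                ≡⟨ lem Q P ⟩
        P * K                      ∎)
        where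
        open ≤-Reasoning
        lem : ∀ q p → q * (2 * p) ≡ p * (2 * q)
        lem = solve-∀

      Q*W≤ : Q * W ≤ Q * V + P * (n * 5)
      Q*W≤ = begin
        -- The upper estimate is available for `β` because its rounded value is that of `α` and thus
        -- below the cap.
        Q * W                                            ≤⟨ Close.above (close-value β) (subst (_< K) (sym rounded-value) small-value) ⟩
        P * (value (run rounded β) + length β * 5)       ≡⟨ cong₂ (λ v l → P * (v + l * 5)) rounded-value length-β ⟩
        P * (value (run rounded α) + n * 5)              ≡⟨ *-distribˡ-+ P _ (n * 5) ⟩
        P * value (run rounded α) + P * (n * 5)          ≤⟨ +-monoˡ-≤ _ (Close.below (close-value α)) ⟩
        Q * V + P * (n * 5)                              ∎
        where open ≤-Reasoning

      d*W≤ : d * W ≤ d * V + P * 5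
      d*W≤ = *-cancelˡ-≤ n {{>-nonZero 1≤n}} (begin
        n * (d * W)                  ≡⟨ lem n d W ⟩
        Q * W                        ≤⟨ Q*W≤ ⟩
        Q * V + P * (n * 5)          ≡⟨ lem′ n d V P ⟩
        n * (d * V + P * 5)          ∎)
        where
        open ≤-Reasoning
        lem : ∀ n d w → n * (d * w) ≡ d * n * w
        lem = solve-∀
        lem′ : ∀ n d v p → d * n * v + p * (n * 5) ≡ n * (d * v + p * 5)
        lem′ = solve-∀

      ratio : d * W ≤ (d + 5) * V
      ratio = go (proj₂ (proj₂ (proj₂ (proj₂ (proj₂ choice)))))
        where
        open ≤-Reasoning
        go : P ≤ V ⊎ V ≡ 0 → d * W ≤ (d + 5) * V
        go (inj₁ P≤V) = begin
          d * W              ≤⟨ d*W≤ ⟩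
          d * V + P * 5      ≤⟨ +-monoʳ-≤ (d * V) (*-monoˡ-≤ 5 P≤V) ⟩
          d * V + V * 5      ≡⟨ lem d V ⟩
          (d + 5) * V        ∎
          where
          lem : ∀ d v → d * v + v * 5 ≡ (d + 5) * v
          lem = solve-∀
        -- Here P = 1 exceeds V, and the error is not relative to V. Integrality helps: d W ≤ 5 < d
        -- forces W = 0.
        go (inj₂ V≡0) = ≤-trans (≤-reflexive (trans (cong (d *_) (W≡0 W d*W≤5)) (*-zeroʳ d))) z≤n
          where
          P<2 : P ≤ 1
          P<2 = s≤s (≤-reflexive p≡0)
            where
            p≡0 : p ≡ 0
            p≡0 = subst (λ v → proj₁ (scale-for v) ≡ 0) (sym V≡0) refl
          d*W≤5 : d * W ≤ 5
          d*W≤5 = ≤-trans d*W≤ (≤-trans (+-mono-≤ (≤-reflexive (trans (cong (d *_) V≡0) (*-zeroʳ d))) (*-monoˡ-≤ 5 P<2)) (≤-refl {5}))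
          W≡0 : ∀ w → d * w ≤ 5 → w ≡ 0
          W≡0 zero    _  = refl
          W≡0 (suc w) le = ⊥-elim (<⇒≱ 5<d (≤-trans (m≤m*n d (suc w)) le))

      candidate : (W , β) ∈ concatMap (candidates d b is ks) (powers ⌊log₂ total is ⌋)
      candidate = ∈-for⁺ {f = candidates d b is ks} P∈ (∈-for⁺ (proj₁ (proj₂ found)) (here refl))

    -- No optimal plan has to be singled out: for every feasible `α` the power of two belonging to
    -- its own value is among those tried, as this value is at most the total weight, and the table
    -- for that power holds a plan nearly as good.
    best-ratio : ∀ {x} → x ∈ plans d b is → d * proj₁ x ≤ (d + 5) * value (unscaled α)
    best-ratio x∈ = ≤-trans (*-monoʳ-≤ d (proj₂ (∈-lightest {xs = concatMap (candidates d b is ks) (powers ⌊log₂ total is ⌋)} x∈) candidate)) ratio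

    best-exists : ∃[ x ] plans d b is ≡ x ∷ []
    best-exists = lightest-exists candidate

  best-feasible : ∀ {x} → x ∈ plans d b is → proj₁ x ≡ value (unscaled (proj₂ x)) × Feasible b is (proj₂ x)
  best-feasible x∈ =
    let x∈′ , _ = ∈-lightest {xs = concatMap (candidates d b is ks) (powers ⌊log₂ total is ⌋)} x∈
        P , _ , x∈P = ∈-for⁻ {f = candidates d b is ks} (powers ⌊log₂ total is ⌋) x∈′
        tab = table (scaleItem P (d * n) (2 * (d * n))) b ks is
        e , e∈ , x≡ = ∈-for⁻ {f = λ e → (value (unscaled (proj₂ (proj₂ e))) , proj₂ (proj₂ e)) ∷ []} tab x∈P
        s = table-sound (scaleItem P (d * n) (2 * (d * n))) b ks is e∈
    in subst (λ x → proj₁ x ≡ value (unscaled (proj₂ x)) × Feasible b is (proj₂ x)) (sym (∈-single x≡))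
         (refl , feasible (Sound.items s) (Sound.allowed s) (subst (_≤ b) (Sound.costs s) (Sound.cheap s)))

-- From the encoded instance to the list of items

concatMap-tabulate-single : ∀ {A B : Set} {n} (f : A → List B) (g : Fin n → A) i →
                            (∀ j → j ≢ i → f (g j) ≡ []) → concatMap f (tabulate g) ≡ f (g i)
concatMap-tabulate-single {n = suc n} f g zero h = trans (cong (f (g zero) ++_) (none (g ∘ suc) (λ j → h (suc j) λ ()))) (++-identityʳ _)
  where
  none : ∀ {n} (g : Fin n → _) → (∀ j → f (g j) ≡ []) → concatMap f (tabulate g) ≡ []
  none {zero}  g h = refl
  none {suc n} g h rewrite h zero = none (g ∘ suc) (h ∘ suc)
concatMap-tabulate-single {n = suc n} f g (suc i) h rewrite h zero (λ ()) =
  concatMap-tabulate-single f (g ∘ suc) i λ j j≢i → h (suc j) (j≢i ∘ Fin.suc-injective)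

concatMap-[] : ∀ {A B : Set} (f : A → List B) xs → (∀ x → f x ≡ []) → concatMap f xs ≡ []
concatMap-[] f []       h = refl
concatMap-[] f (x ∷ xs) h rewrite h x = concatMap-[] f xs h

concatMap-singletons : ∀ {A B : Set} (f : A → List B) (g : A → B) xs → (∀ x → f x ≡ g x ∷ []) → concatMap f xs ≡ map g xs
concatMap-singletons f g []       h = refl
concatMap-singletons f g (x ∷ xs) h rewrite h x = cong (g x ∷_) (concatMap-singletons f g xs h)

-- The algorithm looks up a job by scanning all entries for its number. As the entries carry the
-- numbers `toℕ j`, such a scan meets exactly one match.
select : ∀ {A B : Set} {n} (key : A → ℕ) (f : A → List B) (g : Fin n → A) → (∀ j → key (g j) ≡ toℕ j) →
         ∀ i → concatMap (λ x → if same (key x) (toℕ i) then f x else []) (tabulate g) ≡ f (g i)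
select key f g keys i = trans
  (concatMap-tabulate-single (λ x → if same (key x) (toℕ i) then f x else []) g i
    λ j j≢i → cong (λ b → if b then f (g j) else []) (≢⇒same (λ eq → j≢i (Fin.toℕ-injective (trans (sym (keys j)) eq)))))
  (cong (λ b → if b then f (g i) else []) (trans (cong (λ k → same k (toℕ i)) (keys i)) (same-refl (toℕ i))))

select′ : ∀ {A B : Set} {n} (key : A → ℕ) (f : A → List B) (g : Fin n → A) → (∀ j → key (g j) ≡ toℕ j) →
          ∀ i → concatMap (λ x → if same (toℕ i) (key x) then f x else []) (tabulate g) ≡ f (g i)
select′ key f g keys i = trans
  (concatMap-tabulate-single (λ x → if same (toℕ i) (key x) then f x else []) g i
    λ j j≢i → cong (λ b → if b then f (g j) else []) (≢⇒same (λ eq → j≢i (Fin.toℕ-injective (trans (sym (keys j)) (sym eq))))))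
  (cong (λ b → if b then f (g i) else []) (trans (cong (λ k → same (toℕ i) k) (keys i)) (same-refl (toℕ i))))

length-enumerate : ∀ {A : Set} n (xs : List A) → length (enumerate n xs) ≡ length xs
length-enumerate n []       = refl
length-enumerate n (x ∷ xs) = cong suc (length-enumerate n xs)

-- `enumerate` computes a number from the length of what remains, while its first argument stays
-- fixed; the offset `m` makes the induction go through.
enumerate-tabulate : ∀ {A : Set} {n} m (g : Fin n → A) →
                     enumerate (m + n) (tabulate g) ≡ tabulate (λ j → m + toℕ j , g j)
enumerate-tabulate {n = zero}  m g = refl
enumerate-tabulate {n = suc n} m g = cong₂ _∷_
  (cong (_, g zero) (trans (cong (λ l → m + suc n ∸ suc l) (trans (length-enumerate (m + suc n) (tabulate (g ∘ suc))) (length-tabulate (g ∘ suc))))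
    (trans (m+n∸n≡m m (suc n)) (sym (+-identityʳ m)))))
  (trans (cong (λ k → enumerate k (tabulate (g ∘ suc))) (+-suc m n))
    (trans (enumerate-tabulate (suc m) (g ∘ suc)) (tabulate-cong (λ j → cong (_, g (suc j)) (sym (+-suc m (toℕ j)))))))

toL : Maybe ℕ → List ℕ
toL nothing  = []
toL (just d) = d ∷ []

enc-Maybe : ∀ m → encodeMaybe m ≡ enc (list num) (toL m)
enc-Maybe nothing  = refl
enc-Maybe (just _) = refl

tabulated-enc : ∀ a {n} {f : Fin n → Val} (g : Fin n → El a) → (∀ j → f j ≡ enc a (g j)) →
                tabulated f ≡ enc (list a) (tabulate g)
tabulated-enc a {zero}  g h = refl
tabulated-enc a {suc n} g h = cong₂ pair (h zero) (tabulated-enc a (g ∘ suc) (h ∘ suc))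

Unique⇒length≤ : ∀ {n} {xs : List (Fin n)} → Unique xs → length xs ≤ n
Unique⇒length≤ {xs = xs} u = Fin.injective⇒≤ (lookup-injective u)
  where
  lookup-injective : ∀ {A : Set} {xs : List A} → Unique xs → ∀ {i j} → List.lookup xs i ≡ List.lookup xs j → i ≡ j
  lookup-injective (x∉ ∷ u) {zero}  {zero}  eq = refl
  lookup-injective (x∉ ∷ u) {zero}  {suc j} eq = ⊥-elim (All.lookup x∉ (∈-lookup j) eq)
  lookup-injective (x∉ ∷ u) {suc i} {zero}  eq = ⊥-elim (All.lookup x∉ (∈-lookup i) (sym eq))
  lookup-injective (x∉ ∷ u) {suc i} {suc j} eq = cong suc (lookup-injective u eq)

module Items (I : Instance) where
  open Instance I

  cloudTimesOf : Job → List ℕ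
  cloudTimesOf j = toL (p-c j)

  delays : Job → Job → List ℕ
  delays i j = toL (delay i j)

  inputOf : ℕ → El inputTy
  -- The trailing 0 is the end marker of `encodeList`, which lets the encoded list be read as a
  -- nested tuple.
  inputOf b = #jobs , toℕ s , toℕ t , tabulate p-s , tabulate cloudTimesOf , tabulate (λ i → tabulate (delays i)) , b , 0

  encodeInput≡ : ∀ b → encodeInput I b ≡ enc inputTy (inputOf b)
  encodeInput≡ b = cong (pair (nat #jobs)) (cong (pair (nat (toℕ s))) (cong (pair (nat (toℕ t)))
    (cong₂ pair (tabulated-enc num p-s (λ _ → refl)) (cong₂ pair (tabulated-enc (list num) cloudTimesOf (λ j → enc-Maybe (p-c j)))
      (cong₂ pair (tabulated-enc (list (list num)) (λ i → tabulate (delays i)) (λ i → tabulated-enc (list num) (delays i) (λ j → enc-Maybe (delay i j))))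
        refl)))))

  edgesFrom : Job → Job → List (Job × ℕ)
  edgesFrom u k = map (k ,_) (delays u k)

  succJobs : Job → List (Job × ℕ)
  succJobs u = concatMap (edgesFrom u) (allFin #jobs)

  numbered : Job × ℕ → ℕ × ℕ
  numbered (k , d) = toℕ k , d

  row : Job → List (ℕ × ℕ)
  row u = map numbered (succJobs u)

  rec : Job → Rec
  rec j = toℕ j , p-s j , cloudTimesOf j , row j

  J : List Rec
  J = tabulate rec

  present-row : ∀ u → present (enumerate #jobs (tabulate (delays u))) ≡ row u
  present-row u = begin
    present (enumerate #jobs (tabulate (delays u)))   ≡⟨ cong present (enumerate-tabulate 0 (delays u)) ⟩
    present (tabulate (λ k → toℕ k , delays u k))     ≡⟨ cong present (map-tabulate id (λ k → toℕ k , delays u k)) ⟨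
    present (map (λ k → toℕ k , delays u k) (allFin #jobs))
      ≡⟨ concatMap-map (λ e → concatMap (λ d → (proj₁ e , d) ∷ []) (proj₂ e)) (λ k → toℕ k , delays u k) (allFin #jobs) ⟩
    concatMap (λ k → concatMap (λ d → (toℕ k , d) ∷ []) (delays u k)) (allFin #jobs)
      ≡⟨ concatMap-cong (λ k → trans (concatMap-singletons _ (toℕ k ,_) (delays u k) (λ _ → refl)) (map-∘ (delays u k))) (allFin #jobs) ⟩
    concatMap (map numbered ∘ edgesFrom u) (allFin #jobs)
      ≡⟨ map-concatMap numbered (edgesFrom u) (allFin #jobs) ⟨
    row u ∎
    where
    open ≡-Reasoning

  records≡ : records #jobs (tabulate p-s) (tabulate cloudTimesOf) (tabulate (λ i → tabulate (delays i))) ≡ J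
  records≡ = begin
    records #jobs (tabulate p-s) (tabulate cloudTimesOf) (tabulate (λ i → tabulate (delays i)))
      ≡⟨ cong₂ (λ xs ys → concatMap (λ x → concatMap (λ y → concatMap (entry x y) (enumerate #jobs (tabulate (λ i → tabulate (delays i))))) ys) xs)
           (enumerate-tabulate 0 p-s) (enumerate-tabulate 0 cloudTimesOf) ⟩
    concatMap (λ x → concatMap (λ y → concatMap (entry x y) (enumerate #jobs (tabulate (λ i → tabulate (delays i))))) ys₀) xs₀
      ≡⟨ cong (λ zs → concatMap (λ x → concatMap (λ y → concatMap (entry x y) zs) ys₀) xs₀) (enumerate-tabulate 0 (λ i → tabulate (delays i))) ⟩
    concatMap (λ x → concatMap (λ y → concatMap (entry x y) zs₀) ys₀) xs₀
      ≡⟨ cong (concatMap (λ x → concatMap (λ y → concatMap (entry x y) zs₀) ys₀)) (map-tabulate id (λ i → toℕ i , p-s i)) ⟨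
    concatMap (λ x → concatMap (λ y → concatMap (entry x y) zs₀) ys₀) (map (λ i → toℕ i , p-s i) (allFin #jobs))
      ≡⟨ concatMap-map _ (λ i → toℕ i , p-s i) (allFin #jobs) ⟩
    concatMap (λ i → concatMap (λ y → concatMap (entry (toℕ i , p-s i) y) zs₀) ys₀) (allFin #jobs)
      ≡⟨ concatMap-singletons _ rec (allFin #jobs) single ⟩
    map rec (allFin #jobs)
      ≡⟨ map-tabulate id rec ⟩
    J ∎
    where
    open ≡-Reasoning
    entry : ℕ × ℕ → ℕ × List ℕ → ℕ × List (List ℕ) → List Rec
    entry x y w = choose (if same (proj₁ x) (proj₁ y) then same (proj₁ x) (proj₁ w) else false)
      (proj₁ x , proj₂ x , proj₂ y , present (enumerate #jobs (proj₂ w)))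
    xs₀ = tabulate (λ i → toℕ i , p-s i)
    ys₀ = tabulate (λ i → toℕ i , cloudTimesOf i)
    zs₀ = tabulate (λ i → toℕ i , tabulate (delays i))
    entry-if : ∀ x y → concatMap (entry x y) zs₀ ≡ (if same (proj₁ x) (proj₁ y) then
      concatMap (λ w → choose (same (proj₁ x) (proj₁ w)) (proj₁ x , proj₂ x , proj₂ y , present (enumerate #jobs (proj₂ w)))) zs₀ else [])
    entry-if x y with same (proj₁ x) (proj₁ y)
    ... | true  = refl
    ... | false = concatMap-[] _ zs₀ (λ _ → refl)
    single : ∀ i → concatMap (λ y → concatMap (entry (toℕ i , p-s i) y) zs₀) ys₀ ≡ rec i ∷ []
    single i = begin
      concatMap (λ y → concatMap (entry (toℕ i , p-s i) y) zs₀) ys₀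
        ≡⟨ concatMap-cong (entry-if (toℕ i , p-s i)) ys₀ ⟩
      concatMap (λ y → if same (toℕ i) (proj₁ y) then
        concatMap (λ w → choose (same (toℕ i) (proj₁ w)) (toℕ i , p-s i , proj₂ y , present (enumerate #jobs (proj₂ w)))) zs₀ else []) ys₀
        ≡⟨ select′ proj₁ (λ y → concatMap (λ w → choose (same (toℕ i) (proj₁ w)) (toℕ i , p-s i , proj₂ y , present (enumerate #jobs (proj₂ w)))) zs₀)
             (λ i → toℕ i , cloudTimesOf i) (λ _ → refl) i ⟩
      concatMap (λ w → choose (same (toℕ i) (proj₁ w)) (toℕ i , p-s i , cloudTimesOf i , present (enumerate #jobs (proj₂ w)))) zs₀
        ≡⟨ select′ proj₁ (λ w → (toℕ i , p-s i , cloudTimesOf i , present (enumerate #jobs (proj₂ w))) ∷ []) (λ i → toℕ i , tabulate (delays i)) (λ _ → refl) i ⟩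
      (toℕ i , p-s i , cloudTimesOf i , present (enumerate #jobs (tabulate (delays i)))) ∷ []
        ≡⟨ cong (λ r → (toℕ i , p-s i , cloudTimesOf i , r) ∷ []) (present-row i) ⟩
      rec i ∷ [] ∎

  recDelay : Job × ℕ → Rec × ℕ
  recDelay (k , d) = rec k , d

  successors≡ : ∀ u → successors J (rec u) ≡ map recDelay (succJobs u)
  successors≡ u = trans (concatMap-map _ numbered (succJobs u))
    (concatMap-singletons _ recDelay (succJobs u)
      λ (k , d) → select′ proj₁ (λ r → (r , d) ∷ []) rec (λ _ → refl) k)

  delayAfter : Job → ℕ
  delayAfter x = match (succJobs x) 0 (λ e _ → proj₂ e)

  delaysTo≡ : ∀ x v → succJobs x ≡ (v , delayAfter x) ∷ [] → delaysTo (rec x) (rec v) ≡ delayAfter x ∷ []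
  delaysTo≡ x v eq rewrite eq | same-refl (toℕ v) = refl

  -- Job, chain node or not, and the two delays of the item.
  Visit : Set
  Visit = Job × Bool × ℕ × ℕ

  itemOf : Visit → Item
  itemOf (j , c , r , q) = item c (rec j) r q

  forked : Job × ℕ → Visit
  forked (x , r) = x , false , r , delayAfter x

  -- The possible traversals of the algorithm, indexed by the last chain node. The lower bounds and
  -- list scheduling are inductions over this type; the extended chain itself matters only for
  -- reaching the sink and for visiting all jobs.
  data Layout : Job → List Visit → Set where
    root  : Layout s ((s , true , 0 , 0) ∷ [])
    link  : ∀ {u A v d} → Layout u A → succJobs u ≡ (v , d) ∷ [] → Layout v ((v , true , d , 0) ∷ A)
    fork  : ∀ {u A v x S} → Layout u A → succJobs u ≡ x ∷ S →
            All (λ y → succJobs (proj₁ y) ≡ (v , delayAfter (proj₁ y)) ∷ []) (x ∷ S) →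
            Layout v ((v , true , 0 , 0) ∷ map forked (x ∷ S) ++ A)

  nextItems-end : ∀ {u} → succJobs u ≡ [] → nextItems J (rec u) ≡ []
  nextItems-end {u} eq rewrite successors≡ u | eq = refl

  nextItems-link : ∀ {u v d} → succJobs u ≡ (v , d) ∷ [] → nextItems J (rec u) ≡ itemOf (v , true , d , 0) ∷ []
  nextItems-link {u} eq rewrite successors≡ u | eq = refl

  nextItems-fork : ∀ {u v x y S} → succJobs u ≡ x ∷ y ∷ S →
                   All (λ y → succJobs (proj₁ y) ≡ (v , delayAfter (proj₁ y)) ∷ []) (x ∷ y ∷ S) →
                   nextItems J (rec u) ≡ itemOf (v , true , 0 , 0) ∷ map itemOf (map forked (x ∷ y ∷ S))
  nextItems-fork {u} {v} {x} {y} {S} eq all = begin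
    nextItems J (rec u)
      ≡⟨ cong branch (trans (successors≡ u) (cong (map recDelay) eq)) ⟩
    match (successors J (rec (proj₁ x))) [] (λ w _ → item true (proj₁ w) 0 0 ∷ parallelItems xs (proj₁ w))
      ≡⟨ cong (λ ws → match ws [] (λ w _ → item true (proj₁ w) 0 0 ∷ parallelItems xs (proj₁ w)))
           (trans (successors≡ (proj₁ x)) (cong (map recDelay) (All.head all))) ⟩
    item true (rec v) 0 0 ∷ parallelItems xs (rec v)
      ≡⟨ cong (item true (rec v) 0 0 ∷_) (items all) ⟩
    itemOf (v , true , 0 , 0) ∷ map itemOf (map forked (x ∷ y ∷ S)) ∎
    where
    open ≡-Reasoning
    xs = map recDelay (x ∷ y ∷ S)
    branch : List (Rec × ℕ) → List Item
    branch ss = match ss [] λ x xs → match xs (item true (proj₁ x) (proj₂ x) 0 ∷ []) λ _ _ →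
      match (successors J (proj₁ x)) [] λ v _ → item true (proj₁ v) 0 0 ∷ parallelItems ss (proj₁ v)
    items : ∀ {S} → All (λ y → succJobs (proj₁ y) ≡ (v , delayAfter (proj₁ y)) ∷ []) S →
            parallelItems (map recDelay S) (rec v) ≡ map itemOf (map forked S)
    items []                       = refl
    items (_∷_ {x , r} eq all) = cong₂ _++_
      (cong (concatMap (λ q → item false (rec x) r q ∷ [])) (delaysTo≡ x v eq)) (items all)

  next : Job → List Visit → List Item
  next u A = nextItems J (rec u) ++ map itemOf A

  layout-head : ∀ {u A} → Layout u A → ∃[ r ] ∃[ q ] ∃[ A′ ] A ≡ (u , true , r , q) ∷ A′
  layout-head root         = _ , _ , _ , refl
  layout-head (link _ _)   = _ , _ , _ , refl
  layout-head (fork _ _ _) = _ , _ , _ , refl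

  extend≡ : ∀ {u A} → Layout u A → extend J (map itemOf A) ≡ next u A
  extend≡ {u} L with layout-head L
  ... | r , q , A′ , refl = cong (_++ map itemOf ((u , true , r , q) ∷ A′)) (select proj₁ (nextItems J) rec (λ _ → refl) u)

  ∈-succJobs⁺ : ∀ {u k d} → delay u k ≡ just d → (k , d) ∈ succJobs u
  ∈-succJobs⁺ {u} {k} {d} eq = ∈-for⁺ {f = edgesFrom u} (∈-allFin k)
    (subst (λ m → (k , d) ∈ map (k ,_) (toL m)) (sym eq) (here refl))

  ∈-succJobs⁻ : ∀ {u k d} → (k , d) ∈ succJobs u → delay u k ≡ just d
  ∈-succJobs⁻ {u} {k} {d} kd∈ with ∈-for⁻ {f = edgesFrom u} (allFin #jobs) kd∈
  ... | k′ , _ , kd∈′ with delay u k′ in eq | kd∈′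
  ... | just _ | here refl = eq

  edge : ∀ {u k d} → delay u k ≡ just d → Edge u k
  edge eq rewrite eq = just tt

  edge⁻ : ∀ {u k} → Edge u k → ∃[ d ] delay u k ≡ just d
  edge⁻ {u} {k} e with delay u k | e
  ... | just d | _ = d , refl

  succJobs-single : ∀ {u v d} → delay u v ≡ just d → (∀ k → Edge u k → k ≡ v) → succJobs u ≡ (v , d) ∷ []
  succJobs-single {u} {v} {d} eq only = trans (concatMap-tabulate-single (edgesFrom u) id v no-edge) (cong (λ m → map (v ,_) (toL m)) eq)
    where
    no-edge : ∀ j → j ≢ v → edgesFrom u j ≡ []
    no-edge j j≢v with delay u j in eq′
    ... | nothing = refl
    ... | just _  = ⊥-elim (j≢v (only j (edge eq′)))

  unique-succJobs : ∀ u → Unique (map proj₁ (succJobs u))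
  unique-succJobs u = go (allFin⁺ #jobs)
    where
    go : ∀ {ks} → Unique ks → Unique (map proj₁ (concatMap (edgesFrom u) ks))
    go [] = []
    go {k ∷ ks} (k∉ ∷ uq) with delay u k
    ... | nothing = go uq
    ... | just d  = All.tabulate fresh ∷ go uq
      where
      fresh : ∀ {y} → y ∈ map proj₁ (concatMap (edgesFrom u) ks) → k ≢ y
      fresh y∈ with ∈-map⁻ proj₁ y∈
      ... | (y , e) , ye∈ , refl with ∈-for⁻ {f = edgesFrom u} ks ye∈
      ... | k′ , k′∈ , ye∈′ with ∈-map⁻ (k′ ,_) ye∈′
      ... | _ , _ , refl = All.lookup k∉ k′∈

  jobs : List Visit → List Job
  jobs = map proj₁

  jobs-forked : ∀ S A → jobs (map forked S ++ A) ≡ map proj₁ S ++ jobs A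
  jobs-forked []      A = refl
  jobs-forked (x ∷ S) A = cong (proj₁ x ∷_) (jobs-forked S A)

  Before : Job → Job → Set
  Before u j = j ≡ u ⊎ TransClosure Edge j u

  before-step : ∀ {u v j} → Edge u v → Before u j → TransClosure Edge j v
  before-step e (inj₁ refl) = [ e ]
  before-step e (inj₂ path) = path ▻ e

  fresh-successor : ∀ {u v} {js : List Job} → Edge u v → All (Before u) js → All (v ≢_) js
  fresh-successor e = All.map λ { b refl → acyclic _ (before-step e b) }

  succ-edge : ∀ {u y S} → succJobs u ≡ S → y ∈ map proj₁ S → Edge u y
  succ-edge refl y∈ with ∈-map⁻ proj₁ y∈
  ... | _ , yr∈ , refl = edge (∈-succJobs⁻ yr∈)

  Joins : Job → List (Job × ℕ) → Set
  Joins v = All (λ y → succJobs (proj₁ y) ≡ (v , delayAfter (proj₁ y)) ∷ [])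

  join-edge : ∀ {y v S} → Joins v S → y ∈ map proj₁ S → Edge y v
  join-edge all y∈ with ∈-map⁻ proj₁ y∈
  ... | _ , yr∈ , refl = succ-edge (All.lookup all yr∈) (here refl)

  layout-before : ∀ {u A} → Layout u A → All (Before u) (jobs A)
  layout-before root = inj₁ refl ∷ []
  layout-before (link L eq) = inj₁ refl ∷ All.map (λ b → inj₂ (before-step (succ-edge eq (here refl)) b)) (layout-before L)
  layout-before (fork {u} {A} {v} {x} {S} L eq all) = inj₁ refl ∷ subst (All (Before v)) (sym (jobs-forked (x ∷ S) A))
    (All-++⁺ (All.tabulate (λ y∈ → inj₂ [ join-edge all y∈ ]))
             (All.map (λ b → inj₂ (before-step (succ-edge eq (here refl)) b ▻ join-edge all (here refl))) (layout-before L)))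

  -- All visited jobs are `u` or precede it, so visiting one of them again after `u` would close a
  -- cycle.
  layout-unique : ∀ {u A} → Layout u A → Unique (jobs A)
  layout-unique root = [] ∷ []
  layout-unique (link L eq) = fresh-successor (succ-edge eq (here refl)) (layout-before L) ∷ layout-unique L
  layout-unique (fork {u} {A} {v} {x} {S} L eq all) = subst (λ js → Unique (v ∷ js)) (sym (jobs-forked (x ∷ S) A))
    (All-++⁺ (All.tabulate (λ { y∈ refl → acyclic v [ join-edge all y∈ ] }))
             (fresh-successor (join-edge all (here refl))
               (All.map (λ b → inj₂ (before-step (succ-edge eq (here refl)) b)) (layout-before L)))
     ∷ ++⁺ (subst (λ ys → Unique (map proj₁ ys)) eq (unique-succJobs u)) (layout-unique L)
         λ (y∈S , y∈A) → All.lookup (fresh-successor (succ-edge eq y∈S) (layout-before L)) y∈A refl)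

  layout-length : ∀ {u A} → Layout u A → length A ≤ #jobs
  layout-length {A = A} L = subst (_≤ #jobs) (length-map proj₁ A) (Unique⇒length≤ (layout-unique L))

  Progress : Job → List Visit → Set
  Progress u A = ∃[ v ] ∃[ A′ ] Layout v A′ × next u A ≡ map itemOf A′ × length A < length A′

  progress-link : ∀ {u A v d} → Layout u A → succJobs u ≡ (v , d) ∷ [] → Progress u A
  progress-link {A = A} L eq = _ , _ , link L eq , cong (_++ map itemOf A) (nextItems-link eq) , ≤-refl

  progress-fork : ∀ {u A v x S} → Layout u A → succJobs u ≡ x ∷ S → Joins v (x ∷ S) → Progress u A
  progress-fork {S = []} L eq all = progress-link L eq
  progress-fork {A = A} {v} {x} {y ∷ S} L eq all = _ , _ , fork L eq all ,
    trans (cong (_++ map itemOf A) (nextItems-fork eq all)) (cong (itemOf (v , true , 0 , 0) ∷_) (sym (map-++ itemOf (map forked (x ∷ y ∷ S)) A))) ,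
    s≤s (≤-trans (m≤n+m (length A) (length (map forked (x ∷ y ∷ S)))) (≤-reflexive (sym (length-++ (map forked (x ∷ y ∷ S))))))

  progress-branch : ∀ {u A v x} → Layout u A → ∀ S → succJobs u ≡ S → x ∈ S → Joins v S → Progress u A
  progress-branch L []      eq () all
  progress-branch L (x ∷ S) eq _  all = progress-fork L eq all

  -- Each round before the sink lengthens the layout. A layout visits distinct jobs, so it cannot
  -- have more than `#jobs` entries, and the sink is reached within as many rounds as there are
  -- records.
  allItems≡ : (∀ {u A} → Layout u A → u ≢ t → Progress u A) →
              ∃[ A ] Layout t A × allItems J (toℕ s) ≡ map itemOf A
  allItems≡ advances = finish (walk J)
    where
    first-item : concatMap (λ r → choose (same (proj₁ r) (toℕ s)) (item true r 0 0)) J ≡ item true (rec s) 0 0 ∷ []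
    first-item = select proj₁ (λ r → item true r 0 0 ∷ []) rec (λ _ → refl) s

    Walk : List Rec → Set
    Walk js = ∃[ u ] ∃[ A ] Layout u A × foldr (λ _ → extend J) (item true (rec s) 0 0 ∷ []) js ≡ map itemOf A
                × (u ≡ t ⊎ length js < length A)

    walk : ∀ js → Walk js
    walk [] = s , _ , root , refl , inj₂ (s≤s z≤n)
    walk (j ∷ js) with walk js
    ... | u , A , L , eq , more with u Fin.≟ t
    ...   | yes refl = t , A , L , trans (cong (extend J) eq) (trans (extend≡ L)
              (cong (_++ map itemOf A) (nextItems-end no-successors))) , inj₁ refl
      where
      no-successors : succJobs t ≡ []
      no-successors with succJobs t in eq′
      ... | []    = refl
      ... | _ ∷ _ = ⊥-elim (Equivalence.from (sink t) refl _ (succ-edge eq′ (here refl)))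
    ...   | no u≢t with advances L u≢t | more
    ...     | _ | inj₁ u≡t = ⊥-elim (u≢t u≡t)
    ...     | v , A′ , L′ , eq′ , longer | inj₂ lt =
      v , A′ , L′ , trans (cong (extend J) eq) (trans (extend≡ L) eq′) , inj₂ (≤-<-trans lt longer)

    finish : Walk J → ∃[ A ] Layout t A × allItems J (toℕ s) ≡ map itemOf A
    finish (u , A , L , eq , inj₁ refl) = A , L , trans (cong (λ is → foldr (λ _ → extend J) is J) first-item) eq
    finish (u , A , L , eq , inj₂ lt) = ⊥-elim (<⇒≱ lt (≤-trans (layout-length L) (≤-reflexive (sym (length-tabulate rec)))))

module Chain (I : Instance) (ext : IsExtendedChain I) where
  open Instance I
  open IsExtendedChain ext
  open Items I
  open Inverse label using (to; from; strictlyInverseˡ)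

  last-or-inner : ∀ {m} (k : Fin (suc m)) → k ≡ fromℕ m ⊎ (∃[ j ] k ≡ inject₁ j)
  last-or-inner {zero}  zero    = inj₁ refl
  last-or-inner {suc m} zero    = inj₂ (zero , refl)
  last-or-inner {suc m} (suc k) with last-or-inner k
  ... | inj₁ refl       = inj₁ refl
  ... | inj₂ (j , refl) = inj₂ (suc j , refl)

  -- Since `inject₁ j` is not a constructor form, the source of the edge is a variable with an
  -- equation, which keeps the pattern match possible.
  after-chain : ∀ {a w j} → _⇝_ width a w → a ≡ chain (inject₁ j) →
                (w ≡ chain (suc j) × width j ≡ 0) ⊎ (∃[ x ] w ≡ parallel j x)
  after-chain (kept j eq) p with Fin.inject₁-injective (chain-injective p)
    where
    chain-injective : ∀ {k l} → chain {width = width} k ≡ chain l → k ≡ l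
    chain-injective refl = refl
  ... | refl = inj₁ (refl , eq)
  after-chain (fork j x) p with Fin.inject₁-injective (chain-injective p)
    where
    chain-injective : ∀ {k l} → chain {width = width} k ≡ chain l → k ≡ l
    chain-injective refl = refl
  ... | refl = inj₂ (x , refl)
  after-chain (join j x) ()

  after-parallel : ∀ {w j x} → _⇝_ width (parallel j x) w → w ≡ chain (suc j)
  after-parallel (join j x) = refl

  into-edge : ∀ {v w} → _⇝_ width v w → Edge (to v) (to w)
  into-edge = Equivalence.to (edges _ _)

  out-of-edge : ∀ {v k} → Edge (to v) k → _⇝_ width v (from k)
  out-of-edge {v} {k} e = Equivalence.from (edges v (from k)) (subst (Edge (to v)) (sym (strictlyInverseˡ k)) e)

  from-≡ : ∀ {k w} → from k ≡ w → k ≡ to w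
  from-≡ {k} eq = trans (sym (strictlyInverseˡ k)) (cong to eq)

  single-successor : ∀ {v w} → _⇝_ width v w → (∀ {x} → _⇝_ width v x → x ≡ w) →
                     succJobs (to v) ≡ (to w , delayAfter (to v)) ∷ []
  single-successor {v} {w} e only with edge⁻ (into-edge e)
  ... | d , eq = trans single (cong (λ q → (to w , q) ∷ []) (sym (cong (λ l → match l 0 (λ e _ → proj₂ e)) single)))
    where
    single : succJobs (to v) ≡ (to w , d) ∷ []
    single = succJobs-single eq λ k e′ → from-≡ (only (out-of-edge e′))

  progress : ∀ {u A} → Layout u A → u ≢ t → Progress u A
  progress {u} {A} L u≢t = subst (λ u → Layout u A → u ≢ t → Progress u A) (strictlyInverseˡ u) (go (from u)) L u≢t
    where
    go : ∀ v → Layout (to v) A → to v ≢ t → Progress (to v) A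
    -- Reached when the only job of a parallel subgraph has been visited as a link of the chain.
    go (parallel j x) L _ = progress-link L (single-successor (join j x) after-parallel)
    go (chain k) L u≢t with last-or-inner k
    ... | inj₁ refl = ⊥-elim (u≢t last-t)
    ... | inj₂ (j , refl) with width j in w≡
    ...   | zero = progress-link L (single-successor (kept j w≡) λ e → case after-chain e refl of λ
              { (inj₁ (eq , _)) → eq ; (inj₂ (x , _)) → case subst Fin w≡ x of λ () })
    ...   | suc w = progress-branch L (succJobs (to (chain (inject₁ j)))) refl
      (∈-succJobs⁺ (proj₂ (edge⁻ (into-edge (fork j (subst Fin (sym w≡) zero)))))) (All.tabulate joins)
      where
      joins : ∀ {z} → z ∈ succJobs (to (chain (inject₁ j))) → succJobs (proj₁ z) ≡ (to (chain (suc j)) , delayAfter (proj₁ z)) ∷ []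
      joins {z} z∈ = case after-chain (out-of-edge (succ-edge refl (∈-map⁺ proj₁ z∈))) refl of λ
        { (inj₁ (_ , w≡0)) → case trans (sym w≡) w≡0 of λ ()
        ; (inj₂ (x , eq′)) → subst (λ k → succJobs k ≡ (to (chain (suc j)) , delayAfter k) ∷ []) (sym (from-≡ eq′))
            (single-successor (join j x) after-parallel) }

  layout : ∃[ A ] Layout t A × allItems J (toℕ s) ≡ map itemOf A
  layout = allItems≡ progress

-- Disjoint intervals on one machine

module Packing {A : Set} (len end : A → ℕ) where

  Disjoint : A → A → Set
  Disjoint x y = (end x + len y ≤ end y) ⊎ (end y + len x ≤ end x)

  disjoint-⊆ : ∀ {xs ys} → xs ⊆ ys → AllPairs Disjoint ys → AllPairs Disjoint xs
  disjoint-⊆ []         []       = []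
  disjoint-⊆ (y ∷ʳ p)   (_ ∷ ds) = disjoint-⊆ p ds
  disjoint-⊆ (refl ∷ p) (d ∷ ds) = All-resp-⊆ p d ∷ disjoint-⊆ p ds

  record Split (x : A) (ys : List A) : Set where
    field
      early late : List A
      early⊆     : early ⊆ ys
      late⊆      : late ⊆ ys
      early≤     : All (λ y → end y + len x ≤ end x) early
      late≥      : All (λ y → end x + len y ≤ end y) late
      sums       : sum (map len ys) ≡ sum (map len early) + sum (map len late)
      early-len  : length early ≤ length ys
      late-len   : length late ≤ length ys
  open Split

  split : ∀ {x ys} → All (Disjoint x) ys → Split x ys
  split [] = record { early⊆ = [] ; late⊆ = [] ; early≤ = [] ; late≥ = [] ; sums = refl ; early-len = z≤n ; late-len = z≤n }
  split (_∷_ {y} (inj₁ x≤y) ds) = let r = split ds in record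
    { early⊆ = y ∷ʳ early⊆ r ; late⊆ = refl ∷ late⊆ r ; early≤ = early≤ r ; late≥ = x≤y ∷ late≥ r
    ; sums = trans (cong (len y +_) (sums r)) (lem (len y) (sum (map len (early r))) (sum (map len (late r))))
    ; early-len = m≤n⇒m≤1+n (early-len r) ; late-len = s≤s (late-len r) }
    where
    lem : ∀ a b c → a + (b + c) ≡ b + (a + c)
    lem = solve-∀
  split (_∷_ {y} (inj₂ y≤x) ds) = let r = split ds in record
    { early⊆ = refl ∷ early⊆ r ; late⊆ = y ∷ʳ late⊆ r ; early≤ = y≤x ∷ early≤ r ; late≥ = late≥ r
    ; sums = trans (cong (len y +_) (sums r)) (sym (+-assoc (len y) _ _))
    ; early-len = s≤s (early-len r) ; late-len = m≤n⇒m≤1+n (late-len r) }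

  -- As in quicksort, the first interval splits the others into those that end before it starts and
  -- those that start after it ends. The former are packed between `a` and its start, the latter
  -- between its end and `T`. The recursion is on a bound for the length, as the two parts are not
  -- structurally smaller.
  packing : ∀ a T xs → a ≤ T → AllPairs Disjoint xs → All (λ x → a + len x ≤ end x × end x ≤ T) xs →
            a + sum (map len xs) ≤ T
  packing a T xs = go (length xs) a T xs ≤-refl
    where
    go : ∀ n a T xs → length xs ≤ n → a ≤ T → AllPairs Disjoint xs → All (λ x → a + len x ≤ end x × end x ≤ T) xs →
         a + sum (map len xs) ≤ T
    go n       a T []       _         a≤T _        _               = ≤-trans (≤-reflexive (+-identityʳ a)) a≤T
    go (suc n) a T (x ∷ xs) (s≤s len≤) a≤T (d ∷ ds) ((lo , hi) ∷ bs) = begin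
      a + (len x + sum (map len xs))                              ≡⟨ cong (λ s → a + (len x + s)) (sums r) ⟩
      a + (len x + (sum (map len (early r)) + sum (map len (late r))))
                                                                  ≡⟨ lem a (len x) (sum (map len (early r))) (sum (map len (late r))) ⟩
      (a + sum (map len (early r))) + len x + sum (map len (late r))
        ≤⟨ +-monoˡ-≤ _ (+-monoˡ-≤ (len x) (go n a (end x ∸ len x) (early r) (≤-trans (early-len r) len≤)
             (m+n≤o⇒m≤o∸n a lo) (disjoint-⊆ (early⊆ r) ds)
             (All.zipWith (λ ((l , _) , e) → l , m+n≤o⇒m≤o∸n (end _) e) (All-resp-⊆ (early⊆ r) bs , early≤ r)))) ⟩
      (end x ∸ len x) + len x + sum (map len (late r))            ≡⟨ cong (_+ sum (map len (late r))) (m∸n+n≡m (≤-trans (m≤n+m (len x) a) lo)) ⟩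
      end x + sum (map len (late r))
        ≤⟨ go n (end x) T (late r) (≤-trans (late-len r) len≤) hi (disjoint-⊆ (late⊆ r) ds)
             (All.zipWith (λ ((_ , h) , l) → l , h) (All-resp-⊆ (late⊆ r) bs , late≥ r)) ⟩
      T ∎
      where
      open ≤-Reasoning
      r = split d
      lem : ∀ a l e f → a + (l + (e + f)) ≡ a + e + l + f
      lem = solve-∀

-- Lower bounds on the makespan

module Plans (I : Instance) (χ : Instance.Job I → Bool) where
  open Instance I
  open Items I

  time work : Job → ℕ
  time j = if χ j then sum (cloudTimesOf j) else p-s j
  work j = if χ j then 0 else p-s j

  transfer : Job → Job → ℕ → ℕ
  transfer i j d = if differ (χ i) (χ j) then d else 0

  plan : List Visit → Plan
  plan = map (λ a → itemOf a , χ (proj₁ a))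

  -- Equivalent to Valid if all processing times are finite.
  record Respects (C : Job → ℕ) : Set where
    field
      precedence : ∀ {i j d} → delay i j ≡ just d → C i + transfer i j d + time j ≤ C j
      exclusion  : ∀ {i j} → i ≢ j → χ i ≡ false → χ j ≡ false → C i + time j ≤ C j ⊎ C j + time i ≤ C i

  front-parallel : ∀ j r q σ S b → front (advance (itemOf (j , false , r , q)) σ S) b ≡
                   max (front S b) (detour (itemOf (j , false , r , q)) σ (proj₁ S) b)
  front-parallel j r q σ S true  = refl
  front-parallel j r q σ S false = refl

  no-front : ∀ b → (if b then 0 else 0) ≡ 0
  no-front true  = refl
  no-front false = refl

  serverLoad-plan : ∀ A → serverLoad (unscaled (plan A)) ≡ sum (map work (jobs A))
  serverLoad-plan [] = refl
  serverLoad-plan ((j , true , r , q) ∷ A) = trans (+-comm _ (work j)) (cong (work j +_) (serverLoad-plan A))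
  serverLoad-plan ((j , false , r , q) ∷ A) = trans (+-comm _ (work j)) (cong (work j +_) (serverLoad-plan A))

  join-delay : ∀ {v S y} → Joins v S → y ∈ S → delay (proj₁ y) v ≡ just (delayAfter (proj₁ y))
  join-delay {v} {S} {y} all y∈ = ∈-succJobs⁻ (subst ((v , delayAfter (proj₁ y)) ∈_) (sym (All.lookup all y∈)) (here refl))

  succ-delay : ∀ {u S y} → succJobs u ≡ S → y ∈ S → delay u (proj₁ y) ≡ just (proj₂ y)
  succ-delay refl y∈ = ∈-succJobs⁻ y∈

  module LowerBound {C : Job → ℕ} (R : Respects C) (server-s : χ s ≡ false) where
    open Respects R

    AtChain : Job → State → Set
    AtChain u S = proj₁ S ≡ χ u × (∀ b → front S b ≡ 0) × clock S ≤ C u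

    before-transfer : ∀ {i j d} → delay i j ≡ just d → C i + time j ≤ C j
    before-transfer {i} {j} {d} eq = ≤-trans (+-monoˡ-≤ (time j) (m≤m+n (C i) (transfer i j d))) (precedence eq)

    before-start : ∀ {i j d} → delay i j ≡ just d → C i ≤ C j
    before-start eq = ≤-trans (m≤m+n _ _) (before-transfer eq)

    time-s : time s ≡ 0
    time-s = trans (cong (λ b → if b then sum (cloudTimesOf s) else p-s s) server-s) p-s-s

    -- Each detour is a path from `u` through one parallel job to `v`, and two applications of
    -- `precedence` bound it. Only the front for the side on which the join really runs is
    -- controlled; the other one may be larger.
    parallel-front : ∀ {u v A} S → AtChain u (unscaled (plan A)) → C u + time v ≤ C v →
                     (∀ {y} → y ∈ S → delay u (proj₁ y) ≡ just (proj₂ y)) → Joins v S →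
                     let T = unscaled (plan (map forked S ++ A)) in
                     proj₁ T ≡ χ u × clock T ≤ C u × clock T + front T (χ v) + time v ≤ C v
    parallel-front {v = v} [] (a , f , c) uv _ _ = a , c ,
      ≤-trans (+-monoˡ-≤ (time v) (≤-trans (+-mono-≤ c (≤-reflexive (f (χ v)))) (≤-reflexive (+-identityʳ _)))) uv
    parallel-front {u} {v} {A} ((x , r) ∷ S) at uv outs (j ∷ js) = a , c , (begin
      clock T + front (advance i (χ x) T) (χ v) + time v
        ≡⟨ cong (λ m → clock T + m + time v) (front-parallel x r (delayAfter x) (χ x) T (χ v)) ⟩
      clock T + max (front T (χ v)) (detour i (χ x) (proj₁ T) (χ v)) + time v
        ≤⟨ by-max (max-sel (front T (χ v)) (detour i (χ x) (proj₁ T) (χ v))) ⟩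
      C v ∎)
      where
      open ≤-Reasoning
      T = unscaled (plan (map forked S ++ A))
      i = itemOf (forked (x , r))
      ih = parallel-front {u} {v} {A} S at uv (λ y∈ → outs (there y∈)) js
      a = proj₁ ih
      c = proj₁ (proj₂ ih)
      by-detour : clock T + detour i (χ x) (proj₁ T) (χ v) + time v ≤ C v
      by-detour = begin
        clock T + detour i (χ x) (proj₁ T) (χ v) + time v
          ≡⟨ cong (λ a → clock T + detour i (χ x) a (χ v) + time v) a ⟩
        clock T + (transfer u x r + time x + transfer x v (delayAfter x)) + time v
          ≤⟨ +-monoˡ-≤ (time v) (+-monoˡ-≤ (transfer u x r + time x + transfer x v (delayAfter x)) c) ⟩
        C u + (transfer u x r + time x + transfer x v (delayAfter x)) + time v
          ≡⟨ cong (_+ time v) (lem (C u) (transfer u x r) (time x) (transfer x v (delayAfter x))) ⟩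
        C u + transfer u x r + time x + transfer x v (delayAfter x) + time v
          ≤⟨ +-monoˡ-≤ (time v) (+-monoˡ-≤ (transfer x v (delayAfter x)) (precedence (outs (here refl)))) ⟩
        C x + transfer x v (delayAfter x) + time v
          ≤⟨ precedence (join-delay {S = (x , r) ∷ S} (j ∷ js) (here refl)) ⟩
        C v ∎
        where
        lem : ∀ c r t q → c + (r + t + q) ≡ c + r + t + q
        lem = solve-∀
      by-max : max (front T (χ v)) (detour i (χ x) (proj₁ T) (χ v)) ≡ front T (χ v) ⊎
               max (front T (χ v)) (detour i (χ x) (proj₁ T) (χ v)) ≡ detour i (χ x) (proj₁ T) (χ v) →
               clock T + max (front T (χ v)) (detour i (χ x) (proj₁ T) (χ v)) + time v ≤ C v
      by-max (inj₁ eq) = ≤-trans (≤-reflexive (cong (λ m → clock T + m + time v) eq)) (proj₂ (proj₂ ih))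
      by-max (inj₂ eq) = ≤-trans (≤-reflexive (cong (λ m → clock T + m + time v) eq)) by-detour

    max-0 : ∀ {m} n → m ≡ 0 → max m n ≡ n
    max-0 n refl = refl

    clock≤C : ∀ {u A} → Layout u A → AtChain u (unscaled (plan A))
    clock≤C root = refl , no-front , ≤-trans (≤-reflexive zero-clock) z≤n
      where
      zero-clock : clock (unscaled (plan ((s , true , 0 , 0) ∷ []))) ≡ 0
      zero-clock = cong₂ _+_ (trans (max-0 _ (no-front (χ s))) (no-front (differ false (χ s)))) time-s
    clock≤C (link {u} {A} {v} {d} L eq) with clock≤C L
    ... | a , f , c = refl , no-front , (begin
      clock S + max (front S (χ v)) (if differ (proj₁ S) (χ v) then d else 0) + time v
        ≡⟨ cong (λ m → clock S + m + time v) (max-0 _ (f (χ v))) ⟩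
      clock S + (if differ (proj₁ S) (χ v) then d else 0) + time v
        ≡⟨ cong (λ a → clock S + (if differ a (χ v) then d else 0) + time v) a ⟩
      clock S + transfer u v d + time v
        ≤⟨ +-monoˡ-≤ (time v) (+-monoˡ-≤ (transfer u v d) c) ⟩
      C u + transfer u v d + time v
        ≤⟨ precedence (succ-delay eq (here refl)) ⟩
      C v ∎)
      where
      open ≤-Reasoning
      S = unscaled (plan A)
    clock≤C (fork {u} {A} {v} {x} {xs} L eq all)
      with parallel-front (x ∷ xs) (clock≤C L)
             -- There is no edge from `u` to `v` to rely on; the path through the first parallel job
             -- supplies the bound for the case without detours.
             (≤-trans (+-monoˡ-≤ (time v) (before-start (succ-delay eq (here refl)))) (before-transfer (join-delay all (here refl))))
             (succ-delay eq) all
    ... | a , c , f = refl , no-front , (begin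
      clock S + max (front S (χ v)) (if differ (proj₁ S) (χ v) then 0 else 0) + time v
        ≡⟨ cong (λ n → clock S + max (front S (χ v)) n + time v) (no-front (differ (proj₁ S) (χ v))) ⟩
      clock S + max (front S (χ v)) 0 + time v
        ≤⟨ +-monoˡ-≤ (time v) (+-monoʳ-≤ (clock S) (max-lub ≤-refl z≤n)) ⟩
      clock S + front S (χ v) + time v
        ≤⟨ f ⟩
      C v ∎)
      where
      open ≤-Reasoning
      S = unscaled (plan (map forked (x ∷ xs) ++ A))

    Between : Job → Job → Set
    Between u j = time j ≤ C j × C j ≤ C u

    between-later : ∀ {u v j} → C u ≤ C v → Between u j → Between v j
    between-later le (t , c) = t , ≤-trans c le

    jobs-between : ∀ {u A} → Layout u A → All (Between u) (jobs A)
    jobs-between root = (≤-trans (≤-reflexive time-s) z≤n , ≤-refl) ∷ []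
    jobs-between (link {u} L eq) = (≤-trans (m≤n+m _ (C u)) (before-transfer uv) , ≤-refl) ∷
      All.map (between-later (before-start uv)) (jobs-between L)
      where uv = succ-delay eq (here refl)
    jobs-between (fork {u} {A} {v} {x} {S} L eq all) =
      (≤-trans (m≤n+m _ (C (proj₁ x))) (before-transfer (join-delay all (here refl))) , ≤-refl) ∷
      subst (All (Between v)) (sym (jobs-forked (x ∷ S) A)) (All-++⁺
        (All-map⁺ (All.tabulate λ {y} y∈ → ≤-trans (m≤n+m _ (C u)) (before-transfer (succ-delay eq y∈)) , before-start (join-delay all y∈)))
        (All.map (between-later (≤-trans (before-start (succ-delay eq (here refl))) (before-start (join-delay all (here refl))))) (jobs-between L)))

    -- By `jobs-between` all jobs lie within the interval from 0 to C t, and by `exclusion` those on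
    -- the server are disjoint, so `packing` applies.
    load≤C : ∀ {A} → Layout t A → sum (map work (jobs A)) ≤ C t
    load≤C {A} L = go (jobs A) (layout-unique L) (jobs-between L)
      where
      open Packing time C
      servers : List Job → List Job
      servers []       = []
      servers (j ∷ js) = if χ j then servers js else j ∷ servers js
      servers-all : ∀ {P : Job → Set} {js} → All P js → All (λ j → χ j ≡ false × P j) (servers js)
      servers-all [] = []
      servers-all {js = j ∷ _} (p ∷ ps) with χ j in eq
      ... | true  = servers-all ps
      ... | false = (eq , p) ∷ servers-all ps
      servers-disjoint : ∀ {js} → Unique js → AllPairs Disjoint (servers js)
      servers-disjoint [] = []
      servers-disjoint {j ∷ js} (j∉ ∷ uq) with χ j in eq
      ... | true  = servers-disjoint uq
      ... | false = All.map (λ (eq′ , j≢k) → exclusion j≢k eq eq′) (servers-all j∉) ∷ servers-disjoint uq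
      sum-servers : ∀ js → sum (map work js) ≡ sum (map time (servers js))
      sum-servers [] = refl
      sum-servers (j ∷ js) with χ j in eq
      ... | true  = sum-servers js
      ... | false rewrite eq = cong (p-s j +_) (sum-servers js)
      go : ∀ js → Unique js → All (Between t) js → sum (map work js) ≤ C t
      go js uq bs = ≤-trans (≤-reflexive (sum-servers js))
        (packing 0 (C t) (servers js) z≤n (servers-disjoint uq) (All.map proj₂ (servers-all bs)))

    value≤ : ∀ {A} → Layout t A → value (unscaled (plan A)) ≤ 2 * C t
    value≤ {A} L = +-mono-≤ (proj₂ (proj₂ (clock≤C L)))
      (≤-trans (≤-trans (≤-reflexive (serverLoad-plan A)) (load≤C L)) (≤-reflexive (sym (+-identityʳ (C t)))))

-- List scheduling

select-unique : ∀ {A B : Set} (key : A → ℕ) (g : A → B) xs → Unique (map key xs) → ∀ {x} → x ∈ xs →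
                concatMap (λ y → choose (same (key y) (key x)) (g y)) xs ≡ g x ∷ []
select-unique key g (y ∷ xs) (y∉ ∷ uq) (here refl) =
  cong₂ _++_ (cong (λ b → choose b (g y)) (same-refl (key y))) (none xs y∉)
  where
  none : ∀ zs → All (key y ≢_) (map key zs) → concatMap (λ z → choose (same (key z) (key y)) (g z)) zs ≡ []
  none []       []         = refl
  none (z ∷ zs) (z≢ ∷ zs≢) = cong₂ _++_ (cong (λ b → choose b (g z)) (≢⇒same (z≢ ∘ sym))) (none zs zs≢)
select-unique key g (y ∷ xs) (y∉ ∷ uq) (there x∈) =
  cong₂ _++_ (cong (λ b → choose b (g y)) (≢⇒same (All.lookup y∉ (∈-map⁺ key x∈)))) (select-unique key g xs uq x∈)

unique-key : ∀ {A : Set} (key : A → ℕ) {xs x y} → Unique (map key xs) → x ∈ xs → y ∈ xs → key x ≡ key y → x ≡ y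
unique-key key uq         (here refl) (here refl) eq = refl
unique-key key (x∉ ∷ uq)  (here refl) (there y∈)  eq = ⊥-elim (All.lookup x∉ (∈-map⁺ key y∈) eq)
unique-key key (y∉ ∷ uq)  (there x∈)  (here refl) eq = ⊥-elim (All.lookup y∉ (∈-map⁺ key x∈) (sym eq))
unique-key key (_ ∷ uq)   (there x∈)  (there y∈)  eq = unique-key key uq x∈ y∈ eq

loadBefore : List Slot → ℕ → ℕ
loadBefore ss κ = sum (concatMap (λ e → choose (rank e ≤ᵇ κ) (slotLoad e)) ss)

loadUpTo : Slot → ℕ → ℕ
loadUpTo e κ = if rank e ≤ᵇ κ then slotLoad e else 0

loadBefore-∷ : ∀ e ss κ → loadBefore (e ∷ ss) κ ≡ loadUpTo e κ + loadBefore ss κ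
loadBefore-∷ e ss κ with rank e ≤ᵇ κ
... | true  = refl
... | false = refl

loadUpTo≤ : ∀ e κ → loadUpTo e κ ≤ slotLoad e
loadUpTo≤ e κ with rank e ≤ᵇ κ
... | true  = ≤-refl
... | false = z≤n

loadUpTo-mono : ∀ e {κ κ′} → κ ≤ κ′ → loadUpTo e κ ≤ loadUpTo e κ′
loadUpTo-mono e {κ} {κ′} le with rank e ≤ᵇ κ in eq
... | false = z≤n
... | true  = ≤-reflexive (cong (λ b → if b then slotLoad e else 0) (sym (≤⇒≤ᵇ≡true {rank e} {κ′} (≤-trans (≤ᵇ≡true⇒≤ {rank e} {κ} eq) le))))

loadBefore-mono : ∀ ss {κ κ′} → κ ≤ κ′ → loadBefore ss κ ≤ loadBefore ss κ′
loadBefore-mono []       le = z≤n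
loadBefore-mono (e ∷ ss) {κ} {κ′} le = ≤-trans (≤-reflexive (loadBefore-∷ e ss κ))
  (≤-trans (+-mono-≤ (loadUpTo-mono e le) (loadBefore-mono ss le)) (≤-reflexive (sym (loadBefore-∷ e ss κ′))))

loadBefore-total : ∀ ss κ → loadBefore ss κ ≤ sum (map slotLoad ss)
loadBefore-total []       κ = z≤n
loadBefore-total (e ∷ ss) κ = ≤-trans (≤-reflexive (loadBefore-∷ e ss κ)) (+-mono-≤ (loadUpTo≤ e κ) (loadBefore-total ss κ))

-- The slot `e` is counted on the right by its own rank, but not on the left, where the threshold is
-- smaller.
loadBefore-step : ∀ ss {e κ} → e ∈ ss → κ < rank e → loadBefore ss κ + slotLoad e ≤ loadBefore ss (rank e)
loadBefore-step (e ∷ ss) {κ = κ} (here refl) lt = begin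
  loadBefore (e ∷ ss) κ + slotLoad e                ≡⟨ cong (_+ slotLoad e) (loadBefore-∷ e ss κ) ⟩
  loadUpTo e κ + loadBefore ss κ + slotLoad e       ≡⟨ cong (λ b → (if b then slotLoad e else 0) + loadBefore ss κ + slotLoad e) (<⇒≰ᵇ lt) ⟩
  loadBefore ss κ + slotLoad e                      ≤⟨ +-monoˡ-≤ (slotLoad e) (loadBefore-mono ss (<⇒≤ lt)) ⟩
  loadBefore ss (rank e) + slotLoad e               ≡⟨ +-comm _ (slotLoad e) ⟩
  slotLoad e + loadBefore ss (rank e)               ≡⟨ cong (λ b → (if b then slotLoad e else 0) + loadBefore ss (rank e)) (≤⇒≤ᵇ≡true (≤-refl {rank e})) ⟨
  loadUpTo e (rank e) + loadBefore ss (rank e)      ≡⟨ loadBefore-∷ e ss (rank e) ⟨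
  loadBefore (e ∷ ss) (rank e)                      ∎
  where open ≤-Reasoning
loadBefore-step (f ∷ ss) {e} {κ} (there e∈) lt = begin
  loadBefore (f ∷ ss) κ + slotLoad e                ≡⟨ cong (_+ slotLoad e) (loadBefore-∷ f ss κ) ⟩
  loadUpTo f κ + loadBefore ss κ + slotLoad e       ≡⟨ +-assoc (loadUpTo f κ) _ _ ⟩
  loadUpTo f κ + (loadBefore ss κ + slotLoad e)     ≤⟨ +-mono-≤ (loadUpTo-mono f (<⇒≤ lt)) (loadBefore-step ss e∈ lt) ⟩
  loadUpTo f (rank e) + loadBefore ss (rank e)      ≡⟨ loadBefore-∷ f ss (rank e) ⟨
  loadBefore (f ∷ ss) (rank e)                      ∎
  where open ≤-Reasoning

-- As positions stay below `M`, ranks order the pairs of start and position lexicographically.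
rank-order : ∀ {M ℓ ℓ′ p p′} → p′ < M → ℓ * M + p ≤ ℓ′ * M + p′ → ℓ ≤ ℓ′
rank-order {M} {ℓ} {ℓ′} {p} {p′} p′< le = ≮⇒≥ λ ℓ′<ℓ → <⇒≱ (begin-strict
  ℓ′ * M + p′     <⟨ +-monoʳ-< (ℓ′ * M) p′< ⟩
  ℓ′ * M + M      ≡⟨ +-comm (ℓ′ * M) M ⟩
  suc ℓ′ * M      ≤⟨ *-monoˡ-≤ M ℓ′<ℓ ⟩
  ℓ * M           ≤⟨ m≤m+n _ p ⟩
  ℓ * M + p       ∎) le
  where open ≤-Reasoning

module Timeline (I : Instance) (χ : Instance.Job I → Bool) (M : ℕ) where
  open Instance I
  open Items I
  open Plans I χ

  cloudWork : Job → ℕ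
  cloudWork j = if χ j then time j else 0

  cloud+work : ∀ j → cloudWork j + work j ≡ time j
  cloud+work j with χ j
  ... | true  = +-identityʳ _
  ... | false = refl

  slots : List Visit → List Slot
  slots B = timeline M (plan B)

  slot : Job → ℕ → ℕ → Slot
  slot j ℓ p = toℕ j , χ j , work j , cloudWork j , ℓ , ℓ * M + p

  At : List Visit → Job → ℕ → ℕ → Set
  At B j ℓ p = slot j ℓ p ∈ slots B

  length-slots : ∀ B → length (slots B) ≡ length B
  length-slots B = trans (length-timeline M (plan B)) (length-map _ B)

  jobs-slots : ∀ B → map proj₁ (slots B) ≡ map toℕ (jobs B)
  jobs-slots []      = refl
  jobs-slots (x ∷ B) = cong (toℕ (proj₁ x) ∷_) (jobs-slots B)

  at-head : ∀ x B → At (x ∷ B) (proj₁ x) (begins (itemOf x) (χ (proj₁ x)) (unscaled (plan B))) (length B)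
  at-head x B = here (cong (λ n → toℕ j , χ j , work j , cloudWork j , ℓ , ℓ * M + n) (sym (length-slots B)))
    where
    j = proj₁ x
    ℓ = begins (itemOf x) (χ j) (unscaled (plan B))

  at-exists : ∀ {B j} → j ∈ jobs B → ∃[ ℓ ] ∃[ p ] At B j ℓ p × p < length B
  at-exists {x ∷ B} (here refl) = _ , _ , at-head x B , ≤-refl
  at-exists {x ∷ B} (there j∈)  = let ℓ , p , at , lt = at-exists j∈ in ℓ , p , there at , m≤n⇒m≤1+n lt

  at-inv : ∀ {x B j ℓ p} → At (x ∷ B) j ℓ p → (j ≡ proj₁ x × p ≡ length B) ⊎ At B j ℓ p
  at-inv (there at) = inj₂ at
  at-inv {x} {B} {j} {ℓ} {p} (here eq) = inj₁ (Fin.toℕ-injective (cong proj₁ eq) ,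
    trans (+-cancelˡ-≡ (ℓ * M) p (length (slots B)) (trans (cong rank eq) (cong (λ k → k * M + length (slots B)) (sym ℓ≡)))) (length-slots B))
    where
    ℓ≡ : ℓ ≡ begins (itemOf x) (χ (proj₁ x)) (unscaled (plan B))
    ℓ≡ = cong (λ e → proj₁ (proj₂ (proj₂ (proj₂ (proj₂ e))))) eq

  at-bounded : ∀ {B j ℓ p} → At B j ℓ p → p < length B
  at-bounded {x ∷ B} {j} {ℓ} at with at-inv {x} {B} {j} {ℓ} at
  ... | inj₁ (_ , refl) = ≤-refl
  ... | inj₂ at′        = m≤n⇒m≤1+n (at-bounded {B} {j} {ℓ} at′)

  at-position : ∀ {B i j ℓ ℓ′ p} → At B i ℓ p → At B j ℓ′ p → i ≡ j
  at-position {x ∷ B} {i} {j} {ℓ} {ℓ′} ati atj with at-inv {x} {B} {i} {ℓ} ati | at-inv {x} {B} {j} {ℓ′} atj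
  ... | inj₁ (refl , _)    | inj₁ (refl , _)    = refl
  ... | inj₁ (_ , refl)    | inj₂ atj′          = ⊥-elim (<-irrefl refl (at-bounded {B} {j} {ℓ′} atj′))
  ... | inj₂ ati′          | inj₁ (_ , refl)    = ⊥-elim (<-irrefl refl (at-bounded {B} {i} {ℓ} ati′))
  ... | inj₂ ati′          | inj₂ atj′          = at-position {B} {i} {j} {ℓ} {ℓ′} ati′ atj′

  at-++ : ∀ S {A j ℓ p} → At A j ℓ p → At (map forked S ++ A) j ℓ p
  at-++ []      at = at
  at-++ (x ∷ S) {A} {j} {ℓ} at = there (at-++ S {A} {j} {ℓ} at)

  Current : Job → List Visit → Set
  Current u A = let T = unscaled (plan A) in
    proj₁ T ≡ χ u × (∀ b → front T b ≡ 0) × (∃[ ℓ ] ∃[ p ] At A u ℓ p × ℓ + time u ≡ clock T)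

  current : ∀ {u A} → Layout u A → Current u A
  current {u} L with layout-head L
  ... | r , q , A′ , refl = refl , no-front , _ , _ , at-head (u , true , r , q) A′ , refl

  -- `after` places the job behind `u` for ties in the start time. `reached` is stated for both
  -- sides because the side of the join is not yet fixed at this point of the layout.
  record ForkSlot (A : List Visit) (u : Job) (S : List (Job × ℕ)) (y : Job × ℕ) : Set where
    constructor between
    field
      {position} : ℕ
      at         : At (map forked S ++ A) (proj₁ y) (clock (unscaled (plan A)) + transfer u (proj₁ y) (proj₂ y)) position
      after      : length A ≤ position
      reached    : ∀ b → transfer u (proj₁ y) (proj₂ y) + time (proj₁ y) + (if differ (χ (proj₁ y)) b then delayAfter (proj₁ y) else 0)
                         ≤ front (unscaled (plan (map forked S ++ A))) b

  fork-state : ∀ A S → let T = unscaled (plan (map forked S ++ A)) ; T₀ = unscaled (plan A) in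
               proj₁ T ≡ proj₁ T₀ × clock T ≡ clock T₀
  fork-state A []      = refl , refl
  fork-state A (x ∷ S) = fork-state A S

  fork-between : ∀ {u} A S → proj₁ (unscaled (plan A)) ≡ χ u → ∀ {y} → y ∈ S → ForkSlot A u S y
  fork-between {u} A (x@(j , r) ∷ S) side (here refl) = between
    (subst (λ ℓ → At (map forked (x ∷ S) ++ A) j ℓ (length (map forked S ++ A))) start≡ (at-head (forked x) (map forked S ++ A)))
    (≤-trans (m≤n+m (length A) (length (map forked S))) (≤-reflexive (sym (length-++ (map forked S)))))
    λ b → ≤-trans (≤-reflexive (cong (λ a → (if differ a (χ j) then r else 0) + time j + (if differ (χ j) b then delayAfter j else 0)) (sym side′)))
            (≤-trans (n≤max (front T b) (detour (itemOf (forked x)) (χ j) (proj₁ T) b))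
              (≤-reflexive (sym (front-parallel j r (delayAfter j) (χ j) T b))))
    where
    T = unscaled (plan (map forked S ++ A))
    side′ : proj₁ T ≡ χ u
    side′ = trans (proj₁ (fork-state A S)) side
    start≡ : clock T + (if differ (proj₁ T) (χ j) then r else 0) ≡ clock (unscaled (plan A)) + transfer u j r
    start≡ = cong₂ (λ D a → D + (if differ a (χ j) then r else 0)) (proj₂ (fork-state A S)) side′
  fork-between {u} A (x@(j , r) ∷ S) side (there y∈) with fork-between {u} A S side y∈
  ... | between at after reached = between (there at) after
    λ b → ≤-trans (reached b) (≤-trans (m≤max _ _) (≤-reflexive (sym (front-parallel j r (delayAfter j) (χ j) (unscaled (plan (map forked S ++ A))) b))))

  -- `earlier` is there for ties: if durations and delays are 0, both ends of an edge may start at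
  -- the same time, and the rank must still increase strictly along the edge.
  record Scheduled (A : List Visit) (i j : Job) (d : ℕ) : Set where
    constructor scheduled
    field
      {ℓᵢ pᵢ ℓⱼ pⱼ} : ℕ
      atᵢ    : At A i ℓᵢ pᵢ
      atⱼ    : At A j ℓⱼ pⱼ
      ready  : ℓᵢ + time i + transfer i j d ≤ ℓⱼ
      earlier : pᵢ < pⱼ

  succ-unique : ∀ {u S j d} → succJobs u ≡ S → delay u j ≡ just d → (j , d) ∈ S
  succ-unique refl eq = ∈-succJobs⁺ eq

  -- The last chain node is excluded because its successors are not part of the layout yet. In the
  -- final layout this is the sink, which has none.
  schedule-edge : ∀ {u A i j d} → Layout u A → i ∈ jobs A → i ≢ u → delay i j ≡ just d → Scheduled A i j d
  schedule-edge root (here refl) i≢u _ = ⊥-elim (i≢u refl)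
  schedule-edge (link L eq) (here refl) i≢v _ = ⊥-elim (i≢v refl)
  schedule-edge {i = i} {j} {d} (link {u} {A} {v} L eq) (there i∈) i≢v e with i Fin.≟ u
  ... | no i≢u with schedule-edge L i∈ i≢u e
  ...   | scheduled ati atj r lt = scheduled (there ati) (there atj) r lt
  schedule-edge {i = i} {j} {d} (link {u} {A} {v} L eq) (there i∈) i≢v e | yes refl with succ-unique eq e
  ...   | here refl with current L
  ...     | side , _ , ℓ , p , at , ℓ≡ = scheduled (there at) (at-head (v , true , d , 0) A)
    (+-mono-≤ (≤-reflexive ℓ≡) (≤-trans (≤-reflexive (cong (λ a → if differ a (χ v) then d else 0) (sym side))) (n≤max (front (unscaled (plan A)) (χ v)) _)))
    (at-bounded {A} {u} {ℓ} at)
  schedule-edge (fork L eq all) (here refl) i≢v _ = ⊥-elim (i≢v refl)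
  schedule-edge {i = i} {j} {d} (fork {u} {A} {v} {x} {S} L eq all) (there i∈) i≢v e
    with ∈-++⁻ (map proj₁ (x ∷ S)) (subst (i ∈_) (jobs-forked (x ∷ S) A) i∈)
  ... | inj₁ i∈S with ∈-map⁻ proj₁ i∈S
  ...   | y , y∈ , refl with fork-between {u} A (x ∷ S) (proj₁ (current L)) y∈ | succ-unique (All.lookup all y∈) e
  ...     | between {p} at after reached | here refl = scheduled (there at) (at-head (v , true , 0 , 0) B)
    (begin
      clock (unscaled (plan A)) + transfer u i (proj₂ y) + time i + transfer i v d
        ≡⟨ lem (clock (unscaled (plan A))) (transfer u i (proj₂ y)) (time i) (transfer i v d) ⟩
      clock (unscaled (plan A)) + (transfer u i (proj₂ y) + time i + transfer i v d)
        ≤⟨ +-mono-≤ (≤-reflexive (sym (proj₂ (fork-state A (x ∷ S))))) (≤-trans (reached (χ v)) (m≤max _ _)) ⟩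
      clock (unscaled (plan B)) + max (front (unscaled (plan B)) (χ v)) (if differ (proj₁ (unscaled (plan B))) (χ v) then 0 else 0) ∎)
    (at-bounded {B} {i} {clock (unscaled (plan A)) + transfer u i (proj₂ y)} at)
    where
    open ≤-Reasoning
    B = map forked (x ∷ S) ++ A
    lem : ∀ c r t q → c + r + t + q ≡ c + (r + t + q)
    lem = solve-∀
  schedule-edge {i = i} {j} {d} (fork {u} {A} {v} {x} {S} L eq all) (there i∈) i≢v e | inj₂ i∈A with i Fin.≟ u
  ... | no i≢u with schedule-edge L i∈A i≢u e
  ...   | scheduled ati atj r lt = scheduled (there (at-++ (x ∷ S) ati)) (there (at-++ (x ∷ S) atj)) r lt
  schedule-edge {i = i} {j} {d} (fork {u} {A} {v} {x} {S} L eq all) (there i∈) i≢v e | inj₂ i∈A | yes refl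
    with current L | fork-between {u} A (x ∷ S) (proj₁ (current L)) (succ-unique eq e)
  ... | _ , _ , ℓ , p , at , ℓ≡ | between at′ after _ = scheduled (there (at-++ (x ∷ S) at)) (there at′)
    (≤-reflexive (cong (_+ transfer u j d) ℓ≡)) (<-≤-trans (at-bounded {A} {u} {ℓ} at) after)

  at-job : ∀ {A j ℓ p} → At A j ℓ p → j ∈ jobs A
  at-job {x ∷ A} {j} {ℓ} at with at-inv {x} {A} {j} {ℓ} at
  ... | inj₁ (refl , _) = here refl
  ... | inj₂ at′        = there (at-job {A} {j} {ℓ} at′)

module Construct (I : Instance) (χ : Instance.Job I → Bool) {A : List (Items.Visit I)} (L : Items.Layout I (Instance.t I) A)
                 (complete : ∀ j → j ∈ Items.jobs I A) where
  open Instance I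
  open Items I
  open Plans I χ

  M : ℕ
  M = suc (length (plan A))

  open Timeline I χ M

  ss : List Slot
  ss = slots A

  unique-slots : Unique (map proj₁ ss)
  unique-slots = subst Unique (sym (jobs-slots A)) (Unique-map⁺ Fin.toℕ-injective (layout-unique L))

  startOf position : Job → ℕ
  startOf j   = proj₁ (at-exists (complete j))
  position j = proj₁ (proj₂ (at-exists (complete j)))

  slotOf : Job → Slot
  slotOf j = slot j (startOf j) (position j)

  slotOf∈ : ∀ j → slotOf j ∈ ss
  slotOf∈ j = proj₁ (proj₂ (proj₂ (at-exists (complete j))))

  position< : ∀ j → position j < M
  position< j = m≤n⇒m≤1+n (≤-trans (proj₂ (proj₂ (proj₂ (at-exists (complete j))))) (≤-reflexive (sym (length-map _ A))))

  C : Job → ℕ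
  C j = completion ss (slotOf j)

  at-slotOf : ∀ {j ℓ p} → At A j ℓ p → slot j ℓ p ≡ slotOf j
  at-slotOf {j} at = unique-key proj₁ unique-slots at (slotOf∈ j) refl

  at-start : ∀ {j ℓ p} → At A j ℓ p → ℓ ≡ startOf j × p ≡ position j
  at-start {j} {ℓ} {p} at = ℓ≡ , +-cancelˡ-≡ (ℓ * M) p (position j)
    (trans (cong rank (at-slotOf {j} {ℓ} {p} at)) (cong (λ k → k * M + position j) (sym ℓ≡)))
    where
    ℓ≡ : ℓ ≡ startOf j
    ℓ≡ = cong (λ e → proj₁ (proj₂ (proj₂ (proj₂ (proj₂ e))))) (at-slotOf {j} {ℓ} {p} at)

  κ : Job → ℕ
  κ j = rank (slotOf j)

  -- Only the cloud time of `i` has to fit before the start of `j`: server time of `i` is contained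
  -- in the load counted for `j`. From rank `κ i` to `κ j` this load grows by at least `work j`,
  -- which with `cloudWork j` makes up `time j`. With `c` a delay this gives precedence, with `c`
  -- zero exclusion on the server.
  follows : ∀ {i j} c → κ i < κ j → startOf i + cloudWork i + c ≤ startOf j → C i + c + time j ≤ C j
  follows {i} {j} c lt le = begin
    startOf i + cloudWork i + loadBefore ss (κ i) + c + time j
      ≡⟨ cong (startOf i + cloudWork i + loadBefore ss (κ i) + c +_) (cloud+work j) ⟨
    startOf i + cloudWork i + loadBefore ss (κ i) + c + (cloudWork j + work j)
      ≡⟨ lem (startOf i + cloudWork i) (loadBefore ss (κ i)) c (cloudWork j) (work j) ⟩
    startOf i + cloudWork i + c + cloudWork j + (loadBefore ss (κ i) + work j)
      ≤⟨ +-mono-≤ (+-monoˡ-≤ (cloudWork j) le) (loadBefore-step ss (slotOf∈ j) lt) ⟩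
    startOf j + cloudWork j + loadBefore ss (κ j) ∎
    where
    open ≤-Reasoning
    lem : ∀ s b c l w → s + b + c + (l + w) ≡ s + c + l + (b + w)
    lem = solve-∀

  respects : Respects C
  respects = record { precedence = prec ; exclusion = excl }
    where
    i≢t : ∀ {i j d} → delay i j ≡ just d → i ≢ t
    i≢t {j = j} e refl = Equivalence.from (sink t) refl j (edge e)

    prec : ∀ {i j d} → delay i j ≡ just d → C i + transfer i j d + time j ≤ C j
    prec {i} {j} {d} e = go (schedule-edge L (complete i) (i≢t e) e)
      where
      go : Scheduled A i j d → C i + transfer i j d + time j ≤ C j
      go (scheduled {ℓᵢ} {pᵢ} {ℓⱼ} {pⱼ} ati atj ready lt) with at-start {i} {ℓᵢ} {pᵢ} ati | at-start {j} {ℓⱼ} {pⱼ} atj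
      ... | refl , refl | refl , refl = follows {i} {j} (transfer i j d)
        (+-mono-≤-< (*-monoˡ-≤ M (≤-trans (≤-trans (m≤m+n _ (time i)) (m≤m+n _ (transfer i j d))) ready)) lt)
        (≤-trans (+-monoˡ-≤ (transfer i j d) (+-monoʳ-≤ (startOf i) (≤-trans (m≤m+n (cloudWork i) (work i)) (≤-reflexive (cloud+work i))))) ready)

    no-cloud : ∀ {i} → χ i ≡ false → cloudWork i ≡ 0
    no-cloud {i} eq = cong (λ b → if b then time i else 0) eq

    one-way : ∀ {i j} → χ i ≡ false → κ i < κ j → C i + time j ≤ C j
    one-way {i} {j} eq lt = ≤-trans (≤-reflexive (cong (_+ time j) (sym (+-identityʳ (C i))))) (follows {i} {j} 0 lt
      (≤-trans (≤-reflexive (trans (+-identityʳ _) (trans (cong (startOf i +_) (no-cloud eq)) (+-identityʳ _))))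
               (rank-order {M} {startOf i} {startOf j} {position i} {position j} (position< j) (<⇒≤ lt))))

    excl : ∀ {i j} → i ≢ j → χ i ≡ false → χ j ≡ false → C i + time j ≤ C j ⊎ C j + time i ≤ C i
    excl {i} {j} i≢j eqi eqj with <-cmp (κ i) (κ j)
    ... | tri< lt _ _ = inj₁ (one-way {i} {j} eqi lt)
    ... | tri> _ _ gt = inj₂ (one-way {j} {i} eqj gt)
    -- Equal ranks decode to equal starts and equal positions, and a position belongs to one job
    -- only.
    ... | tri≈ _ eq _ = ⊥-elim (i≢j (at-position {A} {i} {j} {startOf i} {startOf j} (slotOf∈ i)
                          (subst (At A j (startOf j)) (sym position≡) (slotOf∈ j))))
      where
      start≡ : startOf i ≡ startOf j
      start≡ = ≤-antisym (rank-order {M} {startOf i} {startOf j} {position i} {position j} (position< j) (≤-reflexive eq))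
                         (rank-order {M} {startOf j} {startOf i} {position j} {position i} (position< i) (≤-reflexive (sym eq)))
      position≡ : position i ≡ position j
      position≡ = +-cancelˡ-≡ (startOf i * M) (position i) (position j)
        (trans eq (cong (λ k → k * M + position j) (sym start≡)))

  loads-slots : ∀ B → sum (map slotLoad (slots B)) ≡ sum (map work (jobs B))
  loads-slots []      = refl
  loads-slots (x ∷ B) = cong (work (proj₁ x) +_) (loads-slots B)

  -- The sink ends at its longest-path time plus the load of some of the server jobs; the latter is
  -- at most the total load.
  makespan≤ : C t ≤ value (unscaled (plan A))
  makespan≤ with current L
  ... | _ , _ , ℓ , p , at , ℓ≡ with at-start {t} {ℓ} {p} at
  ... | refl , refl = +-mono-≤
    (≤-trans (+-monoʳ-≤ (startOf t) (≤-trans (m≤m+n (cloudWork t) (work t)) (≤-reflexive (cloud+work t)))) (≤-reflexive ℓ≡))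
    (≤-trans (loadBefore-total ss (κ t)) (≤-reflexive (trans (loads-slots A) (sym (serverLoad-plan A)))))

  output≡ : output J (timeline M (plan A)) ≡ tabulate (λ j → χ j , C j)
  output≡ = begin
    output J ss
      ≡⟨ cong (λ rs → output rs ss) (map-tabulate id rec) ⟨
    output (map rec (allFin #jobs)) ss
      ≡⟨ concatMap-map′ ⟩
    concatMap (λ j → concatMap (λ e → choose (same (proj₁ e) (toℕ j)) (proj₁ (proj₂ e) , completion ss e)) ss) (allFin #jobs)
      ≡⟨ concatMap-singletons _ (λ j → χ j , C j) (allFin #jobs) (λ j → select-unique proj₁ (λ e → proj₁ (proj₂ e) , completion ss e) ss unique-slots (slotOf∈ j)) ⟩
    map (λ j → χ j , C j) (allFin #jobs)
      ≡⟨ map-tabulate id (λ j → χ j , C j) ⟩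
    tabulate (λ j → χ j , C j) ∎
    where
    open ≡-Reasoning
    f : Rec → List (Bool × ℕ)
    f r = concatMap (λ e → choose (same (proj₁ e) (proj₁ r)) (proj₁ (proj₂ e) , completion ss e)) ss
    concatMap-map′ : concatMap f (map rec (allFin #jobs)) ≡ concatMap (λ j → f (rec j)) (allFin #jobs)
    concatMap-map′ = concatMap-map f rec (allFin #jobs)

module Complete (I : Instance) (ext : IsExtendedChain I) {A : List (Items.Visit I)} (L : Items.Layout I (Instance.t I) A) where
  open Instance I
  open IsExtendedChain ext
  open Items I
  open Chain I ext using (into-edge)
  open Inverse label using (to; from; strictlyInverseˡ)

  root∈ : ∀ {u B} → Layout u B → s ∈ jobs B
  root∈ root = here refl
  root∈ (link L eq) = there (root∈ L)
  root∈ (fork {x = x} {S} L eq all) = there (subst (s ∈_) (sym (jobs-forked (x ∷ S) _)) (∈-++⁺ʳ (map proj₁ (x ∷ S)) (root∈ L)))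

  -- An arbitrary assignment of sides: all that is taken from `schedule-edge` is that the head of an
  -- edge occurs in the layout.
  open Timeline I (λ _ → false) 0

  closed : ∀ {i j} → i ∈ jobs A → Edge i j → j ∈ jobs A
  closed {i} {j} i∈ e with edge⁻ e
  ... | d , eq with schedule-edge L i∈ (λ { refl → Equivalence.from (sink t) refl j e }) eq
  ... | scheduled {ℓⱼ = ℓ} _ atj _ _ = at-job {A} {j} {ℓ} atj

  chain∈ : ∀ k → to (chain k) ∈ jobs A
  chain∈ = <-weakInduction (λ k → to (chain k) ∈ jobs A) (subst (_∈ jobs A) (sym first-s) (root∈ L)) next-chain
    where
    next-chain : ∀ j → to (chain (inject₁ j)) ∈ jobs A → to (chain (suc j)) ∈ jobs A
    next-chain j k∈ with width j in w≡
    ... | zero  = closed k∈ (into-edge (kept j w≡))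
    ... | suc w = closed (closed k∈ (into-edge (fork j x))) (into-edge (join j x))
      where x = subst Fin (sym w≡) zero

  node∈ : ∀ v → to v ∈ jobs A
  node∈ (chain k)      = chain∈ k
  node∈ (parallel j x) = closed (chain∈ (inject₁ j)) (into-edge (fork j x))

  complete : ∀ j → j ∈ jobs A
  complete j = subst (_∈ jobs A) (strictlyInverseˡ j) (node∈ (from j))

-- Schedules and assignments of sides

isCloud : Side → Bool
isCloud server = false
isCloud cloud  = true

sideOf : Bool → Side
sideOf false = server
sideOf true  = cloud

isCloud-sideOf : ∀ b → isCloud (sideOf b) ≡ b
isCloud-sideOf true  = refl
isCloud-sideOf false = refl

differ-self : ∀ a → differ a a ≡ false
differ-self true  = refl
differ-self false = refl

differ-≢ : ∀ a b → a ≢ b → differ (isCloud a) (isCloud b) ≡ true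
differ-≢ server server a≢b = ⊥-elim (a≢b refl)
differ-≢ server cloud  a≢b = refl
differ-≢ cloud  server a≢b = refl
differ-≢ cloud  cloud  a≢b = ⊥-elim (a≢b refl)

foldr-finite : ∀ {n} (f : Fin n → ℕ∞) (g : Fin n → ℕ) → (∀ j → f j ≡ just (g j)) →
               Vector.foldr _+∞_ (just 0) f ≡ just (sum (tabulate g))
foldr-finite {zero}  f g h = refl
foldr-finite {suc n} f g h rewrite h zero | foldr-finite (f ∘ suc) (g ∘ suc) (h ∘ suc) = refl

foldr-bounded : ∀ {n} (f : Fin n → ℕ∞) {b} → Vector.foldr _+∞_ (just 0) f ≤⁺ just b → ∀ j → ∃[ m ] f j ≡ just m
foldr-bounded f le = terms f (finite le)
  where
  finite : ∀ {x b} → x ≤⁺ just b → ∃[ m ] x ≡ just m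
  finite ([_] {k} _) = k , refl
  summands : ∀ x y {m} → x +∞ y ≡ just m → (∃[ k ] x ≡ just k) × (∃[ k ] y ≡ just k)
  summands (just x) (just y) eq = (x , refl) , (y , refl)
  terms : ∀ {n} (f : Fin n → ℕ∞) → (∃[ m ] Vector.foldr _+∞_ (just 0) f ≡ just m) → ∀ j → ∃[ m ] f j ≡ just m
  terms f (_ , eq) zero    = proj₁ (summands (f zero) _ eq)
  terms f (_ , eq) (suc j) = terms (f ∘ suc) (proj₂ (summands (f zero) _ eq)) j

module Schedules (I : Instance) where
  open Instance I
  open Items I

  toL-just : ∀ {m k} → m ≡ just k → sum (toL m) ≡ k
  toL-just {k = k} refl = +-identityʳ k

  finite-toL : ∀ {m} → toL m ≢ [] → m ≡ just (sum (toL m))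
  finite-toL {nothing} ne = ⊥-elim (ne refl)
  finite-toL {just k}  ne = cong just (sym (+-identityʳ k))

  module _ (σ : Schedule I) where
    open Schedule σ

    χ : Job → Bool
    χ j = isCloud (side j)

    open Plans I χ

    Finite : Set
    Finite = ∀ j → side j ≡ cloud → p-c j ≡ just (sum (cloudTimesOf j))

    jobCost : Job → ℕ
    jobCost j = if χ j then sum (cloudTimesOf j) else 0

    p-π≡ : Finite → ∀ j → p-π σ j ≡ just (time j)
    p-π≡ fin j with side j in eq
    ... | server = refl
    ... | cloud  = fin j eq

    cloudTime≡ : Finite → ∀ j → cloudTime σ j ≡ just (jobCost j)
    cloudTime≡ fin j with side j in eq
    ... | server = refl
    ... | cloud  = fin j eq

    cost≡ : Finite → cost σ ≡ just (sum (tabulate jobCost))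
    cost≡ fin = foldr-finite (cloudTime σ) jobCost (cloudTime≡ fin)

    -- A single infinite summand would make the whole cost infinite. A budget thus keeps source and
    -- sink on the server and lets natural numbers replace the extended ones.
    cost⇒finite : ∀ {b} → cost σ ≤⁺ just b → Finite
    cost⇒finite le j eq with foldr-bounded (cloudTime σ) le j
    ... | m , fin with side j
    cost⇒finite le j refl | m , fin | cloud = trans fin (cong just (sym (toL-just fin)))

    module _ (fin : Finite) where
      ≤start⇒ : ∀ {m j} → _≤start_ σ m j → m + time j ≤ C j
      ≤start⇒ {m} {j} le = [≤]-injective (subst (λ p → (just m +∞ p) ≤⁺ just (C j)) (p-π≡ fin j) le)

      ⇒≤start : ∀ {m j} → m + time j ≤ C j → _≤start_ σ m j
      ⇒≤start {m} {j} le = subst (λ p → (just m +∞ p) ≤⁺ just (C j)) (sym (p-π≡ fin j)) [ le ]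

      transfer-same : ∀ {i j} d → side i ≡ side j → transfer i j d ≡ 0
      transfer-same {i} {j} d eq = cong (λ b → if b then d else 0) (trans (cong (λ x → differ (isCloud x) (χ j)) eq) (differ-self (χ j)))

      transfer-across : ∀ {i j} d → side i ≢ side j → transfer i j d ≡ d
      transfer-across {i} {j} d ne = cong (λ b → if b then d else 0) (differ-≢ (side i) (side j) ne)

      side≡server : ∀ {j} → χ j ≡ false → side j ≡ server
      side≡server {j} eq with side j
      ... | server = refl

      _≟ₛ_ : (a b : Side) → Dec (a ≡ b)
      server ≟ₛ server = yes refl
      server ≟ₛ cloud  = no λ ()
      cloud  ≟ₛ server = no λ ()
      cloud  ≟ₛ cloud  = yes refl

      valid⇒respects : Valid σ → Respects C
      valid⇒respects v = record
        { precedence = λ {i} {j} {d} e → case side i ≟ₛ side j of λ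
            { (yes eq) → subst (λ x → C i + x + time j ≤ C j) (sym (transfer-same d eq))
                (subst (λ x → x + time j ≤ C j) (sym (+-identityʳ (C i))) (≤start⇒ (Valid.same v i j (edge e) eq)))
            ; (no ne) → subst (λ x → C i + x + time j ≤ C j) (sym (transfer-across d ne)) (≤start⇒ (Valid.across v i j d e ne)) }
        ; exclusion = λ {i} {j} i≢j eqi eqj → case Valid.machine v i j i≢j (side≡server eqi) (side≡server eqj) of λ
            { (inj₁ le) → inj₁ (≤start⇒ le) ; (inj₂ le) → inj₂ (≤start⇒ le) }
        }

      respects⇒valid : Respects C → Valid σ
      respects⇒valid r = record
        { machine = λ i j i≢j eqi eqj → case exclusion i≢j (cong isCloud eqi) (cong isCloud eqj) of λ
            { (inj₁ le) → inj₁ (⇒≤start le) ; (inj₂ le) → inj₂ (⇒≤start le) }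
        ; same = λ i j e eq → let d , del = edge⁻ e in ⇒≤start (≤-trans (+-monoˡ-≤ (time j) (m≤m+n (C i) (transfer i j d))) (precedence del))
        ; across = λ i j d e ne → ⇒≤start (subst (λ x → C i + x + time j ≤ C j) (transfer-across d ne) (precedence e))
        }
        where open Respects r

module _ (I : Instance) where
  open Instance I
  open Items I

  -- The table yields a side for every item, a schedule needs a function on jobs. As no job occurs
  -- twice, the function can be patched item by item without disturbing earlier values.
  recover : ∀ {A} → Unique (jobs A) → ∀ β → map proj₁ β ≡ map itemOf A → ∃[ χ ] β ≡ Plans.plan I χ A
  recover {[]}    uq         []            eq = (λ _ → false) , refl
  recover {a ∷ A} (a∉ ∷ uq) ((i , σ) ∷ β) eq with ∷-injective eq
  ... | refl , eq′ with recover uq β eq′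
  ... | χ , β≡ = χ′ , cong₂ _∷_ (cong (itemOf a ,_) (sym at-a))
      (trans β≡ (map-cong-local (All-map⁻′ a∉)))
    where
    χ′ : Job → Bool
    χ′ j = if does (j Fin.≟ proj₁ a) then σ else χ j
    at-a : χ′ (proj₁ a) ≡ σ
    at-a with proj₁ a Fin.≟ proj₁ a
    ... | yes _ = refl
    ... | no ne = ⊥-elim (ne refl)
    elsewhere : ∀ {j} → proj₁ a ≢ j → χ j ≡ χ′ j
    elsewhere {j} ne with j Fin.≟ proj₁ a
    ... | yes eq = ⊥-elim (ne (sym eq))
    ... | no _   = refl
    All-map⁻′ : ∀ {B} → All (proj₁ a ≢_) (jobs B) → All (λ x → (itemOf x , χ (proj₁ x)) ≡ (itemOf x , χ′ (proj₁ x))) B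
    All-map⁻′ ne = All.map (λ {x} ne → cong (itemOf x ,_) (elsewhere ne)) (All-map⁻ ne)

  module _ (χ : Job → Bool) where
    open Plans I χ

    sideCost : Job → ℕ
    sideCost j = if χ j then sum (cloudTimesOf j) else 0

    planCost-plan : ∀ A → planCost (plan A) ≡ sum (map sideCost (jobs A))
    planCost-plan []      = refl
    planCost-plan (a ∷ A) = trans (+-comm (planCost (plan A)) (sideCost (proj₁ a))) (cong (sideCost (proj₁ a) +_) (planCost-plan A))

    allowed-plan : ∀ A → (∀ j → χ j ≡ true → cloudTimesOf j ≢ []) → All Allowed (plan A)
    allowed-plan A h = All-map⁺ (All.tabulate λ {a} _ → h (proj₁ a))

    allowed-job : ∀ {A j} → All Allowed (plan A) → j ∈ jobs A → χ j ≡ true → cloudTimesOf j ≢ []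
    allowed-job {_ ∷ _} (al ∷ _)  (here refl) = al
    allowed-job {_ ∷ _} (_ ∷ als) (there j∈)  = allowed-job als j∈

  sum-jobs : ∀ {A} → Unique (jobs A) → (∀ j → j ∈ jobs A) → (f : Job → ℕ) → sum (map f (jobs A)) ≡ sum (tabulate f)
  sum-jobs {A} uq complete f = trans (sum-↭ (↭-map⁺ f permutation)) (cong sum (map-tabulate id f))
    where
    permutation : jobs A ↭ allFin #jobs
    permutation = ∼bag⇒↭ (unique∧set⇒bag uq (allFin⁺ #jobs) (λ {j} → mk⇔ (λ _ → ∈-allFin j) (λ _ → complete j)))

-- The approximation ratio

-- With the denominator d, the assumption says that the ratio is at most 2 + 1 / d, and 1 / d is at
-- most ε because the numerator of ε is at least 1.
ratio-ℚ : ∀ n d-1 .(c : Coprime (suc n) (suc d-1)) m m′ → suc d-1 * m ≤ (2 * suc d-1 + 1) * m′ →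
          fromℕℚ m ℚ.≤ (fromℕℚ 2 ℚ.+ mkℚ (ℤ.+ suc n) d-1 c) ℚ.* fromℕℚ m′
ratio-ℚ n d-1 c m m′ le = ℚ.toℚᵘ-cancel-≤ (begin
  ℚ.toℚᵘ (fromℕℚ m)                                       ≃⟨ ℚ.toℚᵘ-fromℚᵘ (mkℚᵘ (ℤ.+ m) 0) ⟩
  mkℚᵘ (ℤ.+ m) 0                                            ≤⟨ *≤* integers ⟩
  (mkℚᵘ (ℤ.+ 2) 0 ℚᵘ.+ mkℚᵘ (ℤ.+ suc n) d-1) ℚᵘ.* mkℚᵘ (ℤ.+ m′) 0
    ≃⟨ ℚᵘ.*-cong (ℚᵘ.+-cong (ℚ.toℚᵘ-fromℚᵘ (mkℚᵘ (ℤ.+ 2) 0)) (ℚᵘ.≃-refl {ℚ.toℚᵘ ε})) (ℚ.toℚᵘ-fromℚᵘ (mkℚᵘ (ℤ.+ m′) 0)) ⟨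
  (ℚ.toℚᵘ (fromℕℚ 2) ℚᵘ.+ ℚ.toℚᵘ ε) ℚᵘ.* ℚ.toℚᵘ (fromℕℚ m′)
    ≃⟨ ℚᵘ.*-cong (ℚ.toℚᵘ-homo-+ (fromℕℚ 2) ε) ℚᵘ.≃-refl ⟨
  ℚ.toℚᵘ (fromℕℚ 2 ℚ.+ ε) ℚᵘ.* ℚ.toℚᵘ (fromℕℚ m′)         ≃⟨ ℚ.toℚᵘ-homo-* (fromℕℚ 2 ℚ.+ ε) (fromℕℚ m′) ⟨
  ℚ.toℚᵘ ((fromℕℚ 2 ℚ.+ ε) ℚ.* fromℕℚ m′)                  ∎)
  where
  open ℚᵘ.≤-Reasoning
  ε = mkℚ (ℤ.+ suc n) d-1 c
  d = suc d-1
  naturals : m * (1 * d * 1) ≤ (2 * d + suc n * 1) * m′ * 1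
  naturals = ≤-trans (≤-reflexive (lem m d)) (≤-trans le (≤-trans (*-monoˡ-≤ m′ (+-monoʳ-≤ (2 * d) (s≤s z≤n)))
    (≤-reflexive (sym (*-identityʳ _)))))
    where
    lem : ∀ m d → m * (1 * d * 1) ≡ d * m
    lem = solve-∀
  numerator : ℤ.+ ((2 * d + suc n * 1) * m′ * 1) ≡ ((ℤ.+ 2 ℤ.* ℤ.+ d ℤ.+ ℤ.+ suc n ℤ.* ℤ.+ 1) ℤ.* ℤ.+ m′) ℤ.* ℤ.+ 1
  numerator = trans (ℤ.pos-* ((2 * d + suc n * 1) * m′) 1) (cong (ℤ._* ℤ.+ 1) (trans (ℤ.pos-* (2 * d + suc n * 1) m′)
    (cong (ℤ._* ℤ.+ m′) (cong₂ ℤ._+_ (ℤ.pos-* 2 d) (ℤ.pos-* (suc n) 1)))))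
  integers : ℤ.+ m ℤ.* ℤ.+ (1 * d * 1) ℤ.≤ ((ℤ.+ 2 ℤ.* ℤ.+ d ℤ.+ ℤ.+ suc n ℤ.* ℤ.+ 1) ℤ.* ℤ.+ m′) ℤ.* ℤ.+ 1
  integers = subst₂ ℤ._≤_ (ℤ.pos-* m (1 * d * 1)) numerator (ℤ.+≤+ naturals)

implement : ∀ {𝒢 α} (f : Tm (inputTy ∷ []) (list (bool ⊗ num))) →
            (∀ I → 𝒢 I → ∀ b → ∃[ x ] encodeInput I b ≡ enc inputTy x ×
              Σ (Schedule I) λ σ → enc (list (bool ⊗ num)) (⟦ f ⟧ (x , tt)) ≡ encodeSchedule σ × Approximates α b σ) →
            PolyTimeApproximation 𝒢 α
implement f solves with monomial-bound (pol f)
... | c , k , bound = record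
  { program = code f place
  ; c = c
  ; k = k
  ; correct = λ I I∈ b → let x , x≡ , σ , out≡ , approx = solves I I∈ b in σ , result x≡ out≡ , approx
  }
  where
  place : Place (inputTy ∷ []) 1
  place here = zero
  result : ∀ {x v w} → v ≡ enc inputTy x → enc (list (bool ⊗ num)) (⟦ f ⟧ (x , tt)) ≡ w →
           code f place on v outputs w within (c * size v ^ k + c)
  result {x} refl refl with runs f place (enc inputTy x ∷ᵥ []ᵥ) (x , tt) (λ { here → refl ; (there ()) })
  ... | τ , d , τ≤ = τ , d , (begin
    τ                                        ≤⟨ τ≤ ⟩
    eval (pol f) (∥_∥ {inputTy} x + 0)       ≡⟨ cong (eval (pol f)) (+-identityʳ (∥_∥ {inputTy} x)) ⟩
    eval (pol f) (∥_∥ {inputTy} x)           ≤⟨ bound (∥_∥ {inputTy} x) (1≤size (enc inputTy x)) ⟩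
    c * ∥_∥ {inputTy} x ^ k                  ≤⟨ m≤m+n _ c ⟩
    c * ∥_∥ {inputTy} x ^ k + c              ∎)
    where open ≤-Reasoning

-- Correctness of the algorithm

module Solution (I : Instance) (ext : IsExtendedChain I) (b d : ℕ) (5<d : 5 < d) where
  open Instance I
  open Items I
  open Schedules I

  A = proj₁ (Chain.layout I ext)
  L = proj₁ (proj₂ (Chain.layout I ext))
  items≡ = proj₂ (proj₂ (Chain.layout I ext))

  unique = layout-unique L
  complete = Complete.complete I ext L

  is : List Item
  is = map itemOf A

  1≤n : 1 ≤ length is
  1≤n = nonempty L
    where
    nonempty : ∀ {u A} → Layout u A → 1 ≤ length (map itemOf A)
    nonempty root         = s≤s z≤n
    nonempty (link _ _)   = s≤s z≤n
    nonempty (fork _ _ _) = s≤s z≤n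

  itemsOf-plan : ∀ χ A → itemsOf (Plans.plan I χ A) ≡ map itemOf A
  itemsOf-plan χ []      = refl
  itemsOf-plan χ (a ∷ A) = cong (itemOf a ∷_) (itemsOf-plan χ A)

  -- This plan costs nothing, so there is a feasible plan for every budget and the search never
  -- comes back empty.
  all-server : Feasible b is (Plans.plan I (λ _ → false) A)
  all-server = feasible (itemsOf-plan _ A) (allowed-plan I (λ _ → false) A (λ _ ()))
    (≤-trans (≤-reflexive (trans (planCost-plan I (λ _ → false) A) (free (jobs A)))) z≤n)
    where
    free : ∀ js → sum (map (sideCost I (λ _ → false)) js) ≡ 0
    free []       = refl
    free (j ∷ js) = free js

  best : ∃[ x ] plans d b is ≡ x ∷ []
  best = best-exists d b 5<d is 1≤n all-server

  V = proj₁ (proj₁ best)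
  β = proj₂ (proj₁ best)

  best∈ : proj₁ best ∈ plans d b is
  best∈ = subst (proj₁ best ∈_) (sym (proj₂ best)) (here refl)

  β-feasible = proj₂ (best-feasible d b 5<d is 1≤n best∈)
  V≡ = proj₁ (best-feasible d b 5<d is 1≤n best∈)

  χ₀ : Job → Bool
  χ₀ = proj₁ (recover I unique β (Feasible.items β-feasible))

  β≡ : β ≡ Plans.plan I χ₀ A
  β≡ = proj₂ (recover I unique β (Feasible.items β-feasible))

  open Construct I χ₀ L complete using (C; respects; makespan≤; output≡; M)

  σ : Schedule I
  σ = record { side = λ j → sideOf (χ₀ j) ; C = C }

  χσ : ∀ j → χ σ j ≡ χ₀ j
  χσ j = isCloud-sideOf (χ₀ j)

  finite : Finite σ
  finite j eq = finite-toL (allowed-job I χ₀ (subst (All Allowed) β≡ (Feasible.allowed β-feasible)) (complete j)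
    (trans (sym (χσ j)) (cong isCloud eq)))

  respects-σ : Plans.Respects I (χ σ) C
  respects-σ = record
    { precedence = λ {i} {j} {e} eq → subst₂ (λ a b → C i + (if differ a b then e else 0) + (if b then sum (cloudTimesOf j) else p-s j) ≤ C j)
        (sym (χσ i)) (sym (χσ j)) (precedence eq)
    ; exclusion = λ {i} {j} i≢j eqi eqj → subst₂ (λ a b → C i + (if b then sum (cloudTimesOf j) else p-s j) ≤ C j
                                                        ⊎ C j + (if a then sum (cloudTimesOf i) else p-s i) ≤ C i)
        (sym (χσ i)) (sym (χσ j)) (exclusion i≢j (trans (sym (χσ i)) eqi) (trans (sym (χσ j)) eqj))
    }
    where open Plans.Respects respects

  valid : Valid σ
  valid = respects⇒valid σ finite respects-σ

  cost≤ : cost σ ≤⁺ just b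
  cost≤ = subst (_≤⁺ just b) (sym (cost≡ σ finite)) [ begin
    sum (tabulate (jobCost σ))                   ≡⟨ cong sum (tabulate-cong (λ j → cong (λ a → if a then sum (cloudTimesOf j) else 0) (χσ j))) ⟩
    sum (tabulate (sideCost I χ₀))               ≡⟨ sum-jobs I unique complete (sideCost I χ₀) ⟨
    sum (map (sideCost I χ₀) (jobs A))           ≡⟨ planCost-plan I χ₀ A ⟨
    planCost (Plans.plan I χ₀ A)                 ≡⟨ cong planCost β≡ ⟨
    planCost β                                   ≤⟨ Feasible.cheap β-feasible ⟩
    b                                            ∎ ]
    where
    open ≤-Reasoning

  makespan≤V : C t ≤ V
  makespan≤V = ≤-trans makespan≤ (≤-reflexive (trans (cong (value ∘ unscaled) (sym β≡)) (sym V≡)))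

  output-σ : enc (list (bool ⊗ num)) (algorithm d (inputOf b)) ≡ encodeSchedule σ
  output-σ = trans (cong (enc (list (bool ⊗ num))) computed)
    (sym (tabulated-enc (bool ⊗ num) (λ j → χ₀ j , C j) (λ j → cong (λ v → pair v (nat (C j))) (encode-side (χ₀ j)))))
    where
    encode-side : ∀ a → encodeSide (sideOf a) ≡ fromBool a
    encode-side true  = refl
    encode-side false = refl
    render : ℕ × Plan → List (Bool × ℕ)
    render x = output J (timeline (suc (length (proj₂ x))) (proj₂ x))
    computed : algorithm d (inputOf b) ≡ tabulate (λ j → χ₀ j , C j)
    computed = begin
      solve d (records #jobs (tabulate p-s) (tabulate cloudTimesOf) (tabulate (λ i → tabulate (delays i)))) (toℕ s) b
        ≡⟨ cong (λ rs → solve d rs (toℕ s) b) records≡ ⟩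
      concatMap render (plans d b (allItems J (toℕ s)))
        ≡⟨ cong (λ xs → concatMap render (plans d b xs)) items≡ ⟩
      concatMap render (plans d b is)
        ≡⟨ cong (concatMap render) (proj₂ best) ⟩
      render (V , β) ++ []
        ≡⟨ ++-identityʳ (render (V , β)) ⟩
      render (V , β)
        ≡⟨ cong (λ α → render (V , α)) β≡ ⟩
      output J (timeline M (Plans.plan I χ₀ A))
        ≡⟨ output≡ ⟩
      tabulate (λ j → χ₀ j , C j) ∎
      where open ≡-Reasoning

  module _ (σ′ : Schedule I) (within : WithinBudget σ′ b) where
    open Schedule σ′ using (side) renaming (C to C′)

    finite′ : Finite σ′
    finite′ = cost⇒finite σ′ (proj₂ within)

    server-s : χ σ′ s ≡ false
    server-s with side s in eq
    ... | server = refl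
    ... | cloud  = case trans (sym (finite′ s eq)) (Equivalence.from (p-c-∞ s) (inj₁ refl)) of λ ()

    plan′ : Plan
    plan′ = Plans.plan I (χ σ′) A

    feasible′ : Feasible b is plan′
    feasible′ = feasible (itemsOf-plan (χ σ′) A) (allowed-plan I (χ σ′) A cloud-allowed) (begin
      planCost plan′                              ≡⟨ planCost-plan I (χ σ′) A ⟩
      sum (map (jobCost σ′) (jobs A))             ≡⟨ sum-jobs I unique complete (jobCost σ′) ⟩
      sum (tabulate (jobCost σ′))                 ≤⟨ [≤]-injective (subst (_≤⁺ just b) (cost≡ σ′ finite′) (proj₂ within)) ⟩
      b                                           ∎)
      where
      open ≤-Reasoning
      cloud-allowed : ∀ j → χ σ′ j ≡ true → cloudTimesOf j ≢ []
      cloud-allowed j eq with side j in eq′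
      ... | cloud = subst (λ m → toL m ≢ []) (sym (finite′ j eq′)) λ ()

    approximation : d * C t ≤ (d + 5) * (2 * C′ t)
    approximation = begin
      d * C t                                ≤⟨ *-monoʳ-≤ d makespan≤V ⟩
      d * V                                  ≤⟨ best-ratio d b 5<d is 1≤n feasible′ best∈ ⟩
      (d + 5) * value (unscaled plan′)       ≤⟨ *-monoʳ-≤ (d + 5) (Plans.LowerBound.value≤ I (χ σ′) (valid⇒respects σ′ finite′ (proj₁ within)) server-s L) ⟩
      (d + 5) * (2 * C′ t)                   ∎
      where open ≤-Reasoning

  solution : ∀ {α} → (∀ σ′ → WithinBudget σ′ b → fromℕℚ (makespan σ) ℚ.≤ α ℚ.* fromℕℚ (makespan σ′)) →
             ∃[ x ] encodeInput I b ≡ enc inputTy x ×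
               Σ (Schedule I) λ σ → enc (list (bool ⊗ num)) (algorithm d x) ≡ encodeSchedule σ × Approximates α b σ
  solution ratio = inputOf b , encodeInput≡ b , σ , output-σ , record { withinBudget = valid , cost≤ ; ratio = ratio }

theorem5 : ∀ (ε : ℚ) → 0ℚ ℚ.< ε → PolyTimeApproximation IsExtendedChain (fromℕℚ 2 ℚ.+ ε)
theorem5 (mkℚ (ℤ.+ zero)   q c) (ℚ.*<* (ℤ.+<+ ()))
theorem5 (mkℚ (ℤ.-[1+ n ]) q c) (ℚ.*<* ())
theorem5 (mkℚ (ℤ.+ suc n)  q c) _ = implement (algorithmₜ d) λ I ext b →
  Solution.solution I ext b d 5<d λ σ′ within →
    ratio-ℚ n q c (makespan (Solution.σ I ext b d 5<d)) (makespan σ′)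
      (scaled (makespan (Solution.σ I ext b d 5<d)) (makespan σ′) (Solution.approximation I ext b d 5<d σ′ within))
  where
  -- Rounding gives the factor 1 + 5 / d and the lower bounds give 2, together 2 + 10 / d; ten times
  -- the denominator of ε makes this 2 plus the reciprocal of that denominator.
  d = 10 * suc q
  5<d : 5 < d
  5<d = ≤-trans (m≤m+n 6 4) (*-monoʳ-≤ 10 (s≤s (z≤n {q})))
  scaled : ∀ m m′ → d * m ≤ (d + 5) * (2 * m′) → suc q * m ≤ (2 * suc q + 1) * m′
  scaled m m′ le = *-cancelˡ-≤ 10 (begin
    10 * (suc q * m)               ≡⟨ *-assoc 10 (suc q) m ⟨
    d * m                          ≤⟨ le ⟩
    (d + 5) * (2 * m′)             ≡⟨ lem (suc q) m′ ⟩
    10 * ((2 * suc q + 1) * m′)    ∎)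
    where
    open ≤-Reasoning
    lem : ∀ q m → (10 * q + 5) * (2 * m) ≡ 10 * ((2 * q + 1) * m)
    lem = solve-∀
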